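{- Let $m>0$ and $0<i<k-1$ be integers. If the class $\Sigma_i^p\,\mathbf{\Delta}\,\mathrm{DIFF}_m(\Sigma_k^p)$ is closed under complementation, then $\mathrm{DIFF}_m(\Sigma_k^p) = \mathrm{coDIFF}_m(\Sigma_k^p)$.
   Context: Polynomial hierarchy: $\Sigma_0^p=\mathrm{P}$, $\Sigma_1^p=\mathrm{NP}$, $\Sigma_k^p=\mathrm{NP}^{\Sigma_{k-1}^p}$ for $k>1$. For sets $C,D$, $C\Delta D=(C-D)\cup(D-C)$, and for classes $\mathcal{C},\mathcal{D}$, $\mathcal{C}\,\mathbf{\Delta}\,\mathcal{D}=\{L\mid(\exists C\in\mathcal{C})(\exists D\in\mathcal{D})[L=C\Delta D]\}$. A class $\mathcal{E}$ is closed under complementation if $L\in\mathcal{E}$ implies $\overline{L}\in\mathcal{E}$. Boolean hierarchy over a class $\mathcal{C}$: $\mathrm{DIFF}_1(\mathcal{C})=\mathcal{C}$; for $j\ge1$, $\mathrm{DIFF}_{j+1}(\mathcal{C})=\{L\mid (\exists L_1\in\mathcal{C})(\exists L_2\in\mathrm{DIFF}_j(\mathcal{C}))[L=L_1-L_2]\}$; $\mathrm{coDIFF}_j(\mathcal{C})=\{L\mid \overline{L}\in\mathrm{DIFF}_j(\mathcal{C})\}$. -}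

module Defs where

open import Data.Nat using (ℕ; zero; suc; _+_; _*_; _^_; _≤_)
open import Data.Fin using (Fin; zero; suc)
open import Data.Bool using (Bool; true; false; not; _∧_; _xor_)
open import Data.List using (List; []; _∷_; length; map; replicate; _++_)
open import Data.List.Membership.Propositional using (_∈_)
open import Data.Product using (Σ; Σ-syntax; ∃; ∃-syntax; _×_; _,_)
open import Data.Empty using (⊥)
open import Relation.Binary.PropositionalEquality using (_≡_; _≢_)

Str : Set
Str = List Bool

-- A language is (the characteristic function of) a set of binary strings.
-- All languages occurring here (subsets of the polynomial hierarchy and
-- Boolean combinations thereof) are decidable, so Bool-valued is faithful.
Lang : Set
Lang = Str → Bool

_≐_ : Lang → Lang → Set
L ≐ L' = ∀ x → L x ≡ L' x

Class : Set₁
Class = Lang → Set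

complement : Lang → Lang
complement L x = not (L x)

-- Oracle (nondeterministic) Turing machines
--
-- Two one-way-infinite tapes: a work tape (which initially holds the
-- input) and an oracle query tape over {blank,0,1}.  The transition
-- relation is given as a list of options (nondeterminism).  Entering the
-- query state moves, in one step, to state 'yes' or 'no' according to
-- whether the oracle contains the string written on the query tape
-- (read from cell 0 up to the first blank); the query tape is then erased.

data Move : Set where
  left right stay : Move

record Tape (n : ℕ) : Set where
  constructor tape
  field
    cells : List (Fin (suc n))   -- zero = blank
    pos   : ℕ

readL : ∀ {n} → List (Fin (suc n)) → ℕ → Fin (suc n)
readL []       _       = zero
readL (a ∷ as) zero    = a
readL (a ∷ as) (suc k) = readL as k

writeL : ∀ {n} → List (Fin (suc n)) → ℕ → Fin (suc n) → List (Fin (suc n))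
writeL []       zero    b = b ∷ []
writeL []       (suc k) b = zero ∷ writeL [] k b
writeL (a ∷ as) zero    b = b ∷ as
writeL (a ∷ as) (suc k) b = a ∷ writeL as k b

movePos : Move → ℕ → ℕ
movePos left  zero    = zero
movePos left  (suc k) = k
movePos right k       = suc k
movePos stay  k       = k

read : ∀ {n} → Tape n → Fin (suc n)
read (tape cs p) = readL cs p

update : ∀ {n} → Fin (suc n) → Move → Tape n → Tape n
update b d (tape cs p) = tape (writeL cs p b) (movePos d p)

-- Work-tape alphabet: Fin (3 + Γ), with 0 = blank, 1 = bit 0, 2 = bit 1.
-- Query-tape alphabet: Fin 3, with 0 = blank, 1 = bit 0, 2 = bit 1.
encodeBit : ∀ {Γ} → Bool → Fin (3 + Γ)
encodeBit false = suc zero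
encodeBit true  = suc (suc zero)

decodeQuery : List (Fin 3) → Str
decodeQuery []                    = []
decodeQuery (zero ∷ _)            = []
decodeQuery (suc zero ∷ cs)       = false ∷ decodeQuery cs
decodeQuery (suc (suc zero) ∷ cs) = true ∷ decodeQuery cs

record OTM : Set where
  field
    nQ     : ℕ
    Γ      : ℕ
    start  : Fin nQ
    accept : Fin nQ
    query  : Fin nQ
    yes    : Fin nQ
    no     : Fin nQ
    δ      : Fin nQ → Fin (3 + Γ) → Fin 3 →
             List (Fin nQ × Fin (3 + Γ) × Move × Fin 3 × Move)

module _ (M : OTM) where
  open OTM M

  record Config : Set where
    constructor config
    field
      state : Fin nQ
      work  : Tape (2 + Γ)
      qtape : Tape 2

  initial : Str → Config
  initial x = config start (tape (map encodeBit x) 0) (tape [] 0)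

  data Step (A : Lang) : Config → Config → Set where
    ask   : ∀ {w qs p} →
            Step A (config query w (tape qs p))
                   (config (Data.Bool.if A (decodeQuery qs) then yes else no)
                           w (tape [] 0))
    trans : ∀ {q w t q' a dw b dt} →
            q ≢ query → q ≢ accept →
            (q' , a , dw , b , dt) ∈ δ q (read w) (read t) →
            Step A (config q w t) (config q' (update a dw w) (update b dt t))

  data AcceptsIn (A : Lang) : ℕ → Config → Set where
    halt : ∀ {n c} → Config.state c ≡ accept → AcceptsIn A n c
    step : ∀ {n c c'} → Step A c c' → AcceptsIn A n c' → AcceptsIn A (suc n) c

Deterministic : OTM → Set
Deterministic M = ∀ q a b → length (OTM.δ M q a b) ≤ 1

poly : ℕ → ℕ → ℕ
poly c n = c * n ^ c + c

AcceptsPoly : OTM → Lang → Lang → Set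
AcceptsPoly M A L =
  Σ[ c ∈ ℕ ] (∀ x → (L x ≡ true → AcceptsIn M A (poly c (length x)) (initial M x))
                   × (AcceptsIn M A (poly c (length x)) (initial M x) → L x ≡ true))

emptyLang : Lang
emptyLang _ = false

P : Class
P L = Σ[ M ∈ OTM ] (Deterministic M × AcceptsPoly M emptyLang L)

NP : Class
NP L = Σ[ M ∈ OTM ] AcceptsPoly M emptyLang L

NP^ : Class → Class
NP^ C L = Σ[ A ∈ Lang ] (C A × Σ[ M ∈ OTM ] AcceptsPoly M A L)

Sigma : ℕ → Class
Sigma zero                = P
Sigma (suc zero)          = NP
Sigma (suc (suc k))       = NP^ (Sigma (suc k))

_Δ_ : Class → Class → Class
(C Δ D) L = Σ[ L₁ ∈ Lang ] Σ[ L₂ ∈ Lang ]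
              (C L₁ × D L₂ × L ≐ (λ x → L₁ x xor L₂ x))

ClosedUnderComplement : Class → Set
ClosedUnderComplement E = ∀ L → E L → E (complement L)

-- Boolean hierarchy; only DIFF j for j ≥ 1 is meaningful (DIFF 0 is empty).
DIFF : ℕ → Class → Class
DIFF zero          C L = ⊥
DIFF (suc zero)    C L = C L
DIFF (suc (suc j)) C L = Σ[ L₁ ∈ Lang ] Σ[ L₂ ∈ Lang ]
                           (C L₁ × DIFF (suc j) C L₂ × L ≐ (λ x → L₁ x ∧ not (L₂ x)))

coDIFF : ℕ → Class → Class
coDIFF j C L = DIFF j C (complement L)

_≡C_ : Class → Class → Set
C ≡C D = ∀ L → (C L → D L) × (D L → C L)

{-# OPTIONS --safe #-}
-- Let D ∈ DIFF_m(Σ_k).  The m members of Σ_k defining D can be given a common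
-- oracle, hence a chain of oracles descending to one S ∈ Σ_i.  Apply the closure
-- hypothesis to {⟨u,x⟩ | u ∈ S xor x ∈ D}: its complement is S' Δ D' with S' ∈ Σ_i
-- and D' ∈ DIFF_m(Σ_k).  Call u bad for x if u ∈ S ⇔ ⟨u,x⟩ ∈ S'; then x ∉ D ⇔
-- ⟨u,x⟩ ∈ D'.  If x has no short bad u, then u ↦ ⟨u,x⟩ reduces the complement of
-- S to S' on all strings queried while deciding x ∈ D, so every level above Σ_i
-- drops by one and x ∉ D is decided with an oracle in Σ_{k-1}.  Since i < k-1, the
-- existence of a bad u is a Σ_{k-1} question.  Write D' as the difference of a
-- decreasing sequence D'_1 ⊇ … ⊇ D'_m in Σ_k.  The sets {x | ∃ bad u, ⟨u,x⟩ ∈ D'_j},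
-- the first enlarged by the x ∉ D without bad u, witness that the complement of
-- D is in DIFF_m(Σ_k): all bad u for x give the same parity, hence so does the
-- largest level reached.
--
-- Membership in the classes NP^A is established by programs in a small
-- nondeterministic register language compiled to oracle machines.  Such a program
-- simulates a given machine by guessing its oracle answers, which are recorded and
-- verified afterwards; replacing the verification changes the oracle.
module Submission where
open import Defs
open import Data.Nat using (ℕ; zero; suc; nonZero; _≟_; _<_; _+_; _*_; _^_; _≤_; z≤n; s≤s)
open import Data.Nat.Properties
  using (≤-refl; ≤-trans; ≤-reflexive; ≤-pred; m≤m+n; m≤n+m; n≤1+n; m≤n⇒m≤1+n; +-mono-≤; *-mono-≤; *-monoˡ-≤;
         *-monoʳ-≤; +-monoʳ-≤; +-monoˡ-≤; +-assoc; +-comm; +-identityʳ; +-suc; +-cancelˡ-≤; *-assoc; *-identityˡ;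
         *-identityʳ; ^-monoˡ-≤; ^-monoʳ-≤; ^-distribˡ-+-*; ^-*-assoc; m≤m*n; m≤n⇒∃[o]m+o≡n; m^n>0; *-distribʳ-+; ^-zeroˡ)
open import Data.Nat.Solver using (module +-*-Solver)
open import Data.Fin using (Fin; zero; suc; splitAt; join; combine; remQuot; #_)
open import Data.Fin.Properties using (splitAt-join; remQuot-combine) renaming (_≟_ to _≟F_)
open import Data.Bool using (Bool; true; false; not; _∧_; _∨_; _xor_; if_then_else_)
open import Data.Bool.Properties using (not-involutive; ∨-zeroʳ; ∨-identityʳ; ∧-identityʳ; ∧-zeroʳ)
open import Data.Bool.ListAction using (any)
open import Data.List using (List; []; _∷_; length; map; _++_; _ʳ++_; reverse)
open import Data.List.Properties using (length-map; length-++; ++-identityʳ; ʳ++-defn; ++-ʳ++; ʳ++-ʳ++; length-ʳ++; map-ʳ++; length-reverse) renaming (++-assoc to ++-assocL)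
open import Data.List.Membership.Propositional using (_∈_)
open import Data.List.Membership.Propositional.Properties using (∈-map⁻; ∈-map⁺)
open import Data.List.Relation.Unary.Any using (here; there)
open import Data.List.Relation.Unary.All using (All; []; _∷_) renaming (map to mapAll)
open import Data.Vec using (Vec; []; _∷_; lookup; _[_]≔_; replicate; sum)
open import Data.Vec.Properties using (map-[]≔; lookup-map; lookup∘update; []≔-idempotent; []≔-lookup)
open import Data.Product using (Σ; Σ-syntax; ∃; ∃-syntax; _×_; _,_; proj₁; proj₂)
open import Data.Sum using (_⊎_; inj₁; inj₂)
open import Data.Maybe using (Maybe; just; nothing; is-just; maybe′)
open import Data.Empty using (⊥; ⊥-elim)
open import Data.Unit using (⊤; tt)
open import Function using (_∘_; id)
open import Relation.Nullary using (yes; no; does)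
open import Relation.Binary.PropositionalEquality using (_≡_; _≢_; refl; sym; cong; cong₂; subst) renaming (trans to infixr 6 _∙_)

-- The replaced verification is what gains a level. A record of guessed answers is correct when each
-- tagged question (b, q) in it passes a test, so a machine can be run relative to any
-- nondeterministic tests for yes-answers and no-answers. For the oracle S the no-answers are the
-- obstacle; for an x without short bad u they are certified by membership of ⟨u,x⟩ in S', so
-- queries to S give way to tests that only use an oracle below S. As this works for particular x
-- only, x accompanies every query through the whole chain, which is why the rebuilt languages take
-- pairs. The passage to a decreasing sequence is forced because ∃ does not commute with
-- differences: the projections of arbitrary sets could be witnessed by incompatible u. A language
-- is a Boolean function, so every language introduced needs a decision procedure: `runs` for
-- acceptance with guessed answers, `anyStr` for the bounded quantifier. In return, the case
-- distinction on badness is constructive.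

module V = Data.Vec
module Sum = Data.Sum
module Prod = Data.Product

-- Finite types

-- Only a left inverse of `enc` is asked for, so `size` may exceed the number of elements. Surplus
-- codes are harmless as states or symbols of a machine.
record Finite (A : Set) : Set where
  field
    size    : ℕ
    enc     : A → Fin size
    dec     : Fin size → A
    dec-enc : ∀ a → dec (enc a) ≡ a

  enc-injective : ∀ {a b} → enc a ≡ enc b → a ≡ b
  enc-injective {a} {b} e = sym (dec-enc a) ∙ cong dec e ∙ dec-enc b

open Finite

finFin : ∀ n → Finite (Fin n)
finFin n = record { size = n ; enc = id ; dec = id ; dec-enc = λ _ → refl }

finRetract : ∀ {A B} (f : A → B) (g : B → A) → (∀ a → g (f a) ≡ a) → Finite B → Finite A
finRetract f g gf F = record
  { size = size F ; enc = enc F ∘ f ; dec = g ∘ dec F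
  ; dec-enc = λ a → cong g (dec-enc F (f a)) ∙ gf a }

fin⊥ : Finite ⊥
fin⊥ = finRetract (λ ()) (λ ()) (λ ()) (finFin 0)

fin⊤ : Finite ⊤
fin⊤ = finRetract {B = Fin 1} (λ _ → zero) (λ _ → tt) (λ _ → refl) (finFin 1)

fin⊎ : ∀ {A B} → Finite A → Finite B → Finite (A ⊎ B)
fin⊎ {A} {B} F G = record
  { size = size F + size G ; enc = λ s → join (size F) (size G) (Sum.map (enc F) (enc G) s)
  ; dec = λ i → Sum.map (dec F) (dec G) (splitAt (size F) i) ; dec-enc = lemma }
  where
  lemma : ∀ s → Sum.map (dec F) (dec G) (splitAt (size F) (join (size F) (size G) (Sum.map (enc F) (enc G) s))) ≡ s
  lemma s rewrite splitAt-join (size F) (size G) (Sum.map (enc F) (enc G) s) with s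
  ... | inj₁ a = cong inj₁ (dec-enc F a)
  ... | inj₂ b = cong inj₂ (dec-enc G b)

fin× : ∀ {A B} → Finite A → Finite B → Finite (A × B)
fin× {A} {B} F G = record
  { size = size F * size G ; enc = λ s → combine (enc F (proj₁ s)) (enc G (proj₂ s))
  ; dec = λ i → Prod.map (dec F) (dec G) (remQuot (size G) i) ; dec-enc = lemma }
  where
  lemma : ∀ s → Prod.map (dec F) (dec G) (remQuot (size G) (combine (enc F (proj₁ s)) (enc G (proj₂ s)))) ≡ s
  lemma (a , b) = cong (Prod.map (dec F) (dec G)) (remQuot-combine (enc F a) (enc G b)) ∙ cong₂ _,_ (dec-enc F a) (dec-enc G b)

finMaybe : ∀ {A} → Finite A → Finite (Maybe A)
finMaybe F = finRetract {B = ⊤ ⊎ _}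
  (λ { nothing → inj₁ tt ; (just a) → inj₂ a }) (λ { (inj₁ _) → nothing ; (inj₂ a) → just a })
  (λ { nothing → refl ; (just _) → refl }) (fin⊎ fin⊤ F)

finBool : Finite Bool
finBool = finRetract {B = Fin 2} (λ { false → zero ; true → suc zero }) (λ { zero → false ; (suc _) → true })
  (λ { false → refl ; true → refl }) (finFin 2)

finMove : Finite Move
finMove = finRetract {B = Fin 3}
  (λ { left → zero ; right → suc zero ; stay → suc (suc zero) })
  (λ { zero → left ; (suc zero) → right ; (suc (suc _)) → stay })
  (λ { left → refl ; right → refl ; stay → refl }) (finFin 3)

finVec : ∀ {A} n → Finite A → Finite (Vec A n)
finVec zero    F = finRetract (λ _ → tt) (λ _ → []) (λ { [] → refl }) fin⊤
finVec (suc n) F = finRetract (λ { (a ∷ v) → a , v }) (λ { (a , v) → a ∷ v }) (λ { (_ ∷ _) → refl }) (fin× F (finVec n F))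

nth : ∀ {A : Set} → ℕ → List A → Maybe A
nth _       []       = nothing
nth zero    (a ∷ _)  = just a
nth (suc n) (_ ∷ as) = nth n as

-- For contents before and after writing one cell. Comparing from index `suc m` on leaves the heads
-- of `ys` and `zs` free and lets one of them be empty, which covers a write just past the end.
nth-++-other : ∀ {A : Set} (xs : List A) {ys zs : List A} → (∀ m → nth (suc m) ys ≡ nth (suc m) zs)
             → ∀ n → n ≢ length xs → nth n (xs ++ ys) ≡ nth n (xs ++ zs)
nth-++-other [] e zero ne = ⊥-elim (ne refl)
nth-++-other [] e (suc n) ne = e n
nth-++-other (x ∷ xs) e zero ne = refl
nth-++-other (x ∷ xs) e (suc n) ne = nth-++-other xs e n (ne ∘ cong suc)

module _ {n : ℕ} where
  readL-write-same : ∀ (cs : List (Fin (suc n))) p b → readL (writeL cs p b) p ≡ b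
  readL-write-same [] zero b = refl
  readL-write-same [] (suc p) b = readL-write-same [] p b
  readL-write-same (_ ∷ _) zero b = refl
  readL-write-same (_ ∷ cs) (suc p) b = readL-write-same cs p b

  readL-write-other : ∀ (cs : List (Fin (suc n))) p b m → m ≢ p → readL (writeL cs p b) m ≡ readL cs m
  readL-write-other [] zero b zero ne = ⊥-elim (ne refl)
  readL-write-other [] zero b (suc m) ne = refl
  readL-write-other [] (suc p) b zero ne = refl
  readL-write-other [] (suc p) b (suc m) ne = readL-write-other [] p b m (ne ∘ cong suc)
  readL-write-other (_ ∷ _) zero b zero ne = ⊥-elim (ne refl)
  readL-write-other (_ ∷ _) zero b (suc m) ne = refl
  readL-write-other (_ ∷ _) (suc p) b zero ne = refl
  readL-write-other (_ ∷ cs) (suc p) b (suc m) ne = readL-write-other cs p b m (ne ∘ cong suc)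

-- Trailing blanks make the list representing a tape ambiguous; decoding stops at the first blank
-- and hence depends on the cells alone.
decodeQuery-cong : ∀ cs cs' → (∀ n → readL cs n ≡ readL cs' n) → decodeQuery cs ≡ decodeQuery cs'
decodeQuery-cong [] [] e = refl
decodeQuery-cong [] (c ∷ cs') e with refl ← e 0 = refl
decodeQuery-cong (c ∷ cs) [] e with refl ← e 0 = refl
decodeQuery-cong (zero ∷ cs) (c' ∷ cs') e with refl ← e 0 = refl
decodeQuery-cong (suc zero ∷ cs) (c' ∷ cs') e with refl ← e 0 = cong (false ∷_) (decodeQuery-cong cs cs' (e ∘ suc))
decodeQuery-cong (suc (suc zero) ∷ cs) (c' ∷ cs') e with refl ← e 0 = cong (true ∷_) (decodeQuery-cong cs cs' (e ∘ suc))

-- Compiling stack machines to oracle Turing machines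

AcceptsIn-mono : ∀ {M A m n c} → AcceptsIn M A m c → m ≤ n → AcceptsIn M A n c
AcceptsIn-mono (halt e) m≤n = halt e
AcceptsIn-mono (step s a) (s≤s m≤n) = step s (AcceptsIn-mono a m≤n)

tl : ∀ {A : Set} → List A → List A
tl []      = []
tl (_ ∷ l) = l

length-tl : ∀ {A : Set} (l : List A) → length (tl l) ≤ length l
length-tl [] = z≤n
length-tl (_ ∷ l) = n≤1+n _

-- In `rp ʳ++ t` the reversed list `rp` is what lies left of the head and `t` what lies from the
-- head on; the head position is `length rp`.
nth-ʳ++ : ∀ {A : Set} (rp : List A) k {t} → nth (length rp + k) (rp ʳ++ t) ≡ nth k t
nth-ʳ++ [] k = refl
nth-ʳ++ (a ∷ rp) k {t} = cong (λ j → nth j (rp ʳ++ (a ∷ t))) (sym (+-suc (length rp) k)) ∙ nth-ʳ++ rp (suc k)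

nth-ʳ++-head : ∀ {A : Set} (rp : List A) {t} → nth (length rp) (rp ʳ++ t) ≡ nth 0 t
nth-ʳ++-head rp {t} = cong (λ j → nth j (rp ʳ++ t)) (sym (+-identityʳ _)) ∙ nth-ʳ++ rp 0





nth-ʳ++-other : ∀ {A : Set} (rp : List A) {t t'} → (∀ m → nth (suc m) t ≡ nth (suc m) t')
              → ∀ n → n ≢ length rp → nth n (rp ʳ++ t) ≡ nth n (rp ʳ++ t')
nth-ʳ++-other rp {t} {t'} e n ne =
  cong (nth n) (ʳ++-defn rp) ∙ nth-++-other (reverse rp) e n (λ q → ne (q ∙ length-reverse rp)) ∙ sym (cong (nth n) (ʳ++-defn rp))

ʳ++-ʳ++-[] : ∀ {A : Set} (t rp : List A) → (t ʳ++ rp) ʳ++ [] ≡ rp ʳ++ t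
ʳ++-ʳ++-[] t rp = ʳ++-ʳ++ t ∙ cong (rp ʳ++_) (++-identityʳ t)

bitCells : Str → ℕ → Fin 3
bitCells s n = maybe′ (encodeBit {0}) zero (nth n s)

readL-map : ∀ {A : Set} {n m} (e : A → Fin (suc m)) (s : List A) → readL (map e s) n ≡ maybe′ e zero (nth n s)
readL-map e [] = refl
readL-map {n = zero} e (b ∷ s) = refl
readL-map {n = suc n} e (b ∷ s) = readL-map {n = n} e s

decodeQuery-encodeBit : ∀ s → decodeQuery (map encodeBit s) ≡ s
decodeQuery-encodeBit [] = refl
decodeQuery-encodeBit (false ∷ s) = cong (false ∷_) (decodeQuery-encodeBit s)
decodeQuery-encodeBit (true ∷ s) = cong (true ∷_) (decodeQuery-encodeBit s)

module Stack (Z : Set) (finZ : Finite Z) (r₀ : ℕ) where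

  Sym Reg Store Tops : Set
  Sym   = Bool ⊎ Z
  Reg   = Fin (suc r₀)
  Store = Vec (List Sym) (suc r₀)
  Tops  = Vec (Maybe Sym) (suc r₀)

  col : Store → ℕ → Tops
  col σ n = V.map (nth n) σ

  tops : Store → Tops
  tops σ = col σ 0

  -- Counterpart of `decodeQuery`: the query is the maximal prefix of bits, so other data may lie
  -- below it in the same register.
  toBits : List Sym → Str
  toBits (inj₁ b ∷ l) = b ∷ toBits l
  toBits _            = []

  size# : Store → ℕ
  size# σ = sum (V.map length σ)

  data Op : Set where
    nop  : Op
    push : Reg → Sym → Op
    pop  : Reg → Op

  doOp : Op → Store → Store
  doOp nop        σ = σ
  doOp (push r a) σ = σ [ r ]≔ (a ∷ lookup σ r)
  doOp (pop r)    σ = σ [ r ]≔ tl (lookup σ r)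

  input : Str → Store
  input x = map inj₁ x ∷ replicate r₀ []

  lookup≤size : ∀ {n} (σ : Vec (List Sym) n) r → length (lookup σ r) ≤ sum (V.map length σ)
  lookup≤size (l ∷ σ) zero = m≤m+n _ _
  lookup≤size (l ∷ σ) (suc r) = ≤-trans (lookup≤size σ r) (m≤n+m _ _)

  size-set : ∀ {n} (σ : Vec (List Sym) n) r {l} → length l ≤ suc (length (lookup σ r))
           → sum (V.map length (σ [ r ]≔ l)) ≤ suc (sum (V.map length σ))
  size-set (l ∷ σ) zero p = +-monoˡ-≤ _ p
  size-set (l ∷ σ) (suc r) p = ≤-trans (+-monoʳ-≤ (length l) (size-set σ r p)) (≤-reflexive (+-suc (length l) _))

  size-doOp : ∀ op σ → size# (doOp op σ) ≤ suc (size# σ)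
  size-doOp nop σ = n≤1+n _
  size-doOp (push r a) σ = size-set σ r ≤-refl
  size-doOp (pop r) σ = size-set σ r (m≤n⇒m≤1+n (length-tl (lookup σ r)))

  data Ins (X : Set) : Set where
    ask : Reg → (Bool → Maybe X) → Ins X
    go  : (Tops → List (Op × Maybe X)) → Ins X

  module SM (X : Set) (finX : Finite X) (start : Maybe X) (prog : X → Ins X) where

    data SAcc (A : Lang) : ℕ → Maybe X → Store → Set where
      acc : ∀ {n σ} → SAcc A n nothing σ
      go  : ∀ {n x σ f op y} → prog x ≡ go f → (op , y) ∈ f (tops σ) → SAcc A n y (doOp op σ) → SAcc A (suc n) (just x) σ
      ask : ∀ {n x σ r k} → prog x ≡ ask r k → SAcc A n (k (A (toBits (lookup σ r)))) σ → SAcc A (suc n) (just x) σ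

    SAcc-mono : ∀ {A m n y σ} → SAcc A m y σ → m ≤ n → SAcc A n y σ
    SAcc-mono acc _ = acc
    SAcc-mono (go e i a) (s≤s p) = go e i (SAcc-mono a p)
    SAcc-mono (ask e a) (s≤s p) = ask e (SAcc-mono a p)

    data OSt : Set where
      init Q Y N askL : OSt
      run ret         : Maybe X → OSt
      pushR           : Reg → Sym → Maybe X → OSt
      popR            : Reg → Maybe X → OSt
      popL            : Reg → Maybe Sym → Maybe X → OSt
      askR            : Reg → OSt

    private
      finSym : Finite Sym
      finSym = fin⊎ finBool finZ
      fR : Finite Reg
      fR = finFin _
      OSt′ : Set
      OSt′ = Fin 5 ⊎ (Maybe X ⊎ (Maybe X ⊎ ((Reg × (Sym × Maybe X)) ⊎ ((Reg × Maybe X) ⊎ ((Reg × (Maybe Sym × Maybe X)) ⊎ Reg)))))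
      to : OSt → OSt′
      to init = inj₁ (# 0)
      to Q = inj₁ (# 1)
      to Y = inj₁ (# 2)
      to N = inj₁ (# 3)
      to askL = inj₁ (# 4)
      to (run x) = inj₂ (inj₁ x)
      to (ret x) = inj₂ (inj₂ (inj₁ x))
      to (pushR r a x) = inj₂ (inj₂ (inj₂ (inj₁ (r , a , x))))
      to (popR r x) = inj₂ (inj₂ (inj₂ (inj₂ (inj₁ (r , x)))))
      to (popL r a x) = inj₂ (inj₂ (inj₂ (inj₂ (inj₂ (inj₁ (r , a , x))))))
      to (askR r) = inj₂ (inj₂ (inj₂ (inj₂ (inj₂ (inj₂ r)))))
      from : OSt′ → OSt
      from (inj₁ zero) = init
      from (inj₁ (suc zero)) = Q
      from (inj₁ (suc (suc zero))) = Y
      from (inj₁ (suc (suc (suc zero)))) = N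
      from (inj₁ (suc (suc (suc (suc _))))) = askL
      from (inj₂ (inj₁ x)) = run x
      from (inj₂ (inj₂ (inj₁ x))) = ret x
      from (inj₂ (inj₂ (inj₂ (inj₁ (r , a , x))))) = pushR r a x
      from (inj₂ (inj₂ (inj₂ (inj₂ (inj₁ (r , x)))))) = popR r x
      from (inj₂ (inj₂ (inj₂ (inj₂ (inj₂ (inj₁ (r , a , x))))))) = popL r a x
      from (inj₂ (inj₂ (inj₂ (inj₂ (inj₂ (inj₂ r)))))) = askR r
      from-to : ∀ s → from (to s) ≡ s
      from-to init = refl
      from-to Q = refl
      from-to Y = refl
      from-to N = refl
      from-to askL = refl
      from-to (run x) = refl
      from-to (ret x) = refl
      from-to (pushR r a x) = refl
      from-to (popR r x) = refl
      from-to (popL r a x) = refl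
      from-to (askR r) = refl

    finStates : Finite OSt
    finStates = finRetract to from from-to
      (fin⊎ (finFin 5) (fin⊎ fX (fin⊎ fX (fin⊎ (fin× fR (fin× finSym fX)) (fin⊎ (fin× fR fX) (fin⊎ (fin× fR (fin× (finMaybe finSym) fX)) fR))))))
      where fX = finMaybe finX

    -- Every register is a track of the work tape with its top in cell 0, so a
    -- push or pop shifts the whole track.  The mark is carried by cell 0 only; it
    -- lets the head find the left end, and remembers the asking label across a
    -- query.
    Cell : Set
    Cell = Maybe (Maybe X) × Tops

    finCells : Finite Cell
    finCells = fin× (finMaybe (finMaybe finX)) (finVec _ (finMaybe finSym))

    module Compile (finOSt : Finite OSt) (finCell : Finite Cell) (A : Lang) where

      Γ' : ℕ
      Γ' = size finCell

      encC : Cell → Fin (3 + Γ')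
      encC c = suc (suc (suc (enc finCell c)))

      none : Tops
      none = replicate _ nothing

      -- The first three symbols occur on the input tape only; they are read as
      -- contents of register 0.
      decC : Fin (3 + Γ') → Cell
      decC zero                = nothing , none
      decC (suc zero)          = nothing , none [ zero ]≔ just (inj₁ false)
      decC (suc (suc zero))    = nothing , none [ zero ]≔ just (inj₁ true)
      decC (suc (suc (suc i))) = dec finCell i

      Option′ : Set
      Option′ = OSt × Cell × Move × Fin 3 × Move

      opState : Op → Maybe X → OSt
      opState nop y = run y
      opState (push r a) y = pushR r a y
      opState (pop r) y = popR r y

      δrun : Ins X → X → Cell → Fin 3 → List Option′
      δrun (ask r k) x c b = (askR r , (just (just x) , proj₂ c) , stay , b , stay) ∷ []
      δrun (go f) x c b = map (λ oy → opState (proj₁ oy) (proj₂ oy) , c , stay , b , stay) (f (proj₂ c))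

      δret : OSt → OSt → Maybe (Maybe X) → Cell → Fin 3 → List Option′
      δret s s' (just _) c b = (s , c , stay , b , stay) ∷ []
      δret s s' nothing  c b = (s' , c , left , b , stay) ∷ []

      -- A push carries each displaced symbol one cell to the right until the first blank of the
      -- track. A pop walks to that blank first and shifts on the way back, carrying each symbol one
      -- cell to the left until the marked cell is reached.
      δpush : Reg → Sym → Maybe X → Maybe Sym → Cell → Fin 3 → List Option′
      δpush r a y nothing   (m , v) b = (ret y , (m , v [ r ]≔ just a) , stay , b , stay) ∷ []
      δpush r a y (just a') (m , v) b = (pushR r a' y , (m , v [ r ]≔ just a) , right , b , stay) ∷ []

      δpopR : Reg → Maybe X → Maybe Sym → Cell → Fin 3 → List Option′
      δpopR r y (just _) c b = (popR r y , c , right , b , stay) ∷ []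
      δpopR r y nothing  c b = δret (run y) (popL r nothing y) (proj₁ c) c b

      δpopL : Reg → Maybe Sym → Maybe X → Maybe (Maybe X) → Cell → Fin 3 → List Option′
      δpopL r a y (just _) (m , v) b = (run y , (m , v [ r ]≔ a) , stay , b , stay) ∷ []
      δpopL r a y nothing  (m , v) b = (popL r (lookup v r) y , (m , v [ r ]≔ a) , left , b , stay) ∷ []

      δask : Reg → Maybe Sym → Cell → Fin 3 → List Option′
      δask r (just (inj₁ b')) c b = (askR r , c , right , encodeBit b' , right) ∷ []
      δask r _                c b = (askL , c , stay , b , stay) ∷ []

      resume : Bool → Ins X → Cell → Fin 3 → List Option′
      resume ans (ask r k) c b = (run (k ans) , c , stay , b , stay) ∷ []
      resume ans (go f)    c b = []

      δans : Bool → Maybe (Maybe X) → Cell → Fin 3 → List Option′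
      δans ans (just (just x)) c b = resume ans (prog x) c b
      δans ans _               c b = []

      δ' : OSt → Cell → Fin 3 → List Option′
      δ' init          c b = (run start , (just nothing , proj₂ c) , stay , b , stay) ∷ []
      δ' Q             c b = []
      δ' Y             c b = δans true (proj₁ c) c b
      δ' N             c b = δans false (proj₁ c) c b
      δ' askL          c b = δret Q askL (proj₁ c) c b
      δ' (run nothing) c b = []
      δ' (run (just x)) c b = δrun (prog x) x c b
      δ' (ret y)       c b = δret (run y) (ret y) (proj₁ c) c b
      δ' (pushR r a y) c b = δpush r a y (lookup (proj₂ c) r) c b
      δ' (popR r y)    c b = δpopR r y (lookup (proj₂ c) r) c b
      δ' (popL r a y)  c b = δpopL r a y (proj₁ c) c b
      δ' (askR r)      c b = δask r (lookup (proj₂ c) r) c b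

      encO : Option′ → Fin (size finOSt) × Fin (3 + Γ') × Move × Fin 3 × Move
      encO (s , c , d , b , e) = enc finOSt s , encC c , d , b , e

      machine : OTM
      machine = record
        { nQ = size finOSt ; Γ = Γ' ; start = enc finOSt init ; accept = enc finOSt (run nothing)
        ; query = enc finOSt Q ; yes = enc finOSt Y ; no = enc finOSt N
        ; δ = λ q a b → map encO (δ' (dec finOSt q) (decC a) b) }

      -- Configurations up to representation: tapes are functions of the position and work symbols
      -- are decoded, so neither trailing blanks nor the raw input symbols need separate treatment.
      record AC : Set where
        constructor ⟪_,_,_,_,_⟫
        field
          st : OSt
          cl : ℕ → Cell
          hp : ℕ
          ql : ℕ → Fin 3
          qp : ℕ

      data Cfg : AC → Config machine → Set where
        cfg : ∀ {s f p g qp cs qs} → (∀ n → decC (readL cs n) ≡ f n) → (∀ n → readL qs n ≡ g n)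
            → Cfg ⟪ s , f , p , g , qp ⟫ (config (enc finOSt s) (tape cs p) (tape qs qp))

      -- Acceptance from `c` and from `c'` correspond, exactly `t` steps apart. This is available on
      -- stretches where the machine has a single successor and does not accept; the only branching
      -- is at a `go` instruction.
      record _⟶[_]_ (c : Config machine) (t : ℕ) (c' : Config machine) : Set where
        field
          fwd : ∀ {n} → AcceptsIn machine A n c' → AcceptsIn machine A (t + n) c
          bwd : ∀ {n} → AcceptsIn machine A n c → ∃[ n' ] (n ≡ t + n' × AcceptsIn machine A n' c')

      open _⟶[_]_

      _↠[_]_ : AC → ℕ → AC → Set
      a ↠[ t ] a' = ∀ {c} → Cfg a c → ∃[ c' ] (Cfg a' c' × c ⟶[ t ] c')

      ↠-trans : ∀ {a b c s t} → a ↠[ s ] b → b ↠[ t ] c → a ↠[ s + t ] c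
      ↠-trans {s = s} {t} f g {c₀} C with f C
      ... | _ , C' , x with g C'
      ... | _ , C'' , y = _ , C'' , record
        { fwd = λ {n} a → subst (λ k → AcceptsIn machine A k c₀) (sym (+-assoc s t n)) (fwd x {t + n} (fwd y {n} a))
        ; bwd = λ a → let (n₁ , e₁ , a₁) = bwd x a ; (n₂ , e₂ , a₂) = bwd y a₁
                      in n₂ , (e₁ ∙ cong (s +_) e₂ ∙ sym (+-assoc s t n₂)) , a₂ }

      decC-encC : ∀ c → decC (encC c) ≡ c
      decC-encC = dec-enc finCell

      write-cells : ∀ {f f' : ℕ → Cell} {p a cs} → (∀ n → decC (readL cs n) ≡ f n) → f' p ≡ a → (∀ n → n ≢ p → f' n ≡ f n)
                  → ∀ n → decC (readL (writeL cs p (encC a)) n) ≡ f' n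
      write-cells {p = p} {a} {cs} r e o n with n ≟ p
      ... | yes refl = cong decC (readL-write-same cs p (encC a)) ∙ decC-encC a ∙ sym e
      ... | no  ne   = cong decC (readL-write-other cs p (encC a) n ne) ∙ r n ∙ sym (o n ne)

      write-query : ∀ {g g' : ℕ → Fin 3} {p b cs} → (∀ n → readL cs n ≡ g n) → g' p ≡ b → (∀ n → n ≢ p → g' n ≡ g n)
                  → ∀ n → readL (writeL cs p b) n ≡ g' n
      write-query {p = p} {b} {cs} r e o n with n ≟ p
      ... | yes refl = readL-write-same cs p b ∙ sym e
      ... | no  ne   = readL-write-other cs p b n ne ∙ r n ∙ sym (o n ne)

      δ-options : ∀ {s} {f : ℕ → Cell} {p} {g : ℕ → Fin 3} {qp cs qs} → (∀ n → decC (readL cs n) ≡ f n) → (∀ n → readL qs n ≡ g n)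
                → OTM.δ machine (enc finOSt s) (readL cs p) (readL qs qp) ≡ map encO (δ' s (f p) (g qp))
      δ-options {s} {f} {p} {g} {qp} {cs} {qs} r r' rewrite dec-enc finOSt s | r p | r' qp = refl

      step-↠ : ∀ {s f p g qp s' a d b e} (f' : ℕ → Cell) (g' : ℕ → Fin 3) → δ' s (f p) (g qp) ≡ (s' , a , d , b , e) ∷ [] → s ≢ Q → s ≢ run nothing
             → f' p ≡ a → (∀ n → n ≢ p → f' n ≡ f n) → g' qp ≡ b → (∀ n → n ≢ qp → g' n ≡ g n)
             → ⟪ s , f , p , g , qp ⟫ ↠[ 1 ] ⟪ s' , f' , movePos d p , g' , movePos e qp ⟫
      step-↠ {s} {f} {p} {g} {qp} {s'} {a} {d} {b} {e} f' g' eq nq na ef of eg og (cfg {cs = cs} {qs} r r') =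
        _ , cfg (write-cells {f} {f'} {p} {a} {cs} r ef of) (write-query {g} {g'} {qp} {b} {qs} r' eg og) , record { fwd = F ; bwd = B }
        where
        c₀ c₁ : Config machine
        c₀ = config (enc finOSt s) (tape cs p) (tape qs qp)
        c₁ = config (enc finOSt s') (update (encC a) d (tape cs p)) (update b e (tape qs qp))
        opts : OTM.δ machine (enc finOSt s) (readL cs p) (readL qs qp) ≡ encO (s' , a , d , b , e) ∷ []
        opts = δ-options {s} {f} {p} {g} {qp} {cs} {qs} r r' ∙ cong (map encO) eq
        F : ∀ {n} → AcceptsIn machine A n c₁ → AcceptsIn machine A (suc n) c₀
        F = step (trans {q' = enc finOSt s'} {a = encC a} {dw = d} {b = b} {dt = e} (nq ∘ enc-injective finOSt) (na ∘ enc-injective finOSt)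
                 (subst (encO (s' , a , d , b , e) ∈_) (sym opts) (here refl)))
        C : ∀ {c c'} → Step machine A c c' → c ≡ c₀ → c' ≡ c₁
        C ask q = ⊥-elim (nq (enc-injective finOSt (sym (cong Config.state q))))
        C (trans _ _ i) refl with subst (_ ∈_) opts i
        ... | here refl = refl
        B : ∀ {n} → AcceptsIn machine A n c₀ → ∃[ n' ] (n ≡ 1 + n' × AcceptsIn machine A n' c₁)
        B (halt x) = ⊥-elim (na (enc-injective finOSt x))
        B (step st x) = _ , refl , subst (AcceptsIn machine A _) (C st refl) x

      silent : ∀ {s f p g qp s' d e} → δ' s (f p) (g qp) ≡ (s' , f p , d , g qp , e) ∷ [] → s ≢ Q → s ≢ run nothing
             → ⟪ s , f , p , g , qp ⟫ ↠[ 1 ] ⟪ s' , f , movePos d p , g , movePos e qp ⟫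
      silent {f = f} {g = g} eq nq na = step-↠ f g eq nq na refl (λ _ _ → refl) refl (λ _ _ → refl)

      δpush-cong : ∀ {r a y v v' c b} → v ≡ v' → δpush r a y v c b ≡ δpush r a y v' c b
      δpush-cong refl = refl

      δpopR-cong : ∀ {r y v v' c b} → v ≡ v' → δpopR r y v c b ≡ δpopR r y v' c b
      δpopR-cong refl = refl

      δask-cong : ∀ {r v v' c b} → v ≡ v' → δask r v c b ≡ δask r v' c b
      δask-cong refl = refl

      carry-cong : ∀ {r y v v' z} → v ≡ v' → _≡_ {A = List Option′} ((popL r v y , z) ∷ []) ((popL r v' y , z) ∷ [])
      carry-cong refl = refl

      mark : Maybe X → ℕ → Maybe (Maybe X)
      mark m zero    = just m
      mark m (suc _) = nothing

      image : Maybe X → Store → ℕ → Cell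
      image m σ n = mark m n , col σ n

      col-set : ∀ σ r l n → col (σ [ r ]≔ l) n ≡ col σ n [ r ]≔ nth n l
      col-set σ r l n = map-[]≔ (nth n) σ r

      lookup-col : ∀ σ r l n → lookup (col (σ [ r ]≔ l) n) r ≡ nth n l
      lookup-col σ r l n = lookup-map r (nth n) (σ [ r ]≔ l) ∙ cong (nth n) (lookup∘update r σ l)

      image-write : ∀ {m σ r l l' n v} → nth n l' ≡ v
                  → image m (σ [ r ]≔ l') n ≡ (mark m n , col (σ [ r ]≔ l) n [ r ]≔ v)
      image-write {m} {σ} {r} {l} {l'} {n} refl = cong (mark m n ,_)
        (col-set σ r l' n ∙ sym ([]≔-idempotent (col σ n) r) ∙ cong (_[ r ]≔ nth n l') (sym (col-set σ r l n)))

      image-keep : ∀ {m σ r l l' n} → nth n l' ≡ nth n l → image m (σ [ r ]≔ l') n ≡ image m (σ [ r ]≔ l) n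
      image-keep {m} {σ} {r} {l} {l'} {n} e = cong (mark m n ,_)
        (col-set σ r l' n ∙ cong (col σ n [ r ]≔_) e ∙ sym (col-set σ r l n))

      ret-walk : ∀ {y m σ g qp} p → ⟪ ret y , image m σ , p , g , qp ⟫ ↠[ suc p ] ⟪ run y , image m σ , 0 , g , qp ⟫
      ret-walk zero = silent refl (λ ()) (λ ())
      ret-walk (suc p) = ↠-trans (silent refl (λ ()) (λ ())) (ret-walk p)

      askL-walk : ∀ {m σ g qp} p → ⟪ askL , image m σ , p , g , qp ⟫ ↠[ suc p ] ⟪ Q , image m σ , 0 , g , qp ⟫
      askL-walk zero = silent refl (λ ()) (λ ())
      askL-walk (suc p) = ↠-trans (silent refl (λ ()) (λ ())) (askL-walk p)

      -- Invariant: the prefix `rp` is final and the carried symbol `a` is still to be inserted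
      -- before `t`. A step adds `a` to the prefix and picks up the head of `t`.
      push-walk : ∀ {r y m σ g qp} a rp t → ∃[ p ] (p ≤ length rp + length t ×
        ⟪ pushR r a y , image m (σ [ r ]≔ (rp ʳ++ t)) , length rp , g , qp ⟫ ↠[ suc (length t) ]
        ⟪ ret y , image m (σ [ r ]≔ (rp ʳ++ (a ∷ t))) , p , g , qp ⟫)
      push-walk {r} {y} {m} {σ} {g} {qp} a rp [] = length rp , m≤m+n _ _ ,
        step-↠ {b = g qp} (image m (σ [ r ]≔ (rp ʳ++ (a ∷ [])))) g
          (δpush-cong (lookup-col σ r (rp ʳ++ []) (length rp) ∙ nth-ʳ++-head rp))
          (λ ()) (λ ()) (image-write {σ = σ} {l = rp ʳ++ []} (nth-ʳ++-head rp))
          (λ n ne → image-keep {σ = σ} (nth-ʳ++-other rp (λ _ → refl) n ne)) refl (λ _ _ → refl)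
      push-walk {r} {y} {m} {σ} {g} {qp} a rp (b ∷ t) with push-walk {r} {y} {m} {σ} {g} {qp} b (a ∷ rp) t
      ... | p , p≤ , w = p , ≤-trans p≤ (≤-reflexive (sym (+-suc (length rp) (length t)))) ,
        ↠-trans (step-↠ {b = g qp} (image m (σ [ r ]≔ (rp ʳ++ (a ∷ t)))) g
          (δpush-cong (lookup-col σ r (rp ʳ++ (b ∷ t)) (length rp) ∙ nth-ʳ++-head rp))
          (λ ()) (λ ()) (image-write {σ = σ} {l = rp ʳ++ (b ∷ t)} (nth-ʳ++-head rp))
          (λ n ne → image-keep {σ = σ} (nth-ʳ++-other rp (λ _ → refl) n ne)) refl (λ _ _ → refl)) w

      -- Invariant: the original track is `rp ʳ++ (b ∷ t)`. The cells right of the head already hold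
      -- `tl t`, and the scanned `b` is about to be overwritten by the carried head of `t`.
      popL-walk : ∀ {r y m σ g qp} rp b t →
        ⟪ popL r (nth 0 t) y , image m (σ [ r ]≔ (rp ʳ++ (b ∷ tl t))) , length rp , g , qp ⟫ ↠[ suc (length rp) ]
        ⟪ run y , image m (σ [ r ]≔ tl (rp ʳ++ (b ∷ t))) , 0 , g , qp ⟫
      popL-walk {r} {y} {m} {σ} {g} {qp} [] b t =
        step-↠ {b = g qp} (image m (σ [ r ]≔ t)) g refl (λ ()) (λ ()) (image-write {σ = σ} {l = b ∷ tl t} refl)
          (λ n ne → image-keep {σ = σ} (other t n ne)) refl (λ _ _ → refl)
        where
        other : ∀ t n → n ≢ 0 → nth n t ≡ nth n (b ∷ tl t)
        other t zero ne = ⊥-elim (ne refl)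
        other [] (suc n) ne = refl
        other (x ∷ t) (suc n) ne = refl
      popL-walk {r} {y} {m} {σ} {g} {qp} (c ∷ rp) b t =
        ↠-trans (step-↠ {b = g qp} (image m (σ [ r ]≔ (rp ʳ++ (c ∷ t)))) g
          (carry-cong (lookup-col σ r ((c ∷ rp) ʳ++ (b ∷ tl t)) (suc (length rp)) ∙ nth-ʳ++-head (c ∷ rp)))
          (λ ()) (λ ()) (image-write {m} {σ} {r} {(c ∷ rp) ʳ++ (b ∷ tl t)} {rp ʳ++ (c ∷ t)} {suc (length rp)} (nth-c t))
          (λ n ne → image-keep {σ = σ} (other t n ne)) refl (λ _ _ → refl))
          (popL-walk rp c (b ∷ t))
        where
        nth-c : ∀ t → nth (suc (length rp)) (rp ʳ++ (c ∷ t)) ≡ nth 0 t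
        nth-c t = nth-ʳ++-head (c ∷ rp)
        shift : ∀ t m → nth (suc m) t ≡ nth (suc m) (b ∷ tl t)
        shift [] m = refl
        shift (x ∷ t) m = refl
        other : ∀ t n → n ≢ suc (length rp) → nth n (rp ʳ++ (c ∷ t)) ≡ nth n (rp ʳ++ (c ∷ b ∷ tl t))
        other t n ne = nth-ʳ++-other (c ∷ rp) (shift t) n ne

      popR-walk : ∀ {r y m σ g qp} rp t →
        ⟪ popR r y , image m (σ [ r ]≔ (rp ʳ++ t)) , length rp , g , qp ⟫ ↠[ length t ]
        ⟪ popR r y , image m (σ [ r ]≔ (rp ʳ++ t)) , length (t ʳ++ rp) , g , qp ⟫
      popR-walk rp [] C = _ , C , record { fwd = id ; bwd = λ a → _ , refl , a }
      popR-walk {r} {y} {m} {σ} {g} {qp} rp (b ∷ t) =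
        ↠-trans (silent (δpopR-cong (lookup-col σ r (rp ʳ++ (b ∷ t)) (length rp) ∙ nth-ʳ++-head rp)) (λ ()) (λ ()))
          (popR-walk (b ∷ rp) t)

      popR-turn : ∀ {r y m σ g qp} rp →
        ⟪ popR r y , image m (σ [ r ]≔ (rp ʳ++ [])) , length rp , g , qp ⟫ ↠[ suc (length rp) ]
        ⟪ run y , image m (σ [ r ]≔ tl (rp ʳ++ [])) , 0 , g , qp ⟫
      popR-turn {r} {y} {m} {σ} [] =
        silent (δpopR-cong (lookup-col σ r [] 0)) (λ ()) (λ ())
      popR-turn {r} {y} {m} {σ} (c ∷ rp) =
        ↠-trans (silent (δpopR-cong (lookup-col σ r ((c ∷ rp) ʳ++ []) (suc (length rp)) ∙ nth-ʳ++-head (c ∷ rp))) (λ ()) (λ ()))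
          (popL-walk rp c [])

      askR-walk : ∀ {r m σ l} rp t u → l ≡ rp ʳ++ t → ∃[ p ] ∃[ qp ] (p ≤ length rp + length t ×
        ∃[ k ] (k ≤ suc (length t) ×
        ⟪ askR r , image m (σ [ r ]≔ l) , length rp , bitCells (u ʳ++ []) , length u ⟫ ↠[ k ]
        ⟪ askL , image m (σ [ r ]≔ l) , p , bitCells (u ʳ++ toBits t) , qp ⟫))
      askR-walk {r} {m} {σ} {l} rp [] u refl = _ , _ , m≤m+n _ _ , 1 , s≤s z≤n ,
        silent (δask-cong (lookup-col σ r l (length rp) ∙ nth-ʳ++-head rp)) (λ ()) (λ ())
      askR-walk {r} {m} {σ} {l} rp (inj₂ z ∷ t) u refl = _ , _ , m≤m+n _ _ , 1 , s≤s z≤n ,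
        silent (δask-cong (lookup-col σ r l (length rp) ∙ nth-ʳ++-head rp)) (λ ()) (λ ())
      askR-walk {r} {m} {σ} {l} rp (inj₁ b ∷ t) u refl with askR-walk {r} {m} {σ} {l} (inj₁ b ∷ rp) t (b ∷ u) refl
      ... | p , qp , p≤ , k , k≤ , w = p , qp , ≤-trans p≤ (≤-reflexive (sym (+-suc (length rp) (length t)))) , suc k , s≤s k≤ ,
        ↠-trans (step-↠ (image m (σ [ r ]≔ l)) (bitCells (u ʳ++ (b ∷ [])))
          (δask-cong (lookup-col σ r l (length rp) ∙ nth-ʳ++-head rp)) (λ ()) (λ ())
          refl (λ _ _ → refl) (cong (maybe′ encodeBit zero) (nth-ʳ++-head u))
          (λ n ne → cong (maybe′ encodeBit zero) (nth-ʳ++-other u (λ _ → refl) n ne))) w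

      private
        double : ∀ {l s} → l ≤ s → l + l ≤ s + s
        double p = +-mono-≤ p p

      ↠-refl : ∀ {a} → a ↠[ 0 ] a
      ↠-refl C = _ , C , record { fwd = id ; bwd = λ a → _ , refl , a }

      op-↠ : ∀ op {y m σ g qp} → ∃[ t ] (t ≤ 2 + (size# σ + size# σ) ×
        ⟪ opState op y , image m σ , 0 , g , qp ⟫ ↠[ t ] ⟪ run y , image m (doOp op σ) , 0 , g , qp ⟫)
      op-↠ nop = 0 , z≤n , ↠-refl
      op-↠ (push r a) {y} {m} {σ} {g} {qp} with push-walk {r} {y} {m} {σ} {g} {qp} a [] (lookup σ r)
      ... | p , p≤ , w = suc (length (lookup σ r)) + suc p ,
        ≤-trans (s≤s (≤-trans (≤-reflexive (+-suc _ p)) (s≤s (+-monoʳ-≤ _ p≤)))) (s≤s (s≤s (double (lookup≤size σ r)))) ,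
        ↠-trans (subst (λ τ → ⟪ pushR r a y , image m τ , 0 , g , qp ⟫ ↠[ suc (length (lookup σ r)) ]
                              ⟪ ret y , image m (σ [ r ]≔ (a ∷ lookup σ r)) , p , g , qp ⟫) ([]≔-lookup σ r) w) (ret-walk p)
      op-↠ (pop r) {y} {m} {σ} {g} {qp} = length l + suc (length (l ʳ++ [])) ,
        ≤-trans (≤-reflexive (+-suc _ _ ∙ cong (λ k → suc (length l + k)) (length-ʳ++ l ∙ +-identityʳ _)))
          (s≤s (m≤n⇒m≤1+n (double (lookup≤size σ r)))) ,
        ↠-trans (subst (λ τ → ⟪ popR r y , image m τ , 0 , g , qp ⟫ ↠[ length l ]
                              ⟪ popR r y , image m τ , length (l ʳ++ []) , g , qp ⟫) ([]≔-lookup σ r) (popR-walk [] l))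
          (subst (λ l' → ⟪ popR r y , image m (σ [ r ]≔ l') , length (l ʳ++ []) , g , qp ⟫ ↠[ suc (length (l ʳ++ [])) ]
                         ⟪ run y , image m (σ [ r ]≔ tl l') , 0 , g , qp ⟫ ) (ʳ++-ʳ++-[] l []) (popR-turn (l ʳ++ []))
           ∘ subst (λ τ → Cfg ⟪ popR r y , image m τ , length (l ʳ++ []) , g , qp ⟫ _) (sym ([]≔-lookup σ r)))
        where l = lookup σ r

      answer : Bool → OSt
      answer b = if b then Y else N

      query-↠ : ∀ {f s qp} → ⟪ Q , f , 0 , bitCells s , qp ⟫ ↠[ 1 ] ⟪ answer (A s) , f , 0 , bitCells [] , 0 ⟫
      query-↠ {f} {s} {qp} (cfg {cs = cs} {qs} r r') = c₁ , cfg r (λ _ → refl) , record { fwd = F ; bwd = B }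
        where
        c₀ c₁ : Config machine
        c₀ = config (enc finOSt Q) (tape cs 0) (tape qs qp)
        c₁ = config (enc finOSt (answer (A s))) (tape cs 0) (tape [] 0)
        decoded : decodeQuery qs ≡ s
        decoded = decodeQuery-cong qs (map encodeBit s) (λ n → r' n ∙ sym (readL-map {n = n} encodeBit s)) ∙ decodeQuery-encodeBit s
        answered : (if A (decodeQuery qs) then enc finOSt Y else enc finOSt N) ≡ enc finOSt (answer (A s))
        answered rewrite decoded with A s
        ... | true = refl
        ... | false = refl
        F : ∀ {n} → AcceptsIn machine A n c₁ → AcceptsIn machine A (suc n) c₀
        F a = step ask (subst (λ q → AcceptsIn machine A _ (config q (tape cs 0) (tape [] 0))) (sym answered) a)
        C : ∀ {c c'} → Step machine A c c' → c ≡ c₀ → c' ≡ c₁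
        C ask refl = cong (λ q → config q (tape cs 0) (tape [] 0)) answered
        C (trans nq _ _) refl = ⊥-elim (nq refl)
        B : ∀ {n} → AcceptsIn machine A n c₀ → ∃[ n' ] (n ≡ 1 + n' × AcceptsIn machine A n' c₁)
        B (halt x) with enc-injective finOSt {Q} {run nothing} x
        ... | ()
        B (step st x) = _ , refl , subst (AcceptsIn machine A _) (C st refl) x

      answer-↠ : ∀ {x r k σ g qp} ans → prog x ≡ ask r k →
        ⟪ answer ans , image (just x) σ , 0 , g , qp ⟫ ↠[ 1 ] ⟪ run (k ans) , image (just x) σ , 0 , g , qp ⟫
      answer-↠ true e = silent (cong (λ i → resume true i _ _) e) (λ ()) (λ ())
      answer-↠ false e = silent (cong (λ i → resume false i _ _) e) (λ ()) (λ ())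

      ask-↠ : ∀ {x r k m σ} → prog x ≡ ask r k → ∃[ t ] (suc t ≤ 5 + (size# σ + size# σ) ×
        ⟪ run (just x) , image m σ , 0 , bitCells [] , 0 ⟫ ↠[ suc t ]
        ⟪ run (k (A (toBits (lookup σ r)))) , image (just x) σ , 0 , bitCells [] , 0 ⟫)
      ask-↠ {x} {r} {k} {m} {σ} e with askR-walk {r} {just x} {σ} {lookup σ r} [] (lookup σ r) [] refl
      ... | p , qp , p≤ , j , j≤ , w = j + (suc p + (1 + 1)) ,
        s≤s (≤-trans (+-mono-≤ j≤ (+-monoˡ-≤ 2 (s≤s p≤))) (≤-trans (≤-reflexive (arith (length (lookup σ r)))) (+-monoʳ-≤ 4 (double (lookup≤size σ r))))) ,
        ↠-trans mark-↠ (↠-trans w' (↠-trans (askL-walk p) (↠-trans query-↠ (answer-↠ _ e))))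
        where
        open +-*-Solver
        arith : ∀ l → suc l + (suc l + 2) ≡ 4 + (l + l)
        arith = solve 1 (λ l → con 1 :+ l :+ (con 1 :+ l :+ con 2) := con 4 :+ (l :+ l)) refl
        w' : ⟪ askR r , image (just x) σ , 0 , bitCells [] , 0 ⟫ ↠[ j ] ⟪ askL , image (just x) σ , p , bitCells (toBits (lookup σ r)) , qp ⟫
        w' = subst (λ τ → ⟪ askR r , image (just x) τ , 0 , bitCells [] , 0 ⟫ ↠[ j ]
                          ⟪ askL , image (just x) τ , p , bitCells (toBits (lookup σ r)) , qp ⟫) ([]≔-lookup σ r) w
        mark-↠ : ⟪ run (just x) , image m σ , 0 , bitCells [] , 0 ⟫ ↠[ 1 ] ⟪ askR r , image (just x) σ , 0 , bitCells [] , 0 ⟫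
        mark-↠ = step-↠ (image (just x) σ) (bitCells []) (cong (λ i → δrun i x _ _) e) (λ ()) (λ ()) refl other refl (λ _ _ → refl)
          where
          other : ∀ n → n ≢ 0 → image (just x) σ n ≡ image m σ n
          other zero ne = ⊥-elim (ne refl)
          other (suc n) ne = refl

      At : Maybe X → Maybe X → Store → Config machine → Set
      At y m σ = Cfg ⟪ run y , image m σ , 0 , bitCells [] , 0 ⟫

      -- The factor bounds the machine steps per instruction when the registers hold at most `s`
      -- symbols. A query is the dearest case: it walks along a register and back, plus five steps.
      cost : ℕ → ℕ → ℕ
      cost s n = n * (5 + (s + s))

      go-target : Op × Maybe X → Cell → List (Fin (3 + Γ')) → List (Fin 3) → Config machine
      go-target (op , y) a cs qs = config (enc finOSt (opState op y)) (tape (writeL cs 0 (encC a)) 0) (tape (writeL qs 0 zero) 0)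

      go-Cfg : ∀ {op y m σ cs qs} → (∀ n → decC (readL cs n) ≡ image m σ n) → (∀ n → readL qs n ≡ bitCells [] n)
             → Cfg ⟪ opState op y , image m σ , 0 , bitCells [] , 0 ⟫ (go-target (op , y) (image m σ 0) cs qs)
      go-Cfg {op} {y} {m} {σ} {cs} {qs} r r' = cfg
        (write-cells {image m σ} {image m σ} {0} {image m σ 0} {cs} r refl (λ _ _ → refl))
        (write-query {bitCells []} {bitCells []} {0} {zero} {qs} r' refl (λ _ _ → refl))

      go-δ : ∀ {x f m σ cs qs} → prog x ≡ go f → (∀ n → decC (readL cs n) ≡ image m σ n) → (∀ n → readL qs n ≡ bitCells [] n)
           → OTM.δ machine (enc finOSt (run (just x))) (readL cs 0) (readL qs 0)
             ≡ map encO (map (λ oy → opState (proj₁ oy) (proj₂ oy) , image m σ 0 , stay , zero , stay) (f (tops σ)))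
      go-δ {x} {f} {m} {σ} {cs} {qs} e r r' =
        δ-options {run (just x)} {image m σ} {0} {bitCells []} {0} {cs} {qs} r r' ∙ cong (λ i → map encO (δrun i x (image m σ 0) zero)) e

      -- The invariant `size# σ + n ≤ s` survives because an operation adds at most one symbol while
      -- using up one unit of `n`. Hence a single `s` bounds every store that is reached.
      simulate : ∀ {n y σ} → SAcc A n y σ → ∀ {s m c} → size# σ + n ≤ s → At y m σ c → AcceptsIn machine A (cost s n) c
      simulate acc s≤ (cfg r r') = halt refl
      simulate (go {n} {x} {σ} {f} {op} {y} e i a) {s} {m} s≤ (cfg {cs = cs} {qs} r r') =
        let (t , t≤ , w) = op-↠ op {y} {m} {σ} {bitCells []} {0}
            (c' , C' , z) = w (go-Cfg {op} {y} {m} {σ} {cs} {qs} r r')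
        in AcceptsIn-mono
        (step (trans (λ q → case₁ (enc-injective finOSt {run (just x)} {Q} q)) (λ q → case₂ (enc-injective finOSt {run (just x)} {run nothing} q))
                (subst (encO (opState op y , image m σ 0 , stay , zero , stay) ∈_) (sym (go-δ {cs = cs} {qs} e r r')) (∈-map⁺ encO (∈-map⁺ _ i))))
              (fwd z (simulate a smaller C')))
        (s≤s (+-monoˡ-≤ _ (≤-trans t≤ (≤-trans (+-monoʳ-≤ 2 (double size≤)) (m≤n+m _ 2)))))
        where
        case₁ : run (just x) ≢ Q
        case₁ ()
        case₂ : run (just x) ≢ run nothing
        case₂ ()
        size≤ : size# σ ≤ s
        size≤ = ≤-trans (m≤m+n _ _) s≤
        smaller : size# (doOp op σ) + n ≤ s
        smaller = ≤-trans (+-monoˡ-≤ n (size-doOp op σ)) (≤-trans (≤-reflexive (sym (+-suc _ n))) s≤)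
      simulate (ask {n} {x} {σ} {r} {k} e a) {s} {m} s≤ C =
        let (t , t≤ , w) = ask-↠ {x} {r} {k} {m} {σ} e
            (c' , C' , z) = w C
        in AcceptsIn-mono (fwd z (simulate a (≤-trans (+-monoʳ-≤ (size# σ) (n≤1+n n)) s≤) C'))
        (+-monoˡ-≤ _ (≤-trans t≤ (+-monoʳ-≤ 5 (double {size# σ} (≤-trans (m≤m+n _ (suc n)) s≤)))))

      private
        later : ∀ {n n'} t → n ≡ suc t + n' → suc n' ≤ n
        later {n' = n'} t refl = s≤s (m≤n+m n' t)

      -- Recursion is on a bound `k` of the remaining time, since an instruction consumes a varying,
      -- though positive, number of machine steps.
      simulated : ∀ k {n y m σ c} → n ≤ k → AcceptsIn machine A n c → At y m σ c → SAcc A n y σ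
      simulated k {y = nothing} n≤ a C = acc
      simulated zero {y = just x} z≤n (halt q) (cfg r r') with enc-injective finOSt {run (just x)} {run nothing} q
      ... | ()
      simulated (suc k) {n} {just x} {m} {σ} n≤ a C with prog x in e
      simulated (suc k) {n} {just x} {m} {σ} n≤ a C | ask r f =
        let (t , _ , w) = ask-↠ {x} {r} {f} {m} {σ} e
            (c' , C' , z) = w C
            (n' , n≡ , a') = bwd z a
            n'< = later {n} t n≡
        in SAcc-mono (ask e (simulated k (≤-pred (≤-trans n'< n≤)) a' C')) n'<
      simulated (suc k) {n} {just x} {m} {σ} n≤ (halt q) (cfg r r') | go f with enc-injective finOSt {run (just x)} {run nothing} q
      ... | ()
      simulated (suc k) {suc n} {just x} {m} {σ} n≤ (step st a) (cfg {cs = cs} {qs} r r') | go f = invert st refl a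
        where
        invert : ∀ {c₀ c} → Step machine A c₀ c → c₀ ≡ config (enc finOSt (run (just x))) (tape cs 0) (tape qs 0) → AcceptsIn machine A n c
               → SAcc A (suc n) (just x) σ
        invert ask q a with enc-injective finOSt {Q} {run (just x)} (cong Config.state q)
        ... | ()
        invert (trans _ _ i) refl a with ∈-map⁻ encO (subst (_ ∈_) (go-δ {cs = cs} {qs} e r r') i)
        ... | _ , j , refl with ∈-map⁻ _ j
        ... | (op , y) , j' , refl =
          let (t , _ , w) = op-↠ op {y} {m} {σ} {bitCells []} {0}
              (c' , C' , z) = w (go-Cfg {op} {y} {m} {σ} {cs} {qs} r r')
              (n' , n≡ , a') = bwd z a
              n'< = later t (cong suc n≡)
          in SAcc-mono (go e j' (simulated k (≤-pred (≤-trans n'< n≤)) a' C')) n'<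

      private
        nth-nil : ∀ n r → V.map (nth {Sym} n) (replicate r []) ≡ replicate r nothing
        nth-nil n zero = refl
        nth-nil n (suc r) = cong (nothing ∷_) (nth-nil n r)

        sum-nil : ∀ r → sum (V.map (length {A = Sym}) (replicate r [])) ≡ 0
        sum-nil zero = refl
        sum-nil (suc r) = sum-nil r

        decC-encodeBit : ∀ x n → decC (readL (map encodeBit x) n) ≡ (nothing , col (input x) n)
        decC-encodeBit x n = cong decC (readL-map encodeBit x) ∙ cells x n
          where
          cells : ∀ x n → decC (maybe′ encodeBit zero (nth n x)) ≡ (nothing , col (input x) n)
          cells [] n = cong (λ v → nothing , nothing ∷ v) (sym (nth-nil n r₀))
          cells (false ∷ x) zero = cong (λ v → nothing , just (inj₁ false) ∷ v) (sym (nth-nil zero r₀))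
          cells (true ∷ x) zero = cong (λ v → nothing , just (inj₁ true) ∷ v) (sym (nth-nil zero r₀))
          cells (b ∷ x) (suc n) = cells x n ∙ cong (λ v → nothing , nth n (map inj₁ x) ∷ v) (nth-nil n r₀ ∙ sym (nth-nil (suc n) r₀))

      initial-↠ : ∀ x → ∃[ c ] (At start nothing (input x) c × initial machine x ⟶[ 1 ] c)
      initial-↠ x = step-↠ {e = stay} (image nothing (input x)) (bitCells []) refl (λ ()) (λ ()) refl other refl (λ _ _ → refl)
                      (cfg (decC-encodeBit x) (λ _ → refl))
        where
        other : ∀ n → n ≢ 0 → image nothing (input x) n ≡ (nothing , col (input x) n)
        other zero ne = ⊥-elim (ne refl)
        other (suc n) ne = refl

      size-input : ∀ x → size# (input x) ≡ length x
      size-input x = cong₂ _+_ (length-map inj₁ x) (sum-nil r₀) ∙ +-identityʳ _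

      machine-complete : ∀ {x t} → SAcc A t start (input x) → AcceptsIn machine A (suc (cost (length x + t) t)) (initial machine x)
      machine-complete {x} {t} a with initial-↠ x
      ... | c , C , z = fwd z (simulate a (≤-reflexive (cong (_+ t) (size-input x))) C)

      machine-sound : ∀ {x n} → AcceptsIn machine A n (initial machine x) → ∃[ t ] SAcc A t start (input x)
      machine-sound {x} a with initial-↠ x
      ... | c , C , z with bwd z a
      ... | n' , _ , a' = n' , simulated n' ≤-refl a' C

-- Polynomial bounds

-- The base `suc n` is at least 1, so its powers grow with the exponent and degrees can simply be
-- added; powers of `n` itself would fail at 0.
record PolyFn : Set where
  field
    fn      : ℕ → ℕ
    mono    : ∀ {m n} → m ≤ n → fn m ≤ fn n
    coeff   : ℕ
    degree  : ℕ
    bounded : ∀ n → fn n ≤ coeff * suc n ^ degree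

open PolyFn public

private
  pow≥1 : ∀ n d → 1 ≤ suc n ^ d
  pow≥1 n d = m^n>0 (suc n) d

  ^-≤-+ˡ : ∀ n d e → suc n ^ d ≤ suc n ^ (d + e)
  ^-≤-+ˡ n d e = ^-monoʳ-≤ (suc n) (m≤m+n d e)

  ^-≤-+ʳ : ∀ n d e → suc n ^ e ≤ suc n ^ (d + e)
  ^-≤-+ʳ n d e = ^-monoʳ-≤ (suc n) (m≤n+m e d)

  ^-distribʳ-* : ∀ d a b → (a * b) ^ d ≡ a ^ d * b ^ d
  ^-distribʳ-* zero a b = refl
  ^-distribʳ-* (suc d) a b = cong (a * b *_) (^-distribʳ-* d a b) ∙ arith a b (a ^ d) (b ^ d)
    where
    open +-*-Solver
    arith : ∀ a b x y → a * b * (x * y) ≡ a * x * (b * y)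
    arith = solve 4 (λ a b x y → a :* b :* (x :* y) := a :* x :* (b :* y)) refl

constP : ℕ → PolyFn
constP c = record { fn = λ _ → c ; mono = λ _ → ≤-refl ; coeff = c ; degree = 0
                  ; bounded = λ n → ≤-reflexive (sym (*-identityʳ c)) }

idP : PolyFn
idP = record { fn = id ; mono = id ; coeff = 1 ; degree = 1
             ; bounded = λ n → ≤-trans (n≤1+n n) (≤-reflexive (sym (*-identityʳ (suc n)) ∙ sym (*-identityˡ _))) }

infixl 6 _⊕_
infixl 7 _⊗_
infixr 8 _⊚_

_⊕_ _⊗_ _⊚_ : PolyFn → PolyFn → PolyFn
p ⊕ q = record
  { fn = λ n → fn p n + fn q n ; mono = λ m≤n → +-mono-≤ (mono p m≤n) (mono q m≤n)
  ; coeff = coeff p + coeff q ; degree = degree p + degree q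
  ; bounded = λ n → ≤-trans
      (+-mono-≤ (≤-trans (bounded p n) (*-monoʳ-≤ (coeff p) (^-≤-+ˡ n (degree p) (degree q))))
                (≤-trans (bounded q n) (*-monoʳ-≤ (coeff q) (^-≤-+ʳ n (degree p) (degree q)))))
      (≤-reflexive (sym (*-distribʳ-+ (suc n ^ (degree p + degree q)) (coeff p) (coeff q)))) }
p ⊗ q = record
  { fn = λ n → fn p n * fn q n ; mono = λ m≤n → *-mono-≤ (mono p m≤n) (mono q m≤n)
  ; coeff = coeff p * coeff q ; degree = degree p + degree q
  ; bounded = λ n → ≤-trans (*-mono-≤ (bounded p n) (bounded q n))
      (≤-reflexive (arith (coeff p) (coeff q) (suc n ^ degree p) (suc n ^ degree q)
                    ∙ cong (coeff p * coeff q *_) (sym (^-distribˡ-+-* (suc n) (degree p) (degree q))))) }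
  where
  open +-*-Solver
  arith : ∀ a b x y → a * x * (b * y) ≡ a * b * (x * y)
  arith = solve 4 (λ a b x y → a :* x :* (b :* y) := a :* b :* (x :* y)) refl
p ⊚ q = record
  { fn = λ n → fn p (fn q n) ; mono = λ m≤n → mono p (mono q m≤n)
  ; coeff = coeff p * suc (coeff q) ^ degree p ; degree = degree q * degree p
  ; bounded = λ n → ≤-trans (bounded p (fn q n)) (≤-trans (*-monoʳ-≤ (coeff p)
      (≤-trans (^-monoˡ-≤ (degree p) (step₁ n)) (≤-reflexive (^-distribʳ-* (degree p) (suc (coeff q)) (suc n ^ degree q)
        ∙ cong (suc (coeff q) ^ degree p *_) (^-*-assoc (suc n) (degree q) (degree p))))))
      (≤-reflexive (sym (*-assoc (coeff p) (suc (coeff q) ^ degree p) _)))) }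
  where
  step₁ : ∀ n → suc (fn q n) ≤ suc (coeff q) * suc n ^ degree q
  step₁ n = +-mono-≤ (pow≥1 n (degree q)) (bounded q n)

poly-mono : ∀ c {m n} → m ≤ n → poly c m ≤ poly c n
poly-mono c m≤n = +-monoˡ-≤ c (*-monoʳ-≤ c (^-monoˡ-≤ c m≤n))

polyP : ℕ → PolyFn
polyP c = record
  { fn = poly c ; mono = poly-mono c ; coeff = c + c ; degree = c
  ; bounded = λ n → ≤-trans (+-mono-≤ (*-monoʳ-≤ c (^-monoˡ-≤ c (n≤1+n n))) (≤-trans (≤-reflexive (sym (*-identityʳ c))) (*-monoʳ-≤ c (pow≥1 n c))))
      (≤-reflexive (sym (*-distribʳ-+ (suc n ^ c) c c))) }

-- For n > 0 one has n + 1 ≤ 2 n, which trades the base `suc n` for `n` at the price of the factor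
-- `2 ^ degree p`. Adding `degree p` lets one number serve as both coefficient and exponent in
-- `poly`, whose additive constant takes care of n = 0.
polyBound : PolyFn → ℕ
polyBound p = coeff p * 2 ^ degree p + degree p

≤-polyBound : ∀ p n → fn p n ≤ poly (polyBound p) n
≤-polyBound p zero = ≤-trans (bounded p 0) (≤-trans (*-monoʳ-≤ (coeff p) (≤-trans (≤-reflexive (^-zeroˡ (degree p))) (m^n>0 2 (degree p))))
  (≤-trans (m≤m+n _ (degree p)) (m≤n+m (polyBound p) (polyBound p * 0 ^ polyBound p))))
≤-polyBound p (suc n) = ≤-trans (bounded p (suc n)) (≤-trans (*-monoʳ-≤ (coeff p) pow) (≤-trans (≤-reflexive (sym (*-assoc (coeff p) (2 ^ d) (suc n ^ d))))
  (≤-trans (*-mono-≤ (m≤m+n (coeff p * 2 ^ d) d) (^-monoʳ-≤ (suc n) (m≤n+m d (coeff p * 2 ^ d)))) (m≤m+n _ _))))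
  where
  d = degree p
  base : suc (suc n) ≤ 2 * suc n
  base = ≤-trans (s≤s (s≤s (m≤m+n n (n + 0)))) (≤-reflexive (cong suc (sym (+-suc n (n + 0)))))
  pow : suc (suc n) ^ d ≤ 2 ^ d * suc n ^ d
  pow = ≤-trans (^-monoˡ-≤ d base) (≤-reflexive (^-distribʳ-* d 2 (suc n)))

NP[_] : Lang → Class
NP[ A ] L = Σ[ M ∈ OTM ] AcceptsPoly M A L

-- A nondeterministic register language

module Program (Z : Set) (finZ : Finite Z) (r₀ : ℕ) where
  open Stack Z finZ r₀ public

  infixr 5 _⨾_
  data Cmd : Set where
    skip fail : Cmd
    put       : Reg → (Tops → Sym) → Cmd
    pick      : Reg → (Tops → List Sym) → Cmd
    pop       : Reg → Cmd
    _⨾_       : Cmd → Cmd → Cmd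
    ifc       : (Tops → Bool) → Cmd → Cmd → Cmd
    while     : (Tops → Bool) → Cmd → Cmd
    amb       : Cmd → Cmd → Cmd
    ask       : Reg → Cmd → Cmd → Cmd

  -- The index t is an upper bound for the running time.
  data Exec (A : Lang) : Cmd → Store → Store → ℕ → Set where
    skip    : ∀ {σ t} → Exec A skip σ σ t
    put     : ∀ {r f σ t} → Exec A (put r f) σ (doOp (push r (f (tops σ))) σ) (suc t)
    pick    : ∀ {r f σ t a} → a ∈ f (tops σ) → Exec A (pick r f) σ (doOp (push r a) σ) (suc t)
    pop     : ∀ {r σ t} → Exec A (pop r) σ (doOp (pop r) σ) (suc t)
    _⨾_     : ∀ {c d σ₀ σ₁ σ₂ s t} → Exec A c σ₀ σ₁ s → Exec A d σ₁ σ₂ t → Exec A (c ⨾ d) σ₀ σ₂ (s + t)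
    if-t    : ∀ {g c d σ σ' t} → g (tops σ) ≡ true → Exec A c σ σ' t → Exec A (ifc g c d) σ σ' (suc t)
    if-f    : ∀ {g c d σ σ' t} → g (tops σ) ≡ false → Exec A d σ σ' t → Exec A (ifc g c d) σ σ' (suc t)
    while-t : ∀ {g c σ₀ σ₁ σ₂ s t} → g (tops σ₀) ≡ true → Exec A c σ₀ σ₁ s → Exec A (while g c) σ₁ σ₂ t
            → Exec A (while g c) σ₀ σ₂ (suc (s + t))
    while-f : ∀ {g c σ t} → g (tops σ) ≡ false → Exec A (while g c) σ σ (suc t)
    amb-l   : ∀ {c d σ σ' t} → Exec A c σ σ' t → Exec A (amb c d) σ σ' (suc t)
    amb-r   : ∀ {c d σ σ' t} → Exec A d σ σ' t → Exec A (amb c d) σ σ' (suc t)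
    ask-t   : ∀ {r c d σ σ' t} → A (toBits (lookup σ r)) ≡ true → Exec A c σ σ' t → Exec A (ask r c d) σ σ' (suc t)
    ask-f   : ∀ {r c d σ σ' t} → A (toBits (lookup σ r)) ≡ false → Exec A d σ σ' t → Exec A (ask r c d) σ σ' (suc t)

  Det : Cmd → Set
  Det skip        = ⊤
  Det fail        = ⊤
  Det (put _ _)   = ⊤
  Det (pick _ _)  = ⊥
  Det (pop _)     = ⊤
  Det (c ⨾ d)     = Det c × Det d
  Det (ifc _ c d) = Det c × Det d
  Det (while _ c) = Det c
  Det (amb _ _)   = ⊥
  Det (ask _ c d) = Det c × Det d

  module _ {A : Lang} where
    private
      split-≤ : ∀ s t {u} → s + t ≤ u → ∃[ t' ] (t ≤ t' × u ≡ s + t')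
      split-≤ s t le with m≤n⇒∃[o]m+o≡n le
      ... | o , refl = t + o , m≤m+n t o , +-assoc s t o

    put₁ : ∀ {r f σ} → Exec A (put r f) σ (doOp (push r (f (tops σ))) σ) 1
    put₁ = put

    pop₁ : ∀ {r σ} → Exec A (pop r) σ (doOp (pop r) σ) 1
    pop₁ = pop

    Exec-mono : ∀ {c σ σ' s t} → Exec A c σ σ' s → s ≤ t → Exec A c σ σ' t
    Exec-mono skip le = skip
    Exec-mono put (s≤s le) = put
    Exec-mono (pick i) (s≤s le) = pick i
    Exec-mono pop (s≤s le) = pop
    Exec-mono (_⨾_ {s = s} {t} e f) le with split-≤ s t le
    ... | t' , le' , refl = e ⨾ Exec-mono f le'
    Exec-mono (if-t x e) (s≤s le) = if-t x (Exec-mono e le)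
    Exec-mono (if-f x e) (s≤s le) = if-f x (Exec-mono e le)
    Exec-mono (while-t {s = s} {t} x e f) (s≤s le) with split-≤ s t le
    ... | t' , le' , refl = while-t x e (Exec-mono f le')
    Exec-mono (while-f x) (s≤s le) = while-f x
    Exec-mono (amb-l e) (s≤s le) = amb-l (Exec-mono e le)
    Exec-mono (amb-r e) (s≤s le) = amb-r (Exec-mono e le)
    Exec-mono (ask-t x e) (s≤s le) = ask-t x (Exec-mono e le)
    Exec-mono (ask-f x e) (s≤s le) = ask-f x (Exec-mono e le)

    Exec-to : ∀ {c σ σ₁ σ₂ t} → σ₁ ≡ σ₂ → Exec A c σ σ₁ t → Exec A c σ σ₂ t
    Exec-to refl e = e

    Exec-from : ∀ {c σ₁ σ₂ σ t} → σ₁ ≡ σ₂ → Exec A c σ₁ σ t → Exec A c σ₂ σ t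
    Exec-from refl e = e

    Exec-size : ∀ {c σ σ' t} → Exec A c σ σ' t → size# σ' ≤ size# σ + t
    Exec-size skip = m≤m+n _ _
    Exec-size (put {r} {f} {σ} {t}) = ≤-trans (size-doOp (push r (f (tops σ))) σ) (≤-trans (s≤s (m≤m+n _ t)) (≤-reflexive (sym (+-suc _ t))))
    Exec-size (pick {r} {f} {σ} {t} {a} i) = ≤-trans (size-doOp (push r a) σ) (≤-trans (s≤s (m≤m+n _ t)) (≤-reflexive (sym (+-suc _ t))))
    Exec-size (pop {r} {σ} {t}) = ≤-trans (size-doOp (pop r) σ) (≤-trans (s≤s (m≤m+n _ t)) (≤-reflexive (sym (+-suc _ t))))
    Exec-size (_⨾_ {s = s} {t} e f) = ≤-trans (Exec-size f) (≤-trans (+-monoˡ-≤ t (Exec-size e)) (≤-reflexive (+-assoc _ s t)))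
    Exec-size (if-t x e) = ≤-trans (Exec-size e) (+-monoʳ-≤ _ (n≤1+n _))
    Exec-size (if-f x e) = ≤-trans (Exec-size e) (+-monoʳ-≤ _ (n≤1+n _))
    Exec-size (while-t {s = s} {t} x e f) =
      ≤-trans (Exec-size f) (≤-trans (+-monoˡ-≤ t (Exec-size e)) (≤-trans (≤-reflexive (+-assoc _ s t)) (+-monoʳ-≤ _ (n≤1+n _))))
    Exec-size (while-f x) = m≤m+n _ _
    Exec-size (amb-l e) = ≤-trans (Exec-size e) (+-monoʳ-≤ _ (n≤1+n _))
    Exec-size (amb-r e) = ≤-trans (Exec-size e) (+-monoʳ-≤ _ (n≤1+n _))
    Exec-size (ask-t x e) = ≤-trans (Exec-size e) (+-monoʳ-≤ _ (n≤1+n _))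
    Exec-size (ask-f x e) = ≤-trans (Exec-size e) (+-monoʳ-≤ _ (n≤1+n _))

    private
      clash : ∀ {b : Bool} {P : Set} → b ≡ true → b ≡ false → P
      clash refl ()

    -- This makes one direction of the analysis free: exhibiting an execution of a deterministic
    -- command also determines the result of any given execution of it.
    Exec-det : ∀ {c σ σ₁ σ₂ s t} → Det c → Exec A c σ σ₁ s → Exec A c σ σ₂ t → σ₁ ≡ σ₂
    Exec-det d skip skip = refl
    Exec-det d put put = refl
    Exec-det d pop pop = refl
    Exec-det (d , d') (e ⨾ f) (e' ⨾ f') with refl ← Exec-det d e e' = Exec-det d' f f'
    Exec-det (d , _) (if-t _ e) (if-t _ e') = Exec-det d e e'
    Exec-det d (if-t x _) (if-f y _) = clash x y
    Exec-det d (if-f x _) (if-t y _) = clash y x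
    Exec-det (_ , d) (if-f _ e) (if-f _ e') = Exec-det d e e'
    Exec-det d (while-t _ e f) (while-t _ e' f') with refl ← Exec-det d e e' = Exec-det d f f'
    Exec-det d (while-t x _ _) (while-f y) = clash x y
    Exec-det d (while-f x) (while-t y _ _) = clash y x
    Exec-det d (while-f _) (while-f _) = refl
    Exec-det (d , _) (ask-t _ e) (ask-t _ e') = Exec-det d e e'
    Exec-det d (ask-t x _) (ask-f y _) = clash x y
    Exec-det d (ask-f x _) (ask-t y _) = clash y x
    Exec-det (_ , d) (ask-f _ e) (ask-f _ e') = Exec-det d e e'

  Label : Cmd → Set
  Label skip        = ⊥
  Label fail        = ⊤
  Label (put _ _)   = ⊤
  Label (pick _ _)  = ⊤
  Label (pop _)     = ⊤
  Label (c ⨾ d)     = Label c ⊎ Label d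
  Label (ifc _ c d) = Maybe (Label c ⊎ Label d)
  Label (while _ c) = Maybe (Label c)
  Label (amb c d)   = Maybe (Label c ⊎ Label d)
  Label (ask _ c d) = Maybe (Label c ⊎ Label d)

  finLabel : ∀ c → Finite (Label c)
  finLabel skip        = fin⊥
  finLabel fail        = fin⊤
  finLabel (put _ _)   = fin⊤
  finLabel (pick _ _)  = fin⊤
  finLabel (pop _)     = fin⊤
  finLabel (c ⨾ d)     = fin⊎ (finLabel c) (finLabel d)
  finLabel (ifc _ c d) = finMaybe (fin⊎ (finLabel c) (finLabel d))
  finLabel (while _ c) = finMaybe (finLabel c)
  finLabel (amb c d)   = finMaybe (fin⊎ (finLabel c) (finLabel d))
  finLabel (ask _ c d) = finMaybe (fin⊎ (finLabel c) (finLabel d))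

  module _ {X : Set} where
    -- ι embeds the labels of the command into those of the whole program, and
    -- y is the label at which control continues after the command.
    entry : (c : Cmd) → (Label c → X) → Maybe X → Maybe X
    entry skip        ι y = y
    entry fail        ι y = just (ι tt)
    entry (put _ _)   ι y = just (ι tt)
    entry (pick _ _)  ι y = just (ι tt)
    entry (pop _)     ι y = just (ι tt)
    entry (c ⨾ d)     ι y = entry c (ι ∘ inj₁) (entry d (ι ∘ inj₂) y)
    entry (ifc _ c d) ι y = just (ι nothing)
    entry (while _ c) ι y = just (ι nothing)
    entry (amb c d)   ι y = just (ι nothing)
    entry (ask _ c d) ι y = just (ι nothing)

    code : (c : Cmd) → (Label c → X) → Maybe X → Label c → Ins X
    code fail        ι y _ = go (λ _ → [])
    code (put r f)   ι y _ = go (λ v → (push r (f v) , y) ∷ [])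
    code (pick r f)  ι y _ = go (λ v → map (λ a → push r a , y) (f v))
    code (pop r)     ι y _ = go (λ v → (pop r , y) ∷ [])
    code (c ⨾ d)     ι y (inj₁ l) = code c (ι ∘ inj₁) (entry d (ι ∘ inj₂) y) l
    code (c ⨾ d)     ι y (inj₂ l) = code d (ι ∘ inj₂) y l
    code (ifc g c d) ι y nothing = go (λ v → (nop , (if g v then entry c (ι ∘ just ∘ inj₁) y else entry d (ι ∘ just ∘ inj₂) y)) ∷ [])
    code (ifc g c d) ι y (just (inj₁ l)) = code c (ι ∘ just ∘ inj₁) y l
    code (ifc g c d) ι y (just (inj₂ l)) = code d (ι ∘ just ∘ inj₂) y l
    code (while g c) ι y nothing = go (λ v → (nop , (if g v then entry c (ι ∘ just) (just (ι nothing)) else y)) ∷ [])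
    code (while g c) ι y (just l) = code c (ι ∘ just) (just (ι nothing)) l
    code (amb c d)   ι y nothing = go (λ _ → (nop , entry c (ι ∘ just ∘ inj₁) y) ∷ (nop , entry d (ι ∘ just ∘ inj₂) y) ∷ [])
    code (amb c d)   ι y (just (inj₁ l)) = code c (ι ∘ just ∘ inj₁) y l
    code (amb c d)   ι y (just (inj₂ l)) = code d (ι ∘ just ∘ inj₂) y l
    code (ask r c d) ι y nothing = ask r (λ b → if b then entry c (ι ∘ just ∘ inj₁) y else entry d (ι ∘ just ∘ inj₂) y)
    code (ask r c d) ι y (just (inj₁ l)) = code c (ι ∘ just ∘ inj₁) y l
    code (ask r c d) ι y (just (inj₂ l)) = code d (ι ∘ just ∘ inj₂) y l

  module _ (X : Set) (finX : Finite X) (start : Maybe X) (prog : X → Ins X) (A : Lang) where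
    open SM X finX start prog using (SAcc; SAcc-mono; acc; go; ask)

    private
      if-true : ∀ {b} {y y' : Maybe X} → b ≡ true → (if b then y else y') ≡ y
      if-true refl = refl
      if-false : ∀ {b} {y y' : Maybe X} → b ≡ false → (if b then y else y') ≡ y'
      if-false refl = refl

    Implements : (c : Cmd) → (Label c → X) → Maybe X → Set
    Implements c ι y = ∀ l → prog (ι l) ≡ code c ι y l

    Exec⇒SAcc : ∀ {c σ σ' t} → Exec A c σ σ' t → ∀ ι y → Implements c ι y → ∀ {n} → SAcc A n y σ' → SAcc A (t + n) (entry c ι y) σ
    Exec⇒SAcc (skip {t = t}) ι y im {n} a = SAcc-mono a (m≤n+m n t)
    Exec⇒SAcc (put {t = t}) ι y im {n} a = go (im tt) (here refl) (SAcc-mono a (m≤n+m n t))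
    Exec⇒SAcc (pick {t = t} i) ι y im {n} a = go (im tt) (∈-map⁺ _ i) (SAcc-mono a (m≤n+m n t))
    Exec⇒SAcc (pop {t = t}) ι y im {n} a = go (im tt) (here refl) (SAcc-mono a (m≤n+m n t))
    Exec⇒SAcc (_⨾_ {c} {d} {s = s} {t} e f) ι y im {n} a =
      SAcc-mono (Exec⇒SAcc e _ _ (im ∘ inj₁) (Exec⇒SAcc f _ _ (im ∘ inj₂) a)) (≤-reflexive (sym (+-assoc s t n)))
    Exec⇒SAcc (if-t x e) ι y im a = go (im nothing) (here (cong (nop ,_) (sym (if-true x)))) (Exec⇒SAcc e _ _ (im ∘ just ∘ inj₁) a)
    Exec⇒SAcc (if-f x e) ι y im a = go (im nothing) (here (cong (nop ,_) (sym (if-false x)))) (Exec⇒SAcc e _ _ (im ∘ just ∘ inj₂) a)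
    Exec⇒SAcc (while-t {s = s} {t} x e f) ι y im {n} a = go (im nothing) (here (cong (nop ,_) (sym (if-true x))))
      (SAcc-mono (Exec⇒SAcc e _ _ (im ∘ just) (Exec⇒SAcc f ι y im a)) (≤-reflexive (sym (+-assoc s t n))))
    Exec⇒SAcc (while-f {t = t} x) ι y im {n} a = go (im nothing) (here (cong (nop ,_) (sym (if-false x)))) (SAcc-mono a (m≤n+m n t))
    Exec⇒SAcc (amb-l e) ι y im a = go (im nothing) (here refl) (Exec⇒SAcc e _ _ (im ∘ just ∘ inj₁) a)
    Exec⇒SAcc (amb-r e) ι y im a = go (im nothing) (there (here refl)) (Exec⇒SAcc e _ _ (im ∘ just ∘ inj₂) a)
    Exec⇒SAcc (ask-t x e) ι y im a = ask (im nothing) (subst (λ y' → SAcc A _ y' _) (sym (if-true x)) (Exec⇒SAcc e _ _ (im ∘ just ∘ inj₁) a))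
    Exec⇒SAcc (ask-f x e) ι y im a = ask (im nothing) (subst (λ y' → SAcc A _ y' _) (sym (if-false x)) (Exec⇒SAcc e _ _ (im ∘ just ∘ inj₂) a))

    Outcome : Cmd → Maybe X → ℕ → Store → Set
    Outcome c y n σ = ∃[ σ' ] ∃[ t ] (Exec A c σ σ' t × ∃[ n' ] (n' ≤ n × SAcc A n' y σ'))

    private
      GoInv : ℕ → X → Store → (Tops → List (Op × Maybe X)) → Set
      GoInv n x σ f = ∃[ op ] ∃[ y ] ∃[ n' ] (n ≡ suc n' × (op , y) ∈ f (tops σ) × SAcc A n' y (doOp op σ))

      go-inv : ∀ {n x σ f} → prog x ≡ go f → SAcc A n (just x) σ → GoInv n x σ f
      go-inv e (go e' i a) with refl ← sym e ∙ e' = _ , _ , _ , refl , i , a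
      go-inv e (ask e' a) with sym e ∙ e'
      ... | ()

      ask-inv : ∀ {n x σ r k} → prog x ≡ ask r k → SAcc A n (just x) σ → ∃[ n' ] (n ≡ suc n' × SAcc A n' (k (A (toBits (lookup σ r)))) σ)
      ask-inv e (go e' i a) with sym e ∙ e'
      ... | ()
      ask-inv e (ask e' a) with refl ← sym e ∙ e' = _ , refl , a

    SAcc⇒Exec : ∀ c ι y → Implements c ι y → ∀ n {σ} → SAcc A n (entry c ι y) σ → Outcome c y n σ
    -- The extra bound `k` provides termination: each round takes at least one step off `n`, but by
    -- an amount that depends on the body.
    while-unfold : ∀ k g c ι y → Implements (while g c) ι y → ∀ n {σ} → n ≤ k → SAcc A n (entry (while g c) ι y) σ → Outcome (while g c) y n σ

    SAcc⇒Exec skip ι y im n a = _ , 0 , skip , n , ≤-refl , a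
    SAcc⇒Exec fail ι y im n a with go-inv (im tt) a
    ... | _ , _ , _ , _ , () , _
    SAcc⇒Exec (put r f) ι y im n a with go-inv (im tt) a
    ... | _ , _ , n' , refl , here refl , a' = _ , 1 , put , n' , n≤1+n n' , a'
    SAcc⇒Exec (pick r f) ι y im n a with go-inv (im tt) a
    ... | _ , _ , n' , refl , i , a' with ∈-map⁻ _ i
    ... | _ , j , refl = _ , 1 , pick j , n' , n≤1+n n' , a'
    SAcc⇒Exec (pop r) ι y im n a with go-inv (im tt) a
    ... | _ , _ , n' , refl , here refl , a' = _ , 1 , pop , n' , n≤1+n n' , a'
    SAcc⇒Exec (c ⨾ d) ι y im n a with SAcc⇒Exec c _ _ (im ∘ inj₁) n a
    ... | _ , _ , e , n₁ , le , a₁ with SAcc⇒Exec d _ _ (im ∘ inj₂) n₁ a₁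
    ... | _ , _ , e' , n₂ , le' , a₂ = _ , _ , e ⨾ e' , n₂ , ≤-trans le' le , a₂
    SAcc⇒Exec (ifc g c d) ι y im n {σ} a with go-inv (im nothing) a
    ... | _ , _ , n' , refl , here refl , a' with g (tops σ) in eq
    ... | true = let (_ , _ , e , n₁ , le , a₁) = SAcc⇒Exec c _ _ (im ∘ just ∘ inj₁) n' a' in _ , _ , if-t eq e , n₁ , m≤n⇒m≤1+n le , a₁
    ... | false = let (_ , _ , e , n₁ , le , a₁) = SAcc⇒Exec d _ _ (im ∘ just ∘ inj₂) n' a' in _ , _ , if-f eq e , n₁ , m≤n⇒m≤1+n le , a₁
    SAcc⇒Exec (while g c) ι y im n a = while-unfold n g c ι y im n ≤-refl a
    SAcc⇒Exec (amb c d) ι y im n a with go-inv (im nothing) a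
    ... | _ , _ , n' , refl , here refl , a' =
      let (_ , _ , e , n₁ , le , a₁) = SAcc⇒Exec c _ _ (im ∘ just ∘ inj₁) n' a' in _ , _ , amb-l e , n₁ , m≤n⇒m≤1+n le , a₁
    ... | _ , _ , n' , refl , there (here refl) , a' =
      let (_ , _ , e , n₁ , le , a₁) = SAcc⇒Exec d _ _ (im ∘ just ∘ inj₂) n' a' in _ , _ , amb-r e , n₁ , m≤n⇒m≤1+n le , a₁
    SAcc⇒Exec (ask r c d) ι y im n {σ} a with ask-inv (im nothing) a
    ... | n' , refl , a' with A (toBits (lookup σ r)) in eq
    ... | true = let (_ , _ , e , n₁ , le , a₁) = SAcc⇒Exec c _ _ (im ∘ just ∘ inj₁) n' a' in _ , _ , ask-t eq e , n₁ , m≤n⇒m≤1+n le , a₁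
    ... | false = let (_ , _ , e , n₁ , le , a₁) = SAcc⇒Exec d _ _ (im ∘ just ∘ inj₂) n' a' in _ , _ , ask-f eq e , n₁ , m≤n⇒m≤1+n le , a₁

    while-unfold k g c ι y im n {σ} le a with go-inv (im nothing) a
    while-unfold (suc k) g c ι y im _ {σ} (s≤s le) a | _ , _ , n' , refl , here refl , a' with g (tops σ) in eq
    ... | false = _ , 1 , while-f eq , n' , n≤1+n n' , a'
    ... | true with SAcc⇒Exec c _ _ (im ∘ just) n' a'
    ... | _ , _ , e , n₁ , le₁ , a₁ with while-unfold k g c ι y im n₁ (≤-trans le₁ le) a₁
    ... | _ , _ , e' , n₂ , le₂ , a₂ = _ , _ , while-t eq e e' , n₂ , m≤n⇒m≤1+n (≤-trans le₂ le₁) , a₂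

  module Compiled (c : Cmd) (A : Lang) where
    private
      X : Set
      X = Label c
      start : Maybe X
      start = entry c id nothing
      prog : X → Ins X
      prog = code c id nothing
      module S = SM X (finLabel c) start prog
      module C = S.Compile S.finStates S.finCells A

    compiled : OTM
    compiled = C.machine

    compiled-complete : ∀ {x σ' t} → Exec A c (input x) σ' t → AcceptsIn compiled A (suc (C.cost (length x + t) t)) (initial compiled x)
    compiled-complete {x} {t = t} e = C.machine-complete
      (subst (λ n → S.SAcc A n start (input x)) (+-identityʳ t) (Exec⇒SAcc X (finLabel c) start prog A e id nothing (λ _ → refl) {0} S.acc))

    compiled-sound : ∀ {x n} → AcceptsIn compiled A n (initial compiled x) → ∃[ σ' ] ∃[ t ] Exec A c (input x) σ' t
    compiled-sound a with C.machine-sound a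
    ... | n , b with SAcc⇒Exec X (finLabel c) start prog A c id nothing (λ _ → refl) n b
    ... | σ' , t , e , _ = σ' , t , e

  program⇒NP : ∀ c {A L} (T : PolyFn) → (∀ x → L x ≡ true → ∃[ σ' ] Exec A c (input x) σ' (fn T (length x)))
             → (∀ x {σ' t} → Exec A c (input x) σ' t → L x ≡ true) → NP[ A ] L
  program⇒NP c {A} {L} T complete sound = compiled , polyBound B , λ x →
    (λ Lx → AcceptsIn-mono (compiled-complete (proj₂ (complete x Lx))) (≤-polyBound B (length x))) ,
    (λ a → let (_ , _ , e) = compiled-sound a in sound x e)
    where
    open Compiled c A
    B : PolyFn
    -- With t = `fn T n` this is `suc (cost (n + t) t)`: the initial store has size n and t
    -- instructions add at most t symbols.
    B = constP 1 ⊕ T ⊗ (constP 5 ⊕ ((idP ⊕ T) ⊕ (idP ⊕ T)))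

-- n + m and a * n + m, by recursions that match accumulating loops
-- definitionally.
addAcc : ℕ → ℕ → ℕ
addAcc zero    m = m
addAcc (suc n) m = addAcc n (suc m)

mulAcc : ℕ → ℕ → ℕ → ℕ
mulAcc zero    n m = m
mulAcc (suc a) n m = mulAcc a n (addAcc n m)

addAcc≡+ : ∀ n m → addAcc n m ≡ n + m
addAcc≡+ zero m = refl
addAcc≡+ (suc n) m = addAcc≡+ n (suc m) ∙ +-suc n m

mulAcc≡* : ∀ a n m → mulAcc a n m ≡ a * n + m
mulAcc≡* zero n m = refl
mulAcc≡* (suc a) n m = mulAcc≡* a n (addAcc n m) ∙ cong (a * n +_) (addAcc≡+ n m) ∙ arith (a * n) n m
  where
  open +-*-Solver
  arith : ∀ x n m → x + (n + m) ≡ n + x + m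
  arith = solve 3 (λ x n m → x :+ (n :+ m) := n :+ x :+ m) refl

-- Cost of computing a polynomial clock in unary

times*-cost : ℕ → ℕ → ℕ
times*-cost n zero    = 1
times*-cost n (suc a) = suc (1 + (suc n * 4 + suc n * 3) + times*-cost n a)

times-cost : ℕ → ℕ → ℕ
times-cost n a = times*-cost n a + suc (a * n) * 3

power-cost : ℕ → ℕ → ℕ → ℕ
power-cost n zero    a = 0
power-cost n (suc k) a = times-cost n a + power-cost n k (a * n)

private
  times*-cost≡ : ∀ n a → times*-cost n a ≡ suc (a * (9 + n * 7))
  times*-cost≡ n zero = refl
  times*-cost≡ n (suc a) = cong (λ k → suc (1 + (suc n * 4 + suc n * 3) + k)) (times*-cost≡ n a) ∙ arith n a
    where
    open +-*-Solver
    arith : ∀ n a → suc (1 + (suc n * 4 + suc n * 3) + suc (a * (9 + n * 7))) ≡ suc (suc a * (9 + n * 7))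
    arith = solve 2 (λ n a → con 1 :+ (con 1 :+ ((con 1 :+ n) :* con 4 :+ (con 1 :+ n) :* con 3) :+ (con 1 :+ a :* (con 9 :+ n :* con 7)))
              := con 1 :+ ((con 1 :+ a) :* (con 9 :+ n :* con 7))) refl

  -- Bounds one multiplication of the clock by `n` while the clock is at most `b` before and after
  -- it.
  factor : ℕ → ℕ → ℕ
  factor n b = suc (b * (9 + n * 7)) + suc b * 3

  -- The hypothesis uses the base `suc n` so that it bounds every intermediate clock value,
  -- including `a` itself when n = 0.
  power-cost≤ : ∀ n k a {b} → a * suc n ^ k ≤ b → power-cost n k a ≤ k * factor n b
  power-cost≤ n zero a le = z≤n
  power-cost≤ n (suc k) a {b} le = +-mono-≤
    (+-mono-≤ (≤-trans (≤-reflexive (times*-cost≡ n a)) (s≤s (*-monoˡ-≤ (9 + n * 7) a≤)))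
              (*-monoˡ-≤ 3 (s≤s (≤-trans (*-monoʳ-≤ a (n≤1+n n)) a*n≤))))
    (power-cost≤ n k (a * n) (≤-trans (≤-reflexive (*-assoc a n (suc n ^ k))) (≤-trans (*-monoʳ-≤ a (*-monoˡ-≤ (suc n ^ k) (n≤1+n n))) le)))
    where
    a*n≤ : a * suc n ≤ b
    a*n≤ = ≤-trans (≤-trans (≤-reflexive (sym (*-identityʳ (a * suc n)))) (*-monoʳ-≤ (a * suc n) (m^n>0 (suc n) k)))
             (≤-trans (≤-reflexive (*-assoc a (suc n) (suc n ^ k))) le)
    a≤ : a ≤ b
    a≤ = ≤-trans (≤-trans (≤-reflexive (sym (*-identityʳ a))) (*-monoʳ-≤ a (s≤s z≤n))) a*n≤

powP : ℕ → PolyFn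
powP zero    = constP 1
powP (suc k) = (constP 1 ⊕ idP) ⊗ powP k

powP≡ : ∀ k n → fn (powP k) n ≡ suc n ^ k
powP≡ zero n = refl
powP≡ (suc k) n = cong (suc n *_) (powP≡ k n)

clockP : ℕ → PolyFn
clockP c = constP c ⊕ (constP c ⊗ ((constP 1 ⊕ B ⊗ (constP 9 ⊕ idP ⊗ constP 7)) ⊕ (constP 1 ⊕ B) ⊗ constP 3) ⊕ constP c)
  where B = constP c ⊗ powP c

clock-cost≤ : ∀ c n → c + (power-cost n c c + c) ≤ fn (clockP c) n
clock-cost≤ c n = +-monoʳ-≤ c (+-monoˡ-≤ c (power-cost≤ n c c (≤-reflexive (cong (c *_) (sym (powP≡ c n))))))

-- Registers and the program for the clock

module Registers (W : Set) (finW : Finite W) where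

  open Program (Maybe Bool ⊎ W) (fin⊎ (finMaybe finBool) finW) 8 public

  -- A `dot` is a tick of the clock and also a blank; `mark b` stands on top of a recorded query
  -- that was given the answer `b`; `own w` is left to the individual program.
  pattern bit b  = inj₁ b
  pattern dot    = inj₂ (inj₁ nothing)
  pattern mark b = inj₂ (inj₁ (just b))
  pattern own w  = inj₂ (inj₂ w)

  -- During a simulation `WL` and `INP` are the parts of the work tape left of and from the head,
  -- and `QL`, `QR` those of the query tape. `STA` is a stack of options taken, `REC` collects the
  -- queries, `ENV` keeps the second component of an input pair, and `SAV` is storage that survives
  -- calls.
  pattern INP = zero
  pattern WL  = suc zero
  pattern QL  = suc (suc zero)
  pattern QR  = suc (suc (suc zero))
  pattern STA = suc (suc (suc (suc zero)))
  pattern CLK = suc (suc (suc (suc (suc zero))))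
  pattern REC = suc (suc (suc (suc (suc (suc zero)))))
  pattern ENV = suc (suc (suc (suc (suc (suc (suc zero))))))
  pattern SAV = suc (suc (suc (suc (suc (suc (suc (suc zero)))))))

  pattern regs inp wl ql qr s clk rec env sav =
    inp ∷ wl ∷ ql ∷ qr ∷ s ∷ clk ∷ rec ∷ env ∷ sav ∷ []

  has : Reg → Tops → Bool
  has r v = is-just (lookup v r)

  isBit : Maybe Sym → Bool
  isBit (just (bit _)) = true
  isBit _              = false

  isBitOf : Bool → Maybe Sym → Bool
  isBitOf true  (just (bit true))  = true
  isBitOf false (just (bit false)) = true
  isBitOf _     _                  = false

  isMarkOf : Bool → Maybe Sym → Bool
  isMarkOf true  (just (mark true))  = true
  isMarkOf false (just (mark false)) = true
  isMarkOf _     _                   = false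

  top : Reg → Tops → Sym
  top r v = maybe′ id dot (lookup v r)

  const′ : Sym → Tops → Sym
  const′ a _ = a

  move moveBits : Reg → Reg → Cmd
  move r r'     = while (has r) (put r' (top r) ⨾ pop r)
  moveBits r r' = while (isBit ∘ (λ v → lookup v r)) (put r' (top r) ⨾ pop r)

  clear clearBits : Reg → Cmd
  clear r     = while (has r) (pop r)
  clearBits r = while (isBit ∘ (λ v → lookup v r)) (pop r)

  dots : ℕ → List Sym
  dots zero    = []
  dots (suc n) = dot ∷ dots n

  bits : Str → List Sym
  bits = map inj₁

  ticks : ℕ → Cmd
  ticks zero    = skip
  ticks (suc k) = put CLK (const′ dot) ⨾ ticks k

  -- Multiplication as repeated addition: for every tick on `CLK`, the input is moved to `WL` and
  -- back, leaving one tick on `QR` for each of its symbols.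
  tickInput times times* : Cmd
  tickInput = while (has INP) (put WL (top INP) ⨾ pop INP ⨾ put QR (const′ dot))
  times*    = while (has CLK) (pop CLK ⨾ tickInput ⨾ move WL INP)
  times     = times* ⨾ move QR CLK

  power : ℕ → Cmd
  power zero    = skip
  power (suc k) = times ⨾ power k

  clock : ℕ → Cmd
  clock c = ticks c ⨾ power c ⨾ ticks c

  ticks-det : ∀ c → Det (ticks c)
  ticks-det zero = tt
  ticks-det (suc c) = tt , ticks-det c

  power-det : ∀ c → Det (power c)
  power-det zero = tt
  power-det (suc c) = ((tt , (tt , tt , tt) , tt , tt) , tt , tt) , power-det c

  clock-det : ∀ c → Det (clock c)
  clock-det c = ticks-det c , power-det c , ticks-det c

  module _ {A : Lang} where
    ticks-exec : ∀ k {inp wl ql qr s n rec env sav} →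
      Exec A (ticks k) (regs inp wl ql qr s (dots n) rec env sav) (regs inp wl ql qr s (dots (addAcc k n)) rec env sav) k
    ticks-exec zero = skip
    ticks-exec (suc k) {n = n} = put₁ ⨾ ticks-exec k {n = suc n}

    tickInput-exec : ∀ inp {wl ql n s clk rec env sav} →
      Exec A tickInput (regs inp wl ql (dots n) s clk rec env sav) (regs [] (inp ʳ++ wl) ql (dots (addAcc (length inp) n)) s clk rec env sav)
        (suc (length inp) * 4)
    tickInput-exec [] = while-f refl
    tickInput-exec (a ∷ inp) {n = n} = while-t refl (put₁ ⨾ pop₁ ⨾ put₁) (tickInput-exec inp {n = suc n})

    moveWL-INP : ∀ wl {inp ql qr s clk rec env sav} →
      Exec A (move WL INP) (regs inp wl ql qr s clk rec env sav) (regs (wl ʳ++ inp) [] ql qr s clk rec env sav) (suc (length wl) * 3)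
    moveWL-INP [] = while-f refl
    moveWL-INP (a ∷ wl) = while-t refl (put₁ ⨾ pop₁) (moveWL-INP wl)

    ticksQR-CLK : ∀ k {inp wl ql s n rec env sav} →
      Exec A (move QR CLK) (regs inp wl ql (dots k) s (dots n) rec env sav) (regs inp wl ql [] s (dots (addAcc k n)) rec env sav) (suc k * 3)
    ticksQR-CLK zero = while-f refl
    ticksQR-CLK (suc k) {n = n} = while-t refl (put₁ ⨾ pop₁) (ticksQR-CLK k {n = suc n})

    times*-exec : ∀ a {inp ql n s rec env sav} →
      Exec A times* (regs inp [] ql (dots n) s (dots a) rec env sav) (regs inp [] ql (dots (mulAcc a (length inp) n)) s [] rec env sav)
        (times*-cost (length inp) a)
    times*-exec zero = while-f refl
    times*-exec (suc a) {inp} {ql} {n} {s} {rec} {env} {sav} = while-t refl (pop₁ ⨾ tickInput-exec inp ⨾ back) (times*-exec a)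
      where
      back : Exec A (move WL INP) (regs [] (inp ʳ++ []) ql (dots (addAcc (length inp) n)) s (dots a) rec env sav)
               (regs inp [] ql (dots (addAcc (length inp) n)) s (dots a) rec env sav) (suc (length inp) * 3)
      back = Exec-to (cong (λ i → regs i [] ql (dots (addAcc (length inp) n)) s (dots a) rec env sav) (ʳ++-ʳ++-[] inp []))
               (Exec-mono (moveWL-INP (inp ʳ++ [])) (≤-reflexive (cong (λ k → suc k * 3) (length-ʳ++ inp ∙ +-identityʳ _))))

    times-exec : ∀ a {inp ql s rec env sav} →
      Exec A times (regs inp [] ql [] s (dots a) rec env sav) (regs inp [] ql [] s (dots (a * length inp)) rec env sav) (times-cost (length inp) a)
    times-exec a {inp} {ql} {s} {rec} {env} {sav} =
      Exec-to (cong (λ k → regs inp [] ql (dots k) s [] rec env sav) (mulAcc≡* a (length inp) 0 ∙ +-identityʳ _)) (times*-exec a) ⨾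
      Exec-to (cong (λ k → regs inp [] ql [] s (dots k) rec env sav) (addAcc≡+ (a * length inp) 0 ∙ +-identityʳ _))
        (ticksQR-CLK (a * length inp))

    power-exec : ∀ k a {inp ql s rec env sav} →
      Exec A (power k) (regs inp [] ql [] s (dots a) rec env sav) (regs inp [] ql [] s (dots (a * length inp ^ k)) rec env sav) (power-cost (length inp) k a)
    power-exec zero a {inp} {ql} {s} {rec} {env} {sav} =
      Exec-to (cong (λ k → regs inp [] ql [] s (dots k) rec env sav) (sym (*-identityʳ a))) skip
    power-exec (suc k) a {inp} {ql} {s} {rec} {env} {sav} = times-exec a ⨾
      Exec-to (cong (λ j → regs inp [] ql [] s (dots j) rec env sav) (*-assoc a (length inp) (length inp ^ k))) (power-exec k (a * length inp))

    clock-exec : ∀ c {inp ql s rec env sav} →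
      Exec A (clock c) (regs inp [] ql [] s [] rec env sav) (regs inp [] ql [] s (dots (poly c (length inp))) rec env sav) (fn (clockP c) (length inp))
    clock-exec c {inp} {ql} {s} {rec} {env} {sav} = Exec-mono
      (Exec-to (cong (λ k → regs inp [] ql [] s (dots k) rec env sav) (addAcc≡+ c 0 ∙ +-identityʳ c)) (ticks-exec c {n = 0}) ⨾
       (power-exec c c ⨾
        Exec-to (cong (λ k → regs inp [] ql [] s (dots k) rec env sav) (addAcc≡+ c _ ∙ +-comm c _)) (ticks-exec c {n = c * length inp ^ c})))
      (clock-cost≤ c (length inp))

-- Computations with guessed oracle answers

∨-true : ∀ {a b} → a ∨ b ≡ true → a ≡ true ⊎ b ≡ true
∨-true {true} e = inj₁ refl
∨-true {false} e = inj₂ e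

∨-introˡ : ∀ {a b} → a ≡ true → a ∨ b ≡ true
∨-introˡ refl = refl

∨-introʳ : ∀ {a b} → b ≡ true → a ∨ b ≡ true
∨-introʳ {a} refl = ∨-zeroʳ a

∧-true : ∀ {a b} → a ∧ b ≡ true → a ≡ true × b ≡ true
∧-true {true} {true} e = refl , refl

∧-intro : ∀ {a b} → a ≡ true → b ≡ true → a ∧ b ≡ true
∧-intro refl refl = refl

bool-ext : ∀ {a b} → (a ≡ true → b ≡ true) → (b ≡ true → a ≡ true) → a ≡ b
bool-ext {true} f g = sym (f refl)
bool-ext {false} {false} f g = refl
bool-ext {false} {true} f g = g refl

does-yes : ∀ {n} {i j : Fin n} → i ≡ j → does (i ≟F j) ≡ true
does-yes {i = i} {j} e with i ≟F j
... | yes _ = refl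
... | no ne = ⊥-elim (ne e)

does-no : ∀ {n} {i j : Fin n} → i ≢ j → does (i ≟F j) ≡ false
does-no {i = i} {j} ne with i ≟F j
... | yes e = ⊥-elim (ne e)
... | no _ = refl

does-≡ : ∀ {n} {i j : Fin n} → does (i ≟F j) ≡ true → i ≡ j
does-≡ {i = i} {j} e with i ≟F j
... | yes p = p

does-≢ : ∀ {n} {i j : Fin n} → does (i ≟F j) ≡ false → i ≢ j
does-≢ {i = i} {j} e with i ≟F j
... | no p = p

any-intro : ∀ {A : Set} {f : A → Bool} {x xs} → x ∈ xs → f x ≡ true → any f xs ≡ true
any-intro (here refl) e = ∨-introˡ e
any-intro {f = f} {xs = y ∷ _} (there i) e = ∨-introʳ {f y} (any-intro i e)

any-elim : ∀ {A : Set} {f : A → Bool} xs → any f xs ≡ true → ∃[ x ] (x ∈ xs × f x ≡ true)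
any-elim {f = f} (x ∷ xs) e with ∨-true {f x} e
... | inj₁ p = x , here refl , p
... | inj₂ p with any-elim xs p
... | y , i , q = y , there i , q

Trace : Set
Trace = List (Bool × Str)

Sat : (Bool → Str → Bool) → Trace → Set
Sat Y = All (λ bq → Y (proj₁ bq) (proj₂ bq) ≡ true)

answers : Lang → Bool → Str → Bool
answers B true  q = B q
answers B false q = not (B q)

answers-self : ∀ B q → answers B (B q) q ≡ true
answers-self B q with B q in e
... | true = e
... | false = cong not e

answers-≡ : ∀ B b q → answers B b q ≡ true → B q ≡ b
answers-≡ B true q e = e
answers-≡ B false q e = sym (not-involutive (B q)) ∙ cong not e

module _ (M : OTM) where
  open OTM M renaming (yes to yesQ; no to noQ)

  -- Computations without an oracle; the oracle enters only afterwards, through `Sat` of the trace.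
  -- The condition in `asked` loses no acceptance: where the query state is the accepting state,
  -- `halt` applies.
  data Run : ℕ → Config M → Trace → Set where
    halt  : ∀ {n c} → Config.state c ≡ accept → Run n c []
    asked : ∀ {n w qs p tr} b → query ≢ accept → Run n (config (if b then yesQ else noQ) w (tape [] 0)) tr
          → Run (suc n) (config query w (tape qs p)) ((b , decodeQuery qs) ∷ tr)
    trans : ∀ {n q w t q' a dw b dt tr} → q ≢ query → q ≢ accept → (q' , a , dw , b , dt) ∈ δ q (read w) (read t)
          → Run n (config q' (update a dw w) (update b dt t)) tr → Run (suc n) (config q w t) tr

  AcceptsIn⇒Run : ∀ {B n c} → AcceptsIn M B n c → ∃[ tr ] (Run n c tr × Sat (answers B) tr)
  AcceptsIn⇒Run (halt e) = [] , halt e , []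
  AcceptsIn⇒Run {B} (step (ask {w} {qs} {p}) a) with query ≟F accept
  ... | yes e = [] , halt e , []
  ... | no ne with AcceptsIn⇒Run a
  ... | tr , r , s = (B (decodeQuery qs) , decodeQuery qs) ∷ tr , asked (B (decodeQuery qs)) ne r , answers-self B (decodeQuery qs) ∷ s
  AcceptsIn⇒Run (step (trans nq na i) a) with AcceptsIn⇒Run a
  ... | tr , r , s = tr , trans nq na i r , s

  Run⇒AcceptsIn : ∀ {B n c tr} → Run n c tr → Sat (answers B) tr → AcceptsIn M B n c
  Run⇒AcceptsIn (halt e) s = halt e
  Run⇒AcceptsIn {B} (asked {n} {w} {qs} b ne r) (e ∷ s) = step ask
    (subst (λ b' → AcceptsIn M B n (config (if b' then yesQ else noQ) w (tape [] 0))) (sym (answers-≡ B b (decodeQuery qs) e)) (Run⇒AcceptsIn r s))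
  Run⇒AcceptsIn (trans nq na i r) s = step (trans nq na i) (Run⇒AcceptsIn r s)

  private
    next : Tape (2 + Γ) → Tape 2 → Fin nQ × Fin (3 + Γ) × Move × Fin 3 × Move → Config M
    next w t (q' , a , dw , b , dt) = config q' (update a dw w) (update b dt t)

  -- Decides whether some run has a trace satisfying `Y`, testing each guess as it is made.
  -- `Y true q` and `Y false q` may both hold or both fail, so this makes sense for tests that do
  -- not come from an oracle.
  runs : (Bool → Str → Bool) → ℕ → Config M → Bool
  runs Y zero    (config q w t) = does (q ≟F accept)
  runs Y (suc n) (config q w t) = does (q ≟F accept) ∨
    (if does (q ≟F query)
     then (Y true (decodeQuery (Tape.cells t)) ∧ runs Y n (config yesQ w (tape [] 0)))
          ∨ (Y false (decodeQuery (Tape.cells t)) ∧ runs Y n (config noQ w (tape [] 0)))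
     else any (λ o → runs Y n (next w t o)) (δ q (read w) (read t)))

  Run⇒runs : ∀ {Y n c tr} → Run n c tr → Sat Y tr → runs Y n c ≡ true
  Run⇒runs {n = zero} (halt e) s = does-yes e
  Run⇒runs {n = suc n} (halt e) s = ∨-introˡ (does-yes e)
  Run⇒runs (asked b ne r) s rewrite does-no ne | does-yes {i = query} refl with b | s
  ... | true | e ∷ s' = ∨-introˡ (∧-intro e (Run⇒runs r s'))
  ... | false | e ∷ s' = ∨-introʳ (∧-intro e (Run⇒runs r s'))
  Run⇒runs (trans nq na i r) s rewrite does-no na | does-no nq = any-intro i (Run⇒runs r s)

  runs⇒Run : ∀ {Y} n c → runs Y n c ≡ true → ∃[ tr ] (Run n c tr × Sat Y tr)
  runs⇒Run zero (config q w t) e = [] , halt (does-≡ e) , []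
  runs⇒Run {Y} (suc n) (config q w t) e with q ≟F accept
  ... | yes p = [] , halt p , []
  ... | no na with q ≟F query
  runs⇒Run {Y} (suc n) (config q w (tape qs p)) e | no na | yes refl with ∨-true {Y true (decodeQuery qs) ∧ runs Y n (config yesQ w (tape [] 0))} e
  ... | inj₁ e' = let (y , e'') = ∧-true {Y true (decodeQuery qs)} e' ; (tr , r , s) = runs⇒Run n _ e''
                  in _ , asked true na r , y ∷ s
  ... | inj₂ e' = let (y , e'') = ∧-true {Y false (decodeQuery qs)} e' ; (tr , r , s) = runs⇒Run n _ e''
                  in _ , asked false na r , y ∷ s
  runs⇒Run {Y} (suc n) (config q w t) e | no na | no nq with any-elim (δ q (read w) (read t)) e
  ... | o , i , e' = let (tr , r , s) = runs⇒Run n _ e' in tr , trans nq na i r , s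

  accepts≡runs : ∀ {B c} {L : Lang} → (∀ x → (L x ≡ true → AcceptsIn M B (poly c (length x)) (initial M x))
                                  × (AcceptsIn M B (poly c (length x)) (initial M x) → L x ≡ true))
               → ∀ x → L x ≡ runs (answers B) (poly c (length x)) (initial M x)
  accepts≡runs {B} {c} spec x = bool-ext
    (λ e → let (tr , r , s) = AcceptsIn⇒Run (proj₁ (spec x) e) in Run⇒runs {answers B} r s)
    (λ e → let (tr , r , s) = runs⇒Run {answers B} (poly c (length x)) (initial M x) e in proj₂ (spec x) (Run⇒AcceptsIn {B} r s))

  private
    length-writeL : ∀ {n} (cs : List (Fin (suc n))) {p s} b → length cs ≤ s → p ≤ s → length (writeL cs p b) ≤ suc s
    length-writeL [] {zero} b l≤ p≤ = s≤s z≤n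
    length-writeL [] {suc p} {suc s} b l≤ (s≤s p≤) = s≤s (length-writeL [] b z≤n p≤)
    length-writeL (_ ∷ cs) {zero} b l≤ p≤ = m≤n⇒m≤1+n l≤
    length-writeL (_ ∷ cs) {suc p} {suc s} b (s≤s l≤) (s≤s p≤) = s≤s (length-writeL cs b l≤ p≤)

    movePos≤ : ∀ d {p s} → p ≤ s → movePos d p ≤ suc s
    movePos≤ left {zero} p≤ = z≤n
    movePos≤ left {suc p} p≤ = ≤-trans (n≤1+n p) (m≤n⇒m≤1+n p≤)
    movePos≤ right p≤ = s≤s p≤
    movePos≤ stay p≤ = m≤n⇒m≤1+n p≤

    length-decodeQuery : ∀ qs → length (decodeQuery qs) ≤ length qs
    length-decodeQuery [] = z≤n
    length-decodeQuery (zero ∷ qs) = z≤n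
    length-decodeQuery (suc zero ∷ qs) = s≤s (length-decodeQuery qs)
    length-decodeQuery (suc (suc zero) ∷ qs) = s≤s (length-decodeQuery qs)

  Short : ℕ → Trace → Set
  Short k = All (λ bq → length (proj₂ bq) ≤ k)

  -- In one step the head moves by at most one cell, and a write extends the tape to at most one
  -- more than the larger of its length and the head position. So the bound `k` on both sums with
  -- the remaining time is preserved.
  queries-short : ∀ {n q w qs p tr k} → Run n (config q w (tape qs p)) tr → length qs + n ≤ k → p + n ≤ k → Short k tr
  queries-short (halt _) l≤ p≤ = []
  queries-short {suc n} {qs = qs} {p} {k = k} (asked b _ r) l≤ p≤ =
    ≤-trans (length-decodeQuery qs) (≤-trans (m≤m+n _ _) l≤) ∷ queries-short r n≤ n≤
    where
    n≤ : n ≤ k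
    n≤ = ≤-trans (n≤1+n n) (≤-trans (m≤n+m _ _) l≤)
  queries-short {suc n} {qs = qs} {p} {k = k} (trans {b = b} {dt} _ _ _ r) l≤ p≤ = go n k l≤ p≤ r
    where
    go : ∀ {q w tr} n k → length qs + suc n ≤ k → p + suc n ≤ k → Run n (config q w (update b dt (tape qs p))) tr → Short k tr
    go n k l≤ p≤ r with m≤n⇒∃[o]m+o≡n {suc n} (≤-trans (m≤n+m (suc n) p) p≤)
    ... | s , refl = queries-short r (le (length-writeL qs b (sub l≤) (sub p≤))) (le (movePos≤ dt (sub p≤)))
      where
      sub : ∀ {l} → l + suc n ≤ suc n + s → l ≤ s
      sub {l} h = +-cancelˡ-≤ (suc n) l s (≤-trans (≤-reflexive (+-comm (suc n) l)) h)
      le : ∀ {l} → l ≤ suc s → l + n ≤ suc n + s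
      le h = ≤-trans (+-monoˡ-≤ n h) (≤-reflexive (cong suc (+-comm s n)))

  queries-poly : ∀ {n x tr} → Run n (initial M x) tr → Short n tr
  queries-poly r = queries-short r ≤-refl ≤-refl

-- Simulating an oracle machine by a register program

TOption : OTM → Set
TOption M = Fin nQ × Fin (3 + Γ) × Move × Fin 3 × Move
  where open OTM M

-- Besides work symbols, the simulation keeps whole transition options on a register: the chosen
-- option directs the writes and moves, and its first component is then the current state.
TSym : OTM → Set
TSym M = TOption M ⊎ Fin (3 + OTM.Γ M)

finTSym : ∀ M → Finite (TSym M)
finTSym M = fin⊎ (fin× (finFin _) (fin× (finFin _) (fin× finMove (fin× (finFin _) finMove)))) (finFin _)

module _ {A : Set} where
  zmove : Move → List A → List A → List A × List A
  zmove left  (b ∷ l) r       = l , b ∷ r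
  zmove left  []      r       = [] , r
  zmove right l       (a ∷ r) = a ∷ l , r
  -- A default value: moves follow a write, which makes the right part nonempty.
  zmove right l       []      = l , []
  zmove stay  l       r       = l , r

  record Zip {n} (rd : A → Fin (suc n)) (l r : List A) (T : Tape n) : Set where
    constructor zip
    field
      position : length l ≡ Tape.pos T
      contents : ∀ k → readL (map rd (l ʳ++ r)) k ≡ readL (Tape.cells T) k

  zip-read : ∀ {n} {rd : A → Fin (suc n)} {l r T} → Zip rd l r T → maybe′ rd zero (nth 0 r) ≡ read T
  zip-read {rd = rd} {l} {r} {tape cs _} (zip refl c) =
    sym (readL-map rd (l ʳ++ r) ∙ cong (maybe′ rd zero) (nth-ʳ++-head l)) ∙ c (length l)

  zip-update : ∀ {n} {rd : A → Fin (suc n)} {l r T a b} d → Zip rd l r T → rd a ≡ b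
             → Zip rd (proj₁ (zmove d l (a ∷ tl r))) (proj₂ (zmove d l (a ∷ tl r))) (update b d T)
  zip-update {n} {rd} {l} {r} {tape cs _} {a} {b} d (zip refl c) refl = shifted d l written refl
    where
    tails : ∀ r k → nth (suc k) (a ∷ tl r) ≡ nth (suc k) r
    tails [] k = refl
    tails (_ ∷ r) k = refl
    written : ∀ k → readL (map rd (l ʳ++ (a ∷ tl r))) k ≡ readL (writeL cs (length l) b) k
    written k with k ≟ length l
    ... | yes refl = readL-map rd (l ʳ++ (a ∷ tl r)) ∙ cong (maybe′ rd zero) (nth-ʳ++-head l) ∙ sym (readL-write-same cs (length l) b)
    ... | no ne = readL-map rd (l ʳ++ (a ∷ tl r)) ∙ cong (maybe′ rd zero) (nth-ʳ++-other l (tails r) k ne) ∙ sym (readL-map rd (l ʳ++ r))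
                  ∙ c k ∙ sym (readL-write-other cs (length l) b k ne)
    shifted : ∀ d l {r cs p} → (∀ k → readL (map rd (l ʳ++ (a ∷ r))) k ≡ readL cs k) → length l ≡ p
            → Zip rd (proj₁ (zmove d l (a ∷ r))) (proj₂ (zmove d l (a ∷ r))) (tape cs (movePos d p))
    shifted left [] c refl = zip refl c
    shifted left (_ ∷ _) c refl = zip refl c
    shifted right l c refl = zip refl c
    shifted stay l c refl = zip refl c

  length-zmove : ∀ d (l : List A) a r → length (proj₁ (zmove d l (a ∷ tl r))) + length (proj₂ (zmove d l (a ∷ tl r))) ≤ suc (length l + length r)
  length-zmove left [] a r = s≤s (length-tl r)
  length-zmove left (b ∷ l) a r = ≤-trans (≤-reflexive (+-suc (length l) _)) (s≤s (≤-trans (+-monoʳ-≤ (length l) (s≤s (length-tl r))) (≤-reflexive (+-suc (length l) (length r)))))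
  length-zmove right l a r = s≤s (+-monoʳ-≤ (length l) (length-tl r))
  length-zmove stay l a r = ≤-trans (≤-reflexive (+-suc (length l) _)) (s≤s (+-monoʳ-≤ (length l) (length-tl r)))

isRight isLeft : Move → Bool
isRight right = true
isRight _     = false
isLeft left = true
isLeft _    = false

loopP simulateP : ℕ → PolyFn
loopP c = (constP 0 ⊕ (polyP c ⊕ polyP c)) ⊗ constP 17 ⊕ constP 1
simulateP c = t ⊕ (constP 1 ⊕ ((idP ⊕ t) ⊗ constP 2 ⊕ constP 12))
  where t = clockP c ⊕ (constP 1 ⊕ loopP c)

module Records (W : Set) (finW : Finite W) where
  open Registers W finW

  record1 : Bool × Str → List Sym → List Sym
  record1 (b , q) rec = mark b ∷ bits q ++ rec

  records : Trace → List Sym → List Sym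
  records []         rec = rec
  records (bq ∷ tr) rec = records tr (record1 bq rec)

  encode : Trace → List Sym
  encode []        = []
  encode (bq ∷ tr) = record1 bq (encode tr)

  -- `REC` is a stack, so the record is read off with the last query first. This reversal is
  -- harmless since `Sat` is a condition on the single entries.
  records-encode : ∀ tr acc → records tr (encode acc) ≡ encode (tr ʳ++ acc)
  records-encode [] acc = refl
  records-encode (bq ∷ tr) acc = records-encode tr (bq ∷ acc)

module Simulation (W : Set) (finW : Finite W) (M : OTM)
  (emb : TSym M → W) (prj : W → Maybe (TSym M)) (prj-emb : ∀ s → prj (emb s) ≡ just s) where

  open Registers W finW
  open Records W finW
  open OTM M renaming (yes to yesQ; no to noQ)

  private
    Opt : Set
    Opt = TOption M

    toOpt : Maybe (TSym M) → Maybe Opt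
    toOpt (just (inj₁ o)) = just o
    toOpt _               = nothing

    toWork : Maybe (TSym M) → Fin (3 + Γ)
    toWork (just (inj₂ a)) = a
    toWork _               = zero

  optOf : Maybe Sym → Maybe Opt
  optOf (just (own w)) = toOpt (prj w)
  optOf _              = nothing

  optSym : Opt → Sym
  optSym o = own (emb (inj₁ o))

  optOf-optSym : ∀ o → optOf (just (optSym o)) ≡ just o
  optOf-optSym o = cong toOpt (prj-emb (inj₁ o))

  rdW : Sym → Fin (3 + Γ)
  rdW (bit b) = encodeBit b
  rdW (own w) = toWork (prj w)
  rdW _       = zero

  wrW : Fin (3 + Γ) → Sym
  wrW a = own (emb (inj₂ a))

  rdW-wrW : ∀ a → rdW (wrW a) ≡ a
  rdW-wrW a = cong toWork (prj-emb (inj₂ a))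

  rdQ : Sym → Fin 3
  rdQ (bit b) = encodeBit {0} b
  rdQ _       = zero

  wrQ : Fin 3 → Sym
  wrQ zero             = dot
  wrQ (suc zero)       = bit false
  wrQ (suc (suc zero)) = bit true

  rdQ-wrQ : ∀ b → rdQ (wrQ b) ≡ b
  rdQ-wrQ zero = refl
  rdQ-wrQ (suc zero) = refl
  rdQ-wrQ (suc (suc zero)) = refl

  decodeQuery-toBits : ∀ l → decodeQuery (map rdQ l) ≡ toBits l
  decodeQuery-toBits [] = refl
  decodeQuery-toBits (bit false ∷ l) = cong (false ∷_) (decodeQuery-toBits l)
  decodeQuery-toBits (bit true ∷ l) = cong (true ∷_) (decodeQuery-toBits l)
  decodeQuery-toBits (inj₂ _ ∷ l) = refl

  private
    stateIs : Fin nQ → Maybe Opt → Bool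
    stateIs q (just o) = does (proj₁ o ≟F q)
    stateIs q nothing  = false

    workSym querySym : Maybe Opt → Sym
    workSym (just (_ , a , _)) = wrW a
    workSym nothing            = dot
    querySym (just (_ , _ , _ , b , _)) = wrQ b
    querySym nothing                    = dot

    workDir queryDir : Maybe Opt → Move
    workDir (just (_ , _ , d , _)) = d
    workDir nothing                = stay
    queryDir (just (_ , _ , _ , _ , d)) = d
    queryDir nothing                    = stay

    onOpt : ∀ {B : Set} → (Maybe Opt → B) → Tops → B
    onOpt f v = f (optOf (lookup v STA))

    choices : Maybe Opt → Fin (3 + Γ) → Fin 3 → List Sym
    choices (just o) a b = map optSym (δ (proj₁ o) a b)
    choices nothing  a b = []

    inState : Fin nQ → Tops → Bool
    inState q = onOpt (stateIs q)

    shift : (Tops → Move) → Reg → Reg → Cmd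
    shift d L R = ifc (isRight ∘ d) (put L (top R) ⨾ pop R) (ifc (λ v → isLeft (d v) ∧ has L v) (put R (top L) ⨾ pop L) skip)

    -- As in `decodeQuery`, only the part of the query tape before the first symbol that is not a
    -- bit matters: `qPre` rewinds the tape, keeps that prefix, erases the rest and puts the prefix
    -- on `REC`, where `answerWith` marks it.
    apply act qPre answerWith : Cmd
    apply = pop INP ⨾ put INP (onOpt workSym) ⨾ shift (onOpt workDir) WL INP ⨾
            pop QR ⨾ put QR (onOpt querySym) ⨾ shift (onOpt queryDir) QL QR
    act   = pick STA (λ v → choices (optOf (lookup v STA)) (maybe′ rdW zero (lookup v INP)) (maybe′ rdQ zero (lookup v QR))) ⨾ apply
    qPre  = move QL QR ⨾ moveBits QR QL ⨾ clear QR ⨾ move QL REC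

    -- Only the state of this option is meaningful; it is put on `STA` to name the current state and
    -- is never applied to the tapes.
    resumeIn : Fin nQ → Opt
    resumeIn q = q , zero , stay , zero , stay

    answerWith = amb (put REC (const′ (mark true)) ⨾ put STA (const′ (optSym (resumeIn yesQ))))
                     (put REC (const′ (mark false)) ⨾ put STA (const′ (optSym (resumeIn noQ))))

    body loop cleanup : Cmd
    body = ifc (inState query) (qPre ⨾ answerWith) act ⨾ pop CLK
    loop = while (λ v → has CLK v ∧ not (inState accept v)) body
    cleanup = clear INP ⨾ clear WL ⨾ clear QL ⨾ clear QR ⨾ clear STA ⨾ clear CLK

  -- Simulates M on INP for as many steps as its clock poly c allows, guessing
  -- the oracle answers and recording them on REC.
  simulate : ℕ → Cmd
  simulate c = clock c ⨾ put STA (const′ (optSym (resumeIn start))) ⨾ loop ⨾ ifc (inState accept) skip fail ⨾ cleanup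

  module _ {A : Lang} where
    private
      put-as : ∀ {r f σ a} → f (tops σ) ≡ a → Exec A (put r f) σ (doOp (push r a) σ) 1
      put-as refl = put

      shiftW : ∀ d {a o inp wl ql qr s clk rec env sav} → workDir (optOf (just o)) ≡ d →
        Exec A (shift (onOpt workDir) WL INP) (regs (a ∷ inp) wl ql qr (o ∷ s) clk rec env sav)
          (regs (proj₂ (zmove d wl (a ∷ inp))) (proj₁ (zmove d wl (a ∷ inp))) ql qr (o ∷ s) clk rec env sav) 4
      shiftW right e = if-t (cong isRight e) (put₁ ⨾ pop {t = 1})
      shiftW left {wl = []} e = if-f (cong isRight e) (if-f (cong (λ d → isLeft d ∧ false) e) skip)
      shiftW left {wl = _ ∷ _} e = if-f (cong isRight e) (if-t (cong (λ d → isLeft d ∧ true) e) (put₁ ⨾ pop₁))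
      shiftW stay {wl = wl} e = if-f (cong isRight e) (if-f (cong (λ d → isLeft d ∧ is-just (nth 0 wl)) e) skip)

      shiftQ : ∀ d {a o inp wl ql qr s clk rec env sav} → queryDir (optOf (just o)) ≡ d →
        Exec A (shift (onOpt queryDir) QL QR) (regs inp wl ql (a ∷ qr) (o ∷ s) clk rec env sav)
          (regs inp wl (proj₁ (zmove d ql (a ∷ qr))) (proj₂ (zmove d ql (a ∷ qr))) (o ∷ s) clk rec env sav) 4
      shiftQ right e = if-t (cong isRight e) (put₁ ⨾ pop {t = 1})
      shiftQ left {ql = []} e = if-f (cong isRight e) (if-f (cong (λ d → isLeft d ∧ false) e) skip)
      shiftQ left {ql = _ ∷ _} e = if-f (cong isRight e) (if-t (cong (λ d → isLeft d ∧ true) e) (put₁ ⨾ pop₁))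
      shiftQ stay {ql = ql} e = if-f (cong isRight e) (if-f (cong (λ d → isLeft d ∧ is-just (nth 0 ql)) e) skip)

      apply-exec : ∀ {q' a dw b dt inp wl ql qr s clk rec env sav} → let so = optSym (q' , a , dw , b , dt) in
        Exec A apply (regs inp wl ql qr (so ∷ s) clk rec env sav)
          (regs (proj₂ (zmove dw wl (wrW a ∷ tl inp))) (proj₁ (zmove dw wl (wrW a ∷ tl inp)))
                (proj₁ (zmove dt ql (wrQ b ∷ tl qr))) (proj₂ (zmove dt ql (wrQ b ∷ tl qr))) (so ∷ s) clk rec env sav) 12
      apply-exec {q'} {a} {dw} {b} {dt} = pop₁ ⨾ put-as (cong workSym E) ⨾ shiftW dw (cong workDir E) ⨾
                                          pop₁ ⨾ put-as (cong querySym E) ⨾ shiftQ dt (cong queryDir E)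
        where E = optOf-optSym (q' , a , dw , b , dt)

      moveQL-QR : ∀ ql {inp wl qr s clk rec env sav} →
        Exec A (move QL QR) (regs inp wl ql qr s clk rec env sav) (regs inp wl [] (ql ʳ++ qr) s clk rec env sav) (suc (length ql) * 3)
      moveQL-QR [] = while-f refl
      moveQL-QR (a ∷ ql) = while-t refl (put₁ ⨾ pop₁) (moveQL-QR ql)

      moveQL-REC : ∀ ql {inp wl qr s clk rec env sav} →
        Exec A (move QL REC) (regs inp wl ql qr s clk rec env sav) (regs inp wl [] qr s clk (ql ʳ++ rec) env sav) (suc (length ql) * 3)
      moveQL-REC [] = while-f refl
      moveQL-REC (a ∷ ql) = while-t refl (put₁ ⨾ pop₁) (moveQL-REC ql)

      afterBits : List Sym → List Sym
      afterBits (bit _ ∷ l) = afterBits l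
      afterBits l           = l

      moveBitsQR-QL : ∀ qr {inp wl ql s clk rec env sav} →
        Exec A (moveBits QR QL) (regs inp wl ql qr s clk rec env sav) (regs inp wl (bits (toBits qr) ʳ++ ql) (afterBits qr) s clk rec env sav)
          (suc (length (toBits qr)) * 3)
      moveBitsQR-QL [] = while-f refl
      moveBitsQR-QL (bit b ∷ qr) = while-t refl (put₁ ⨾ pop₁) (moveBitsQR-QL qr)
      moveBitsQR-QL (inj₂ _ ∷ qr) = while-f refl

      length-toBits : ∀ l → length (toBits l) ≤ length l
      length-toBits [] = z≤n
      length-toBits (bit _ ∷ l) = s≤s (length-toBits l)
      length-toBits (inj₂ _ ∷ l) = z≤n

      length-afterBits : ∀ l → length (afterBits l) ≤ length l
      length-afterBits [] = z≤n
      length-afterBits (bit _ ∷ l) = m≤n⇒m≤1+n (length-afterBits l)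
      length-afterBits (inj₂ _ ∷ l) = ≤-refl

      clearQR : ∀ qr {inp wl ql s clk rec env sav} →
        Exec A (clear QR) (regs inp wl ql qr s clk rec env sav) (regs inp wl ql [] s clk rec env sav) (suc (length qr) * 2)
      clearQR [] = while-f refl
      clearQR (_ ∷ qr) = while-t refl pop₁ (clearQR qr)

      qPre-exec : ∀ {inp wl ql qr s clk rec env sav} →
        Exec A qPre (regs inp wl ql qr s clk rec env sav) (regs inp wl [] [] s clk (bits (toBits (ql ʳ++ qr)) ++ rec) env sav)
          (suc (length ql + length qr) * 11)
      qPre-exec {inp} {wl} {ql} {qr} {s} {clk} {rec} {env} {sav} = Exec-mono
        (moveQL-QR ql ⨾ moveBitsQR-QL l ⨾ clearQR (afterBits l) ⨾
         Exec-to (cong (λ r → regs inp wl [] [] s clk r env sav) (ʳ++-ʳ++ (bits (toBits l)))) (moveQL-REC (bits (toBits l) ʳ++ [])))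
        (≤-trans (+-mono-≤ (*-monoˡ-≤ 3 (s≤s (m≤m+n (length ql) (length qr)))) (+-mono-≤ (*-monoˡ-≤ 3 (s≤s b≤)) (+-mono-≤ (*-monoˡ-≤ 2 (s≤s r≤))
           (*-monoˡ-≤ 3 (s≤s (≤-trans (≤-reflexive (length-ʳ++ (bits (toBits l)) ∙ +-identityʳ _ ∙ length-map inj₁ (toBits l))) b≤))))))
          (≤-reflexive (arith (length ql + length qr))))
        where
        l = ql ʳ++ qr
        b≤ : length (toBits l) ≤ length ql + length qr
        b≤ = ≤-trans (length-toBits l) (≤-reflexive (length-ʳ++ ql))
        r≤ : length (afterBits l) ≤ length ql + length qr
        r≤ = ≤-trans (length-afterBits l) (≤-reflexive (length-ʳ++ ql))
        open +-*-Solver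
        arith : ∀ n → suc n * 3 + (suc n * 3 + (suc n * 2 + suc n * 3)) ≡ suc n * 11
        arith = solve 1 (λ n → (con 1 :+ n) :* con 3 :+ ((con 1 :+ n) :* con 3 :+ ((con 1 :+ n) :* con 2 :+ (con 1 :+ n) :* con 3))
                           := (con 1 :+ n) :* con 11) refl

      inState-≡ : ∀ {o q} → stateIs q (optOf (just (optSym o))) ≡ does (proj₁ o ≟F q)
      inState-≡ {o} {q} = cong (stateIs q) (optOf-optSym o)

      guard-on : ∀ {o} → proj₁ o ≢ accept → not (stateIs accept (optOf (just (optSym o)))) ≡ true
      guard-on {o} ne = cong not (inState-≡ {o} ∙ does-no ne)

      -- Amortized: a step lengthens the query tape by at most one cell, and a
      -- query, which costs time linear in that length, empties it.
      loopT : ℕ → ℕ → ℕ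
      loopT n l = (l + (n + n)) * 17 + 1

      loopT-query : ∀ n l → suc (suc (suc l * 11 + 3) + 1 + loopT n 0) ≤ loopT (suc n) l
      loopT-query n l = ≤-trans (m≤m+n _ (l * 6 + 17)) (≤-reflexive (arith n l))
        where
        open +-*-Solver
        arith : ∀ n l → suc (suc (suc l * 11 + 3) + 1 + ((0 + (n + n)) * 17 + 1)) + (l * 6 + 17) ≡ (l + (suc n + suc n)) * 17 + 1
        arith = solve 2 (λ n l → con 1 :+ (con 1 :+ ((con 1 :+ l) :* con 11 :+ con 3) :+ con 1 :+ ((con 0 :+ (n :+ n)) :* con 17 :+ con 1)) :+ (l :* con 6 :+ con 17)
                          := (l :+ (con 1 :+ n :+ (con 1 :+ n))) :* con 17 :+ con 1) refl

      -- Each step of the clock releases 2 * 17 units: 16 pay for the iteration and 17 are stored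
      -- with the cell that it may add to the query tape.
      loopT-act : ∀ n l {l'} → l' ≤ suc l → suc (suc (1 + 12) + 1 + loopT n l') ≤ loopT (suc n) l
      loopT-act n l le = ≤-trans (+-monoʳ-≤ 16 (+-monoˡ-≤ 1 (*-monoˡ-≤ 17 (+-monoˡ-≤ (n + n) le)))) (≤-trans (n≤1+n _) (≤-reflexive (arith n l)))
        where
        open +-*-Solver
        arith : ∀ n l → suc (16 + ((suc l + (n + n)) * 17 + 1)) ≡ (l + (suc n + suc n)) * 17 + 1
        arith = solve 2 (λ n l → con 1 :+ (con 16 :+ ((con 1 :+ l :+ (n :+ n)) :* con 17 :+ con 1)) := (l :+ (con 1 :+ n :+ (con 1 :+ n))) :* con 17 :+ con 1) refl

      data Done (rec env sav : List Sym) : Store → Set where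
        done : ∀ {inp wl ql qr s clk} o → proj₁ o ≡ accept → Done rec env sav (regs inp wl ql qr (optSym o ∷ s) clk rec env sav)

      asked-≡ : ∀ {ql qr T} → Zip rdQ ql qr T → toBits (ql ʳ++ qr) ≡ decodeQuery (Tape.cells T)
      asked-≡ {ql} {qr} (zip _ c) = sym (decodeQuery-toBits (ql ʳ++ qr)) ∙ decodeQuery-cong _ _ c

      choice-∈ : ∀ {o inp qr w t} → maybe′ rdW zero (nth 0 inp) ≡ read w → maybe′ rdQ zero (nth 0 qr) ≡ read t
               → choices (optOf (just (optSym o))) (maybe′ rdW zero (nth 0 inp)) (maybe′ rdQ zero (nth 0 qr)) ≡ map optSym (δ (proj₁ o) (read w) (read t))
      choice-∈ {o} e e' rewrite optOf-optSym o | e | e' = refl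

      blank : Zip rdQ [] [] (tape [] 0)
      blank = zip refl (λ _ → refl)

      loop-complete : ∀ {n q w t tr o inp wl ql qr s rec env sav} → Run M n (config q w t) tr → proj₁ o ≡ q → Zip rdW wl inp w → Zip rdQ ql qr t
        → ∃[ σ' ] (Exec A loop (regs inp wl ql qr (optSym o ∷ s) (dots n) rec env sav) σ' (loopT n (length ql + length qr)) × Done (records tr rec) env sav σ')
      loop-complete {n} {o = o} {inp} {wl} {ql} {qr} {s} {rec} {env} {sav} (halt e) refl zw zq = _ , Exec-mono (while-f {t = 0} (off n)) (m≤n+m 1 _) , done o e
        where
        off : ∀ n → has CLK (tops (regs inp wl ql qr s (dots n) rec env sav)) ∧ not (stateIs accept (optOf (just (optSym o)))) ≡ false
        off zero = refl
        off (suc n) = cong not (inState-≡ {o} ∙ does-yes e)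
      loop-complete {suc n} {o = o} {inp} {wl} {ql} {qr} {s} {rec} {env} {sav} (asked b ne r) refl zw zq with loop-complete {o = resumeIn (if b then yesQ else noQ)} {rec = record1 (b , toBits (ql ʳ++ qr)) rec} r refl zw blank
      ... | σ' , e , d rewrite asked-≡ zq = σ' , Exec-mono (while-t (guard-on ne)
               (if-t (inState-≡ {o} ∙ does-yes {i = query} refl) (Exec-to (cong (λ u → regs inp wl [] [] (optSym o ∷ s) (dots (suc n)) (bits u ++ rec) env sav) (asked-≡ zq)) qPre-exec ⨾ answered b) ⨾ pop₁) e)
               (loopT-query n (length ql + length qr)) , d
        where
        answered : ∀ {inp wl s clk rec env sav} b → Exec A answerWith (regs inp wl [] [] s clk rec env sav)
                     (regs inp wl [] [] (optSym (resumeIn (if b then yesQ else noQ)) ∷ s) clk (mark b ∷ rec) env sav) 3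
        answered true = amb-l (put₁ ⨾ put₁)
        answered false = amb-r (put₁ ⨾ put₁)
      loop-complete {suc n} {w = w} {t} {o = o} {inp} {wl} {ql} {qr} (trans {q' = q'} {a} {dw} {b} {dt} nq na i r) refl zw zq
        with loop-complete {o = q' , a , dw , b , dt} r refl (zip-update dw zw (rdW-wrW a)) (zip-update dt zq (rdQ-wrQ b))
      ... | σ' , e , d = σ' , Exec-mono (while-t (guard-on na)
              (if-f (inState-≡ {o} ∙ does-no nq)
                (pick {t = 0} (subst (optSym (q' , a , dw , b , dt) ∈_) (sym (choice-∈ {o} {inp} {qr} {w} {t} (zip-read zw) (zip-read zq))) (∈-map⁺ optSym i)) ⨾ apply-exec) ⨾ pop₁) e)
              (loopT-act n (length ql + length qr) (length-zmove dt ql (wrQ b) qr)) , d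

      data After (o : Opt) (n : ℕ) (w : Tape (2 + Γ)) (T : Tape 2) (inp wl ql qr s rec env sav : List Sym) : Store → Set where
        asked : ∀ b → proj₁ o ≡ query → After o n w T inp wl ql qr s rec env sav
          (regs inp wl [] [] (optSym (resumeIn (if b then yesQ else noQ)) ∷ optSym o ∷ s) (dots n) (record1 (b , toBits (ql ʳ++ qr)) rec) env sav)
        acted : ∀ {q' a dw b dt} → proj₁ o ≢ query → (q' , a , dw , b , dt) ∈ δ (proj₁ o) (read w) (read T) → After o n w T inp wl ql qr s rec env sav
          (regs (proj₂ (zmove dw wl (wrW a ∷ tl inp))) (proj₁ (zmove dw wl (wrW a ∷ tl inp)))
                (proj₁ (zmove dt ql (wrQ b ∷ tl qr))) (proj₂ (zmove dt ql (wrQ b ∷ tl qr))) (optSym (q' , a , dw , b , dt) ∷ optSym o ∷ s) (dots n) rec env sav)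

      answer-sound : ∀ {inp wl s clk rec env sav σ t} → Exec A answerWith (regs inp wl [] [] s clk rec env sav) σ t
        → ∃[ b ] σ ≡ regs inp wl [] [] (optSym (resumeIn (if b then yesQ else noQ)) ∷ s) clk (mark b ∷ rec) env sav
      answer-sound (amb-l (put ⨾ put)) = true , refl
      answer-sound (amb-r (put ⨾ put)) = false , refl

      apply-det : Det apply
      apply-det = tt , tt , ((tt , tt) , (tt , tt) , tt) , tt , tt , ((tt , tt) , (tt , tt) , tt)

      body-sound : ∀ {o n w T inp wl ql qr s rec env sav σ t} → Exec A body (regs inp wl ql qr (optSym o ∷ s) (dots (suc n)) rec env sav) σ t
        → Zip rdW wl inp w → Zip rdQ ql qr T → After o n w T inp wl ql qr s rec env sav σ
      body-sound {o} {n} {w} {T} {inp} {wl} {ql} {qr} {s} {rec} {env} {sav} {σ} (if-t x (p ⨾ a) ⨾ e) zw zq =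
        conclude (answer-sound (subst (λ τ → Exec A answerWith τ _ _) (Exec-det ((tt , tt) , (tt , tt) , tt , tt , tt) p qPre-exec) a)) e
        where
        conclude : ∀ {σ₁ t} → ∃[ b ] σ₁ ≡ regs inp wl [] [] (optSym (resumeIn (if b then yesQ else noQ)) ∷ optSym o ∷ s) (dots (suc n)) (record1 (b , toBits (ql ʳ++ qr)) rec) env sav
                 → Exec A (pop CLK) σ₁ σ t → After o n w T inp wl ql qr s rec env sav σ
        conclude (b , refl) pop = asked b (does-≡ (sym (inState-≡ {o}) ∙ x))
      body-sound {o} {n} {w} {T} {inp} {wl} {ql} {qr} {s} {rec} {env} {sav} {σ} (if-f x (pick {a = a} i ⨾ p) ⨾ e) zw zq =
        conclude (∈-map⁻ optSym (subst (a ∈_) (choice-∈ {o} {inp} {qr} {w} {T} (zip-read zw) (zip-read zq)) i)) p e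
        where
        finish : ∀ {q' a dw b dt σ₁ t} → (q' , a , dw , b , dt) ∈ δ (proj₁ o) (read w) (read T)
               → σ₁ ≡ regs (proj₂ (zmove dw wl (wrW a ∷ tl inp))) (proj₁ (zmove dw wl (wrW a ∷ tl inp)))
                (proj₁ (zmove dt ql (wrQ b ∷ tl qr))) (proj₂ (zmove dt ql (wrQ b ∷ tl qr))) (optSym (q' , a , dw , b , dt) ∷ optSym o ∷ s) (dots (suc n)) rec env sav
               → Exec A (pop CLK) σ₁ σ t → After o n w T inp wl ql qr s rec env sav σ
        finish j refl pop = acted (does-≢ (sym (inState-≡ {o}) ∙ x)) j
        conclude : ∀ {a σ₁ t t'} → ∃[ o' ] (o' ∈ δ (proj₁ o) (read w) (read T) × a ≡ optSym o')
                 → Exec A apply (regs inp wl ql qr (a ∷ optSym o ∷ s) (dots (suc n)) rec env sav) σ₁ t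
                 → Exec A (pop CLK) σ₁ σ t' → After o n w T inp wl ql qr s rec env sav σ
        conclude ((q' , a , dw , b , dt) , j , refl) p e = finish j (Exec-det apply-det p (apply-exec {q'} {a} {dw} {b} {dt})) e

      loop-sound : ∀ {n w T o inp wl ql qr s rec env sav σ' t} → Exec A loop (regs inp wl ql qr (optSym o ∷ s) (dots n) rec env sav) σ' t
        → inState accept (tops σ') ≡ true → Zip rdW wl inp w → Zip rdQ ql qr T
        → ∃[ tr ] (Run M n (config (proj₁ o) w T) tr × Done (records tr rec) env sav σ')
      loop-sound {o = o} (while-f _) acc zw zq = [] , halt q≡ , done o q≡
        where
        q≡ : proj₁ o ≡ accept
        q≡ = does-≡ (sym (inState-≡ {o}) ∙ acc)
      loop-sound {zero} (while-t () _ _) acc zw zq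
      loop-sound {suc n} {w} {T} {o} {inp} {wl} {ql} {qr} {s} {rec} {env} {sav} {σ'} (while-t g b f) acc zw zq = continue (body-sound b zw zq) f
        where
        na : proj₁ o ≢ accept
        na = does-≢ (sym (not-involutive _) ∙ cong not (cong not (sym (inState-≡ {o})) ∙ g))
        Result : Set
        Result = ∃[ tr ] (Run M (suc n) (config (proj₁ o) w T) tr × Done (records tr rec) env sav σ')
        answered : ∀ b → proj₁ o ≡ query
          → ∃[ tr ] (Run M n (config (if b then yesQ else noQ) w (tape [] 0)) tr × Done (records tr (record1 (b , toBits (ql ʳ++ qr)) rec)) env sav σ')
          → Result
        answered b q≡ (tr , r , d) = _ , subst (λ q → Run M (suc n) (config q w T) ((b , decodeQuery (Tape.cells T)) ∷ tr)) (sym q≡) (asked b (λ q → na (q≡ ∙ q)) r) ,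
          subst (λ u → Done (records tr (record1 (b , u) rec)) env sav σ') (asked-≡ zq) d
        continue : ∀ {σ t} → After o n w T inp wl ql qr s rec env sav σ → Exec A loop σ σ' t → Result
        continue (asked b q≡) f = answered b q≡ (loop-sound f acc zw blank)
        continue (acted {q'} {a} {dw} {b} {dt} nq j) f =
          let (tr , r , d) = loop-sound f acc (zip-update dw zw (rdW-wrW a)) (zip-update dt zq (rdQ-wrQ b))
          in tr , trans nq na j r , d

      clearINP : ∀ inp {wl ql qr s clk rec env sav} →
        Exec A (clear INP) (regs inp wl ql qr s clk rec env sav) (regs [] wl ql qr s clk rec env sav) (suc (length inp) * 2)
      clearINP [] = while-f refl
      clearINP (_ ∷ inp) = while-t refl pop₁ (clearINP inp)

      clearWL : ∀ wl {inp ql qr s clk rec env sav} →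
        Exec A (clear WL) (regs inp wl ql qr s clk rec env sav) (regs inp [] ql qr s clk rec env sav) (suc (length wl) * 2)
      clearWL [] = while-f refl
      clearWL (_ ∷ wl) = while-t refl pop₁ (clearWL wl)

      clearQL : ∀ ql {inp wl qr s clk rec env sav} →
        Exec A (clear QL) (regs inp wl ql qr s clk rec env sav) (regs inp wl [] qr s clk rec env sav) (suc (length ql) * 2)
      clearQL [] = while-f refl
      clearQL (_ ∷ ql) = while-t refl pop₁ (clearQL ql)

      clearSTA : ∀ s {inp wl ql qr clk rec env sav} →
        Exec A (clear STA) (regs inp wl ql qr s clk rec env sav) (regs inp wl ql qr [] clk rec env sav) (suc (length s) * 2)
      clearSTA [] = while-f refl
      clearSTA (_ ∷ s) = while-t refl pop₁ (clearSTA s)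

      clearCLK : ∀ clk {inp wl ql qr s rec env sav} →
        Exec A (clear CLK) (regs inp wl ql qr s clk rec env sav) (regs inp wl ql qr s [] rec env sav) (suc (length clk) * 2)
      clearCLK [] = while-f refl
      clearCLK (_ ∷ clk) = while-t refl pop₁ (clearCLK clk)

      -- `ENV` and `SAV` belong to the caller and have lengths unrelated to the simulated input, so
      -- they must not enter the time bounds. As a simulation leaves both unchanged, their
      -- contribution cancels from `Exec-size`.
      core : Store → ℕ
      core (regs inp wl ql qr s clk rec env sav) = length inp + (length wl + (length ql + (length qr + (length s + (length clk + length rec)))))

      size≡ : ∀ inp wl ql qr s clk rec env sav →
        size# (regs inp wl ql qr s clk rec env sav) ≡ core (regs inp wl ql qr s clk rec env sav) + (length env + length sav)
      size≡ inp wl ql qr s clk rec env sav =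
        regroup (length inp) (regroup (length wl) (regroup (length ql) (regroup (length qr) (regroup (length s) (regroup (length clk)
          (cong (λ k → length rec + (length env + k)) (+-identityʳ (length sav))))))))
        where
        regroup : ∀ a {x y z} → x ≡ y + z → a + x ≡ a + y + z
        regroup a {x} {y} {z} e = cong (a +_) e ∙ sym (+-assoc a y z)

      core-growth : ∀ {c inp wl ql qr s clk rec env sav inp' wl' ql' qr' s' clk' rec' t} →
        Exec A c (regs inp wl ql qr s clk rec env sav) (regs inp' wl' ql' qr' s' clk' rec' env sav) t →
        core (regs inp' wl' ql' qr' s' clk' rec' env sav) ≤ core (regs inp wl ql qr s clk rec env sav) + t
      core-growth {inp = inp} {wl} {ql} {qr} {s} {clk} {rec} {env} {sav} {inp'} {wl'} {ql'} {qr'} {s'} {clk'} {rec'} {t} e =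
        +-cancelˡ-≤ (length env + length sav) _ _
          (≤-trans (≤-reflexive (+-comm (length env + length sav) _ ∙ sym (size≡ inp' wl' ql' qr' s' clk' rec' env sav)))
            (≤-trans (Exec-size e) (≤-reflexive (cong (_+ t) (size≡ inp wl ql qr s clk rec env sav ∙ +-comm _ (length env + length sav))
              ∙ +-assoc (length env + length sav) _ t))))

      cleanup-exec : ∀ {inp wl ql qr s clk rec env sav} →
        Exec A cleanup (regs inp wl ql qr s clk rec env sav) (regs [] [] [] [] [] [] rec env sav) (core (regs inp wl ql qr s clk rec env sav) * 2 + 12)
      cleanup-exec {inp} {wl} {ql} {qr} {s} {clk} {rec} =
        Exec-mono (clearINP inp ⨾ clearWL wl ⨾ clearQL ql ⨾ clearQR qr ⨾ clearSTA s ⨾ clearCLK clk)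
          (add (length inp) (add (length wl) (add (length ql) (add (length qr) (add (length s) base)))))
        where
        open +-*-Solver
        arith : ∀ a y k → suc a * 2 + (y * 2 + k) ≡ (a + y) * 2 + (2 + k)
        arith = solve 3 (λ a y k → (con 1 :+ a) :* con 2 :+ (y :* con 2 :+ k) := (a :+ y) :* con 2 :+ (con 2 :+ k)) refl
        add : ∀ a {x y k} → x ≤ y * 2 + k → suc a * 2 + x ≤ (a + y) * 2 + (2 + k)
        add a {x} {y} {k} le = ≤-trans (+-monoʳ-≤ (suc a * 2) le) (≤-reflexive (arith a y k))
        base : suc (length clk) * 2 ≤ (length clk + length rec) * 2 + 2
        base = ≤-trans (≤-reflexive (+-comm 2 (length clk * 2))) (+-monoˡ-≤ 2 (*-monoˡ-≤ 2 (m≤m+n (length clk) (length rec))))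

      cleanup-det : Det cleanup
      cleanup-det = tt , tt , tt , tt , tt , tt

      map-rdW : ∀ x → map rdW (bits x) ≡ map encodeBit x
      map-rdW [] = refl
      map-rdW (b ∷ x) = cong (encodeBit b ∷_) (map-rdW x)

      input-zip : ∀ x → Zip rdW [] (bits x) (tape (map encodeBit x) 0)
      input-zip x = zip refl (λ k → cong (λ l → readL l k) (map-rdW x))

    -- The bound on the record is needed to estimate its later verification. It holds because all
    -- that is left in the registers is at most the input length plus the time spent.
    simulate-complete : ∀ {c x tr env sav} → Run M (poly c (length x)) (initial M x) tr →
      Exec A (simulate c) (regs (bits x) [] [] [] [] [] [] env sav) (regs [] [] [] [] [] [] (records tr []) env sav) (fn (simulateP c) (length x))
      × length (records tr []) ≤ fn (simulateP c) (length x)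
    simulate-complete {c} {x} {tr} {env} {sav} r
      with loop-complete {o = resumeIn start} {bits x} {s = []} {rec = []} {env} {sav} r refl (input-zip x) blank
    ... | _ , e , done {inp} {wl} {ql} {qr} {s} {clk} o o≡ =
      Exec-mono (clk-e ⨾ put₁ ⨾ e ⨾ if-t {t = 0} (inState-≡ {o} ∙ does-yes o≡) skip ⨾ cleanup-exec)
        (≤-trans (≤-reflexive (arith (fn (clockP c) n) (fn (loopP c) n) _)) (+-monoʳ-≤ (fn (clockP c) n + (1 + fn (loopP c) n)) (+-monoʳ-≤ 1 (+-monoˡ-≤ 12 (*-monoˡ-≤ 2 core≤))))) ,
      ≤-trans (rec≤ (length inp) (length wl) (length ql) (length qr) (length (optSym o ∷ s)) (length clk) (length (records tr [])))
        (≤-trans core≤ (≤-trans (≤-trans (m≤m*n (n + T) 2) (m≤m+n _ 12)) (≤-trans (m≤n+m _ 1) (m≤n+m _ T))))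
      where
      n = length x
      T : ℕ
      T = fn (clockP c ⊕ (constP 1 ⊕ loopP c)) n
      clk-e : Exec A (clock c) (regs (bits x) [] [] [] [] [] [] env sav) (regs (bits x) [] [] [] [] (dots (poly c n)) [] env sav) (fn (clockP c) n)
      clk-e = subst (λ k → Exec A (clock c) (regs (bits x) [] [] [] [] [] [] env sav) (regs (bits x) [] [] [] [] (dots (poly c k)) [] env sav) (fn (clockP c) k))
                (length-map inj₁ x) (clock-exec c)
      main : Exec A (clock c ⨾ put STA (const′ (optSym (resumeIn start))) ⨾ loop) (regs (bits x) [] [] [] [] [] [] env sav)
               (regs inp wl ql qr (optSym o ∷ s) clk (records tr []) env sav) T
      main = clk-e ⨾ put₁ ⨾ e
      core≤ : core (regs inp wl ql qr (optSym o ∷ s) clk (records tr []) env sav) ≤ n + T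
      core≤ = ≤-trans (core-growth main) (≤-reflexive (cong (_+ T) (+-identityʳ _ ∙ length-map inj₁ x)))
      rec≤ : ∀ a b c d e f g → g ≤ a + (b + (c + (d + (e + (f + g)))))
      rec≤ a b c d e f g = ≤-trans (m≤n+m g f) (≤-trans (m≤n+m _ e) (≤-trans (m≤n+m _ d) (≤-trans (m≤n+m _ c) (≤-trans (m≤n+m _ b) (m≤n+m _ a)))))
      arith : ∀ a l k → a + (1 + (l + (1 + k))) ≡ a + (1 + l) + (1 + k)
      arith a l k = sym (+-assoc a (1 + l) (1 + k))

    simulate-sound : ∀ {c x env sav σ' t} → Exec A (simulate c) (regs (bits x) [] [] [] [] [] [] env sav) σ' t
      → ∃[ tr ] (Run M (poly c (length x)) (initial M x) tr × σ' ≡ regs [] [] [] [] [] [] (records tr []) env sav)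
    simulate-sound {c} {x} (e₁ ⨾ e₂) with refl ← Exec-det (clock-det c) e₁ (clock-exec c) with e₂
    ... | put ⨾ f ⨾ if-t acc skip ⨾ g with loop-sound {o = resumeIn start} f acc (input-zip x) blank
    ... | tr , r , done o o≡ = tr , subst (λ k → Run M (poly c k) (initial M x) tr) (length-map inj₁ x) r , Exec-det cleanup-det g cleanup-exec

-- String manipulation

-- A self-delimiting code made for stacks: over `false ∷ e`, the first component is extended at its
-- front by pushing a bit and then `true`, so it can be guessed or copied one bit at a time.
pair : Str → Str → Str
pair []      e = false ∷ e
pair (b ∷ q) e = true ∷ b ∷ pair q e

fst : Str → Str
fst (true ∷ b ∷ w) = b ∷ fst w
fst _              = []

-- The values on strings that are not pairs are those that the loop of `unpair` happens to leave, so
-- the programs are correct on all inputs.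
unpaired : Str → Str
unpaired (true ∷ _ ∷ w) = unpaired w
unpaired (true ∷ [])    = []
unpaired w              = w

snd : Str → Str
snd w = tl (unpaired w)

fst-pair : ∀ q e → fst (pair q e) ≡ q
fst-pair [] e = refl
fst-pair (b ∷ q) e = cong (b ∷_) (fst-pair q e)

snd-pair : ∀ q e → snd (pair q e) ≡ e
snd-pair [] e = refl
snd-pair (b ∷ q) e = snd-pair q e

length-pair : ∀ q e → length (pair q e) ≡ suc (length q * 2 + length e)
length-pair [] e = refl
length-pair (b ∷ q) e = cong (λ k → suc (suc k)) (length-pair q e)

length-fst : ∀ w → length (fst w) ≤ length w
length-fst [] = z≤n
length-fst (false ∷ w) = z≤n
length-fst (true ∷ []) = z≤n
length-fst (true ∷ b ∷ w) = s≤s (m≤n⇒m≤1+n (length-fst w))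

length-unpaired : ∀ w → length (unpaired w) ≤ length w
length-unpaired [] = z≤n
length-unpaired (false ∷ w) = ≤-refl
length-unpaired (true ∷ []) = z≤n
length-unpaired (true ∷ b ∷ w) = ≤-trans (length-unpaired w) (≤-trans (n≤1+n _) (n≤1+n _))

length-snd : ∀ w → length (snd w) ≤ length w
length-snd w = ≤-trans (length-tl (unpaired w)) (length-unpaired w)

All-ʳ++⁺ : ∀ {A : Set} {P : A → Set} {xs ys} → All P xs → All P ys → All P (xs ʳ++ ys)
All-ʳ++⁺ [] q = q
All-ʳ++⁺ (p ∷ ps) q = All-ʳ++⁺ ps (p ∷ q)

All-ʳ++⁻ : ∀ {A : Set} {P : A → Set} xs {ys} → All P (xs ʳ++ ys) → All P xs × All P ys
All-ʳ++⁻ [] q = [] , q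
All-ʳ++⁻ (x ∷ xs) q with All-ʳ++⁻ xs q
... | ps , p ∷ qs = p ∷ ps , qs

module Strings (W : Set) (finW : Finite W) where
  open Registers W finW
  open Records W finW

  toBits-bits : ∀ x {l} → toBits l ≡ [] → toBits (bits x ++ l) ≡ x
  toBits-bits [] e = e
  toBits-bits (b ∷ x) e = cong (b ∷_) (toBits-bits x e)

  toBits-bits₀ : ∀ x → toBits (bits x) ≡ x
  toBits-bits₀ [] = refl
  toBits-bits₀ (b ∷ x) = cong (b ∷_) (toBits-bits₀ x)

  reverseBits : ∀ x z → bits x ʳ++ bits z ≡ bits (x ʳ++ z)
  reverseBits x z = sym (map-ʳ++ inj₁ x)

  tl-bits : ∀ x → tl (bits x) ≡ bits (tl x)
  tl-bits [] = refl
  tl-bits (_ ∷ x) = refl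

  topIs : Bool → Reg → Tops → Bool
  topIs b r v = isBitOf b (lookup v r)

  -- `verify` asks its query with the remaining record still below it, relying on `toBits` stopping
  -- at the next mark. `guess` may let a tick pass without producing a bit, so that all lengths up
  -- to the clock occur.
  unpair split copy pairUp dup verify guess : Cmd
  unpair = while (topIs true INP) (pop INP ⨾ ifc (has INP) (put WL (top INP) ⨾ pop INP) skip)
  split  = unpair ⨾ pop INP ⨾ move INP QL ⨾ move QL ENV ⨾ move WL INP
  copy   = while (has INP) (put QL (top INP) ⨾ put SAV (top INP) ⨾ pop INP) ⨾ move QL INP
  pairUp = while (λ v → isBit (lookup v SAV)) (put INP (top SAV) ⨾ put INP (const′ (bit true)) ⨾ pop SAV)
  dup    = copy ⨾ put INP (const′ (bit false)) ⨾ pairUp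
  verify = while (has REC)
    (ifc (λ v → isMarkOf true (lookup v REC)) (pop REC ⨾ ask REC skip fail) (pop REC ⨾ ask REC fail skip) ⨾ clearBits REC)
  guess  = while (has CLK)
    (pop CLK ⨾ amb skip (pick INP (λ _ → bit false ∷ bit true ∷ []) ⨾ put INP (const′ (bit true))))

  guessPair : ℕ → Cmd
  guessPair c = clock c ⨾ put INP (const′ (bit false)) ⨾ guess

  dropFst : Cmd
  dropFst = while (topIs true INP) (pop INP ⨾ pop INP) ⨾ pop INP

  module _ {A : Lang} where
    moveINP-QL : ∀ inp {wl ql qr s clk rec env sav} →
      Exec A (move INP QL) (regs inp wl ql qr s clk rec env sav) (regs [] wl (inp ʳ++ ql) qr s clk rec env sav) (suc (length inp) * 3)
    moveINP-QL [] = while-f refl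
    moveINP-QL (a ∷ inp) = while-t refl (put₁ ⨾ pop₁) (moveINP-QL inp)

    moveQL-INP : ∀ ql {inp wl qr s clk rec env sav} →
      Exec A (move QL INP) (regs inp wl ql qr s clk rec env sav) (regs (ql ʳ++ inp) wl [] qr s clk rec env sav) (suc (length ql) * 3)
    moveQL-INP [] = while-f refl
    moveQL-INP (a ∷ ql) = while-t refl (put₁ ⨾ pop₁) (moveQL-INP ql)

    moveQL-ENV : ∀ ql {inp wl qr s clk rec env sav} →
      Exec A (move QL ENV) (regs inp wl ql qr s clk rec env sav) (regs inp wl [] qr s clk rec (ql ʳ++ env) sav) (suc (length ql) * 3)
    moveQL-ENV [] = while-f refl
    moveQL-ENV (a ∷ ql) = while-t refl (put₁ ⨾ pop₁) (moveQL-ENV ql)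

    moveSAV-INP : ∀ sav {inp wl ql qr s clk rec env} →
      Exec A (move SAV INP) (regs inp wl ql qr s clk rec env sav) (regs (sav ʳ++ inp) wl ql qr s clk rec env []) (suc (length sav) * 3)
    moveSAV-INP [] = while-f refl
    moveSAV-INP (a ∷ sav) = while-t refl (put₁ ⨾ pop₁) (moveSAV-INP sav)

    moveREC-SAV : ∀ rec {inp wl ql qr s clk env sav} →
      Exec A (move REC SAV) (regs inp wl ql qr s clk rec env sav) (regs inp wl ql qr s clk [] env (rec ʳ++ sav)) (suc (length rec) * 3)
    moveREC-SAV [] = while-f refl
    moveREC-SAV (a ∷ rec) = while-t refl (put₁ ⨾ pop₁) (moveREC-SAV rec)

    moveENV-WL : ∀ env {inp wl ql qr s clk rec sav} →
      Exec A (move ENV WL) (regs inp wl ql qr s clk rec env sav) (regs inp (env ʳ++ wl) ql qr s clk rec [] sav) (suc (length env) * 3)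
    moveENV-WL [] = while-f refl
    moveENV-WL (a ∷ env) = while-t refl (put₁ ⨾ pop₁) (moveENV-WL env)

    unpair-exec : ∀ x {wl ql qr s clk rec env sav} →
      Exec A unpair (regs (bits x) wl ql qr s clk rec env sav) (regs (bits (unpaired x)) (bits (fst x) ʳ++ wl) ql qr s clk rec env sav) (suc (length x) * 5)
    unpair-exec [] = while-f refl
    unpair-exec (false ∷ x) = while-f refl
    unpair-exec (true ∷ []) = while-t refl (pop₁ ⨾ if-f refl (skip {t = 2})) (while-f refl)
    unpair-exec (true ∷ b ∷ x) = Exec-mono (while-t refl (pop₁ ⨾ if-t refl (put₁ ⨾ pop₁)) (unpair-exec x)) (m≤n+m _ 5)

    private
      reversed : ∀ (l : List Sym) → length (l ʳ++ []) ≡ length l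
      reversed l = length-ʳ++ l ∙ +-identityʳ _

    split-exec : ∀ x → Exec A split (input x) (regs (bits (fst x)) [] [] [] [] [] [] (bits (snd x)) []) (suc (length x) * 14 + 1)
    split-exec x = Exec-mono
      (unpair-exec x ⨾ pop₁ ⨾ Exec-mono (moveINP-QL (tl (bits (unpaired x)))) (≤-reflexive (cong (λ l → suc (length l) * 3) (tl-bits (unpaired x)))) ⨾
       Exec-to (cong (λ l → regs [] (bits (fst x) ʳ++ []) [] [] [] [] [] l []) (ʳ++-ʳ++-[] (tl (bits (unpaired x))) [] ∙ tl-bits (unpaired x)))
         (moveQL-ENV (tl (bits (unpaired x)) ʳ++ [])) ⨾
       Exec-to (cong (λ l → regs l [] [] [] [] [] [] (bits (snd x)) []) (ʳ++-ʳ++-[] (bits (fst x)) [])) (moveWL-INP (bits (fst x) ʳ++ [])))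
      (≤-trans (+-monoʳ-≤ (suc (length x) * 5) (+-monoʳ-≤ 1 (+-mono-≤ (*-monoˡ-≤ 3 (s≤s s≤)) (+-mono-≤
          (*-monoˡ-≤ 3 (s≤s (≤-trans (≤-reflexive (reversed (tl (bits (unpaired x))) ∙ cong length (tl-bits (unpaired x)))) s≤)))
          (*-monoˡ-≤ 3 (s≤s (≤-trans (≤-reflexive (reversed (bits (fst x)) ∙ length-map inj₁ (fst x))) (length-fst x))))))))
        (≤-reflexive (arith (suc (length x)))))
      where
      s≤ : length (bits (snd x)) ≤ length x
      s≤ = ≤-trans (≤-reflexive (length-map inj₁ (snd x))) (length-snd x)
      open +-*-Solver
      arith : ∀ n → n * 5 + (1 + (n * 3 + (n * 3 + n * 3))) ≡ n * 14 + 1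
      arith = solve 1 (λ n → n :* con 5 :+ (con 1 :+ (n :* con 3 :+ (n :* con 3 :+ n :* con 3))) := n :* con 14 :+ con 1) refl

    dropFst-exec : ∀ x → Exec A dropFst (input x) (regs (bits (snd x)) [] [] [] [] [] [] [] []) (suc (length x) * 3 + 1)
    dropFst-exec x = walk x ⨾ Exec-to (cong (λ l → regs l [] [] [] [] [] [] [] []) (tl-bits (unpaired x))) pop₁
      where
      walk : ∀ x → Exec A (while (topIs true INP) (pop INP ⨾ pop INP)) (regs (bits x) [] [] [] [] [] [] [] []) (regs (bits (unpaired x)) [] [] [] [] [] [] [] []) (suc (length x) * 3)
      walk [] = while-f refl
      walk (false ∷ x) = while-f refl
      walk (true ∷ []) = while-t refl (pop₁ ⨾ pop₁) (while-f refl)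
      walk (true ∷ b ∷ x) = Exec-mono (while-t refl (pop₁ ⨾ pop₁) (walk x)) (m≤n+m _ 3)

    copy-exec : ∀ x → Exec A copy (input x) (regs (bits x) [] [] [] [] [] [] [] (bits (x ʳ++ []))) (suc (length x) * 7)
    copy-exec x = Exec-mono
      (walk x [] ⨾ Exec-to (cong (λ l → regs l [] [] [] [] [] [] [] (bits (x ʳ++ []))) (reverseBits (x ʳ++ []) [] ∙ cong bits (ʳ++-ʳ++-[] x [])))
        (moveQL-INP (bits (x ʳ++ []))))
      (≤-reflexive (cong (λ k → suc (length x) * 4 + suc k * 3) (length-map inj₁ (x ʳ++ []) ∙ length-ʳ++ x ∙ +-identityʳ _) ∙ arith (suc (length x))))
      where
      walk : ∀ x z → Exec A (while (has INP) (put QL (top INP) ⨾ put SAV (top INP) ⨾ pop INP)) (regs (bits x) [] (bits z) [] [] [] [] [] (bits z))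
                     (regs [] [] (bits (x ʳ++ z)) [] [] [] [] [] (bits (x ʳ++ z))) (suc (length x) * 4)
      walk [] z = while-f refl
      walk (b ∷ x) z = while-t refl (put₁ ⨾ put₁ ⨾ pop₁) (walk x (b ∷ z))
      open +-*-Solver
      arith : ∀ n → n * 4 + n * 3 ≡ n * 7
      arith = solve 1 (λ n → n :* con 4 :+ n :* con 3 := n :* con 7) refl

    pairUp-exec : ∀ r q e {l wl ql qr s clk rec env} → isBit (nth 0 l) ≡ false →
      Exec A pairUp (regs (bits (pair q e)) wl ql qr s clk rec env (bits r ++ l)) (regs (bits (pair (r ʳ++ q) e)) wl ql qr s clk rec env l) (suc (length r) * 4)
    pairUp-exec [] q e nb = while-f nb
    pairUp-exec (b ∷ r) q e nb = while-t refl (put₁ ⨾ put₁ ⨾ pop₁) (pairUp-exec r (b ∷ q) e nb)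

    dup-exec : ∀ x → Exec A dup (input x) (regs (bits (pair x x)) [] [] [] [] [] [] [] []) (suc (length x) * 11 + 1)
    dup-exec x = Exec-mono
      (copy-exec x ⨾ put₁ ⨾ Exec-to (cong (λ y → regs (bits (pair y x)) [] [] [] [] [] [] [] []) (ʳ++-ʳ++-[] x []))
        (Exec-from (cong (λ l → regs (bits (pair [] x)) [] [] [] [] [] [] [] l) (++-identityʳ (bits (x ʳ++ [])))) (pairUp-exec (x ʳ++ []) [] x {[]} refl)))
      (≤-reflexive (cong (λ k → suc (length x) * 7 + (1 + suc k * 4)) (length-ʳ++ x ∙ +-identityʳ _) ∙ arith (suc (length x))))
      where
      open +-*-Solver
      arith : ∀ n → n * 7 + (1 + n * 4) ≡ n * 11 + 1
      arith = solve 1 (λ n → n :* con 7 :+ (con 1 :+ n :* con 4) := n :* con 11 :+ con 1) refl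

    guess-complete : ∀ n r u e → length r ≤ n →
      Exec A guess (regs (bits (pair u e)) [] [] [] [] (dots n) [] [] []) (regs (bits (pair (r ʳ++ u) e)) [] [] [] [] [] [] [] []) (suc n * 5)
    guess-complete zero [] u e _ = while-f refl
    guess-complete (suc n) [] u e _ = while-t refl (pop₁ ⨾ amb-l (skip {t = 2})) (guess-complete n [] u e z≤n)
    guess-complete (suc n) (false ∷ r) u e (s≤s le) = while-t refl (pop₁ ⨾ amb-r (pick {t = 0} (here refl) ⨾ put₁)) (guess-complete n r (false ∷ u) e le)
    guess-complete (suc n) (true ∷ r) u e (s≤s le) = while-t refl (pop₁ ⨾ amb-r (pick {t = 0} (there (here refl)) ⨾ put₁)) (guess-complete n r (true ∷ u) e le)

    guess-sound : ∀ n u e {σ t} → Exec A guess (regs (bits (pair u e)) [] [] [] [] (dots n) [] [] []) σ t →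
      ∃[ r ] (length r ≤ n × σ ≡ regs (bits (pair (r ʳ++ u) e)) [] [] [] [] [] [] [] [])
    guess-sound zero u e (while-f _) = [] , z≤n , refl
    guess-sound zero u e (while-t () _ _)
    guess-sound (suc n) u e (while-f ())
    guess-sound (suc n) u e (while-t _ (pop ⨾ amb-l skip) f) with guess-sound n u e f
    ... | r , le , eq = r , m≤n⇒m≤1+n le , eq
    guess-sound (suc n) u e (while-t _ (pop ⨾ amb-r (pick (here refl) ⨾ put)) f) with guess-sound n (false ∷ u) e f
    ... | r , le , eq = false ∷ r , s≤s le , eq
    guess-sound (suc n) u e (while-t _ (pop ⨾ amb-r (pick (there (here refl)) ⨾ put)) f) with guess-sound n (true ∷ u) e f
    ... | r , le , eq = true ∷ r , s≤s le , eq

    guessPair-clock : ∀ c x → Exec A (clock c) (input x) (regs (bits x) [] [] [] [] (dots (poly c (length x))) [] [] []) (fn (clockP c) (length x))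
    guessPair-clock c x = subst (λ k → Exec A (clock c) (input x) (regs (bits x) [] [] [] [] (dots (poly c k)) [] [] []) (fn (clockP c) k))
                            (length-map inj₁ x) (clock-exec c)

    guessPair-complete : ∀ c x u → length u ≤ poly c (length x) →
      Exec A (guessPair c) (input x) (regs (bits (pair u x)) [] [] [] [] [] [] [] []) (fn (clockP c) (length x) + (1 + suc (poly c (length x)) * 5))
    guessPair-complete c x u le = guessPair-clock c x ⨾ put₁ ⨾
      Exec-to (cong (λ y → regs (bits (pair y x)) [] [] [] [] [] [] [] []) (ʳ++-ʳ++-[] u []))
        (guess-complete (poly c (length x)) (u ʳ++ []) [] x (≤-trans (≤-reflexive (length-ʳ++ u ∙ +-identityʳ _)) le))

    guessPair-sound : ∀ c x {σ t} → Exec A (guessPair c) (input x) σ t →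
      ∃[ u ] (length u ≤ poly c (length x) × σ ≡ regs (bits (pair u x)) [] [] [] [] [] [] [] [])
    guessPair-sound c x (e₁ ⨾ e₂) with refl ← Exec-det (clock-det c) e₁ (guessPair-clock c x) with e₂
    ... | put ⨾ f with guess-sound (poly c (length x)) [] x f
    ... | r , le , eq = r ʳ++ [] , ≤-trans (≤-reflexive (length-ʳ++ r ∙ +-identityʳ _)) le , eq

    toBits-encode : ∀ tr → toBits (encode tr) ≡ []
    toBits-encode [] = refl
    toBits-encode (_ ∷ _) = refl

    clearBits-exec : ∀ q {tr env sav} → Exec A (clearBits REC) (regs [] [] [] [] [] [] (bits q ++ encode tr) env sav)
                                          (regs [] [] [] [] [] [] (encode tr) env sav) (suc (length q) * 2)
    clearBits-exec [] {[]} = while-f refl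
    clearBits-exec [] {_ ∷ _} = while-f refl
    clearBits-exec (b ∷ q) {tr} = while-t refl pop₁ (clearBits-exec q {tr})

    verify-encoded : ∀ tr {env sav} → Sat (answers A) tr → Exec A verify (regs [] [] [] [] [] [] (encode tr) env sav) (regs [] [] [] [] [] [] [] env sav) (suc (length (encode tr)) * 6)
    verify-encoded [] s = while-f refl
    verify-encoded ((b , q) ∷ tr) {env} {sav} (a ∷ s) = Exec-mono (while-t refl (check b a ⨾ clearBits-exec q {tr}) (verify-encoded tr s))
      (≤-trans (m≤m+n _ (length q * 4)) (≤-reflexive (arith (length q) (length (encode tr))
         ∙ cong (λ k → suc (suc k) * 6) (cong (_+ length (encode tr)) (sym (length-map inj₁ q)) ∙ sym (length-++ (bits q))))))
      where
      open +-*-Solver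
      arith : ∀ q n → suc (3 + suc q * 2 + suc n * 6) + q * 4 ≡ suc (suc (q + n)) * 6
      arith = solve 2 (λ q n → con 1 :+ (con 3 :+ (con 1 :+ q) :* con 2 :+ (con 1 :+ n) :* con 6) :+ q :* con 4 := (con 2 :+ (q :+ n)) :* con 6) refl
      asked≡ : A (toBits (bits q ++ encode tr)) ≡ A q
      asked≡ = cong A (toBits-bits q (toBits-encode tr))
      check : ∀ b → answers A b q ≡ true → Exec A (ifc (λ v → isMarkOf true (lookup v REC)) (pop REC ⨾ ask REC skip fail) (pop REC ⨾ ask REC fail skip))
                (regs [] [] [] [] [] [] (mark b ∷ bits q ++ encode tr) env sav) (regs [] [] [] [] [] [] (bits q ++ encode tr) env sav) 3
      check true a = if-t refl (pop₁ ⨾ ask-t (asked≡ ∙ a) (skip {t = 0}))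
      check false a = if-f refl (pop₁ ⨾ ask-f (asked≡ ∙ answers-≡ A false q a) (skip {t = 0}))

    verify-encoded-sound : ∀ tr {env sav σ t} → Exec A verify (regs [] [] [] [] [] [] (encode tr) env sav) σ t
      → Sat (answers A) tr × σ ≡ regs [] [] [] [] [] [] [] env sav
    verify-encoded-sound [] (while-f _) = [] , refl
    verify-encoded-sound [] (while-t () _ _)
    verify-encoded-sound (_ ∷ _) (while-f ())
    verify-encoded-sound ((true , q) ∷ tr) (while-t _ (if-t _ (pop ⨾ ask-t a skip) ⨾ e) f) with refl ← Exec-det tt e (clearBits-exec q {tr})
      with verify-encoded-sound tr f
    ... | s , eq = cong A (sym (toBits-bits q (toBits-encode tr))) ∙ a ∷ s , eq
    verify-encoded-sound ((true , q) ∷ tr) (while-t _ (if-t _ (pop ⨾ ask-f a ()) ⨾ e) f)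
    verify-encoded-sound ((true , q) ∷ tr) (while-t _ (if-f () _ ⨾ e) f)
    verify-encoded-sound ((false , q) ∷ tr) (while-t _ (if-t () _ ⨾ e) f)
    verify-encoded-sound ((false , q) ∷ tr) (while-t _ (if-f _ (pop ⨾ ask-t a ()) ⨾ e) f)
    verify-encoded-sound ((false , q) ∷ tr) (while-t _ (if-f _ (pop ⨾ ask-f a skip) ⨾ e) f) with refl ← Exec-det tt e (clearBits-exec q {tr})
      with verify-encoded-sound tr f
    ... | s , eq = cong not (cong A (sym (toBits-bits q (toBits-encode tr))) ∙ a) ∷ s , eq

-- Closure properties of relativized NP

module Call (W : Set) (finW : Finite W) (M : OTM)
  (emb : TSym M → W) (prj : W → Maybe (TSym M)) (prj-emb : ∀ s → prj (emb s) ≡ just s)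
  {A L : Lang} (c : ℕ)
  (spec : ∀ x → (L x ≡ true → AcceptsIn M A (poly c (length x)) (initial M x)) × (AcceptsIn M A (poly c (length x)) (initial M x) → L x ≡ true)) where

  open Registers W finW
  open Records W finW
  open Strings W finW
  open Simulation W finW M emb prj prj-emb

  call : Cmd
  call = simulate c ⨾ verify

  callP : PolyFn
  callP = simulateP c ⊕ (constP 1 ⊕ simulateP c) ⊗ constP 6

  call-complete : ∀ {x env sav} → L x ≡ true →
    Exec A call (regs (bits x) [] [] [] [] [] [] env sav) (regs [] [] [] [] [] [] [] env sav) (fn callP (length x))
  call-complete {x} {env} {sav} Lx with AcceptsIn⇒Run M (proj₁ (spec x) Lx)
  ... | tr , r , s with simulate-complete {A} {c} {x} {tr} {env} {sav} r
  ... | e , short = Exec-to (cong (λ l → regs [] [] [] [] [] [] l env sav) (records-encode tr [])) e ⨾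
    Exec-mono (verify-encoded (tr ʳ++ []) (All-ʳ++⁺ s []))
      (*-monoˡ-≤ 6 (s≤s (≤-trans (≤-reflexive (cong length (sym (records-encode tr [])))) short)))

  call-sound : ∀ {x env sav σ t} → Exec A call (regs (bits x) [] [] [] [] [] [] env sav) σ t
    → L x ≡ true × σ ≡ regs [] [] [] [] [] [] [] env sav
  call-sound {x} {env} {sav} (e ⨾ f) with simulate-sound {A} {c} {x} e
  ... | tr , r , refl with verify-encoded-sound (tr ʳ++ []) (Exec-from (cong (λ l → regs [] [] [] [] [] [] l env sav) (records-encode tr [])) f)
  ... | s , eq = proj₂ (spec x) (Run⇒AcceptsIn M r (proj₁ (All-ʳ++⁻ tr s))) , eq

-- Acceptance as a command that can be followed by others: it can finish only if `x` belongs to `L`,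
-- and then it returns clean registers with `ENV` and `SAV` intact.
record Subroutine (W : Set) (fW : Finite W) (A L : Lang) : Set where
  open Registers W fW
  field
    call     : Cmd
    cost     : PolyFn
    complete : ∀ {x env sav} → L x ≡ true →
      Exec A call (regs (bits x) [] [] [] [] [] [] env sav) (regs [] [] [] [] [] [] [] env sav) (fn cost (length x))
    sound    : ∀ {x env sav σ t} → Exec A call (regs (bits x) [] [] [] [] [] [] env sav) σ t
      → L x ≡ true × σ ≡ regs [] [] [] [] [] [] [] env sav

subroutine : ∀ {W A L} (fW : Finite W) (p : NP[ A ] L) (emb : TSym (proj₁ p) → W) (prj : W → Maybe (TSym (proj₁ p)))
           → (∀ s → prj (emb s) ≡ just s) → Subroutine W fW A L
subroutine {W} fW (M , c , spec) emb prj prj-emb = record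
  { call = call ; cost = callP ; complete = λ {x} → call-complete {x} ; sound = λ {x} → call-sound {x} }
  where open Call W fW M emb prj prj-emb c spec

subroutine₁ : ∀ {A L} (p : NP[ A ] L) → Subroutine (TSym (proj₁ p)) (finTSym (proj₁ p)) A L
subroutine₁ p = subroutine (finTSym (proj₁ p)) p id just (λ _ → refl)

module _ {A L₁ L₂ : Lang} (p₁ : NP[ A ] L₁) (p₂ : NP[ A ] L₂) where
  Sym₂ : Set
  Sym₂ = TSym (proj₁ p₁) ⊎ TSym (proj₁ p₂)

  finSym₂ : Finite Sym₂
  finSym₂ = fin⊎ (finTSym (proj₁ p₁)) (finTSym (proj₁ p₂))

  subroutineˡ : Subroutine Sym₂ finSym₂ A L₁
  subroutineˡ = subroutine finSym₂ p₁ inj₁ (λ { (inj₁ s) → just s ; (inj₂ _) → nothing }) (λ _ → refl)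

  subroutineʳ : Subroutine Sym₂ finSym₂ A L₂
  subroutineʳ = subroutine finSym₂ p₂ inj₂ (λ { (inj₁ _) → nothing ; (inj₂ s) → just s }) (λ _ → refl)

-- `G` is a relation so that guessing a string is covered too. The program is uniform in `W` because
-- it will run before a subroutine with symbols of its own; what it leaves on `ENV` and `SAV` is
-- ignored there.
record Transducer (G : Str → Str → Set) : Set₁ where
  field
    program  : ∀ W (fW : Finite W) → Registers.Cmd W fW
    T V      : PolyFn
    complete : ∀ W fW → let open Registers W fW in ∀ {A x v} → G x v → ∃[ env ] ∃[ sav ]
               Exec A (program W fW) (input x) (regs (bits v) [] [] [] [] [] [] env sav) (fn T (length x))
    sound    : ∀ W fW → let open Registers W fW in ∀ {A x σ t} → Exec A (program W fW) (input x) σ t → ∃[ v ] ∃[ env ] ∃[ sav ]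
               (G x v × σ ≡ regs (bits v) [] [] [] [] [] [] env sav)
    short    : ∀ {x v} → G x v → length v ≤ fn V (length x)

Graph : (Str → Str) → Str → Str → Set
Graph f x v = v ≡ f x

linearP : ℕ → PolyFn
linearP k = (constP 1 ⊕ idP) ⊗ constP k ⊕ constP 1

fstT : Transducer (Graph fst)
fstT = record
  { program = Strings.split ; T = linearP 14 ; V = idP
  ; complete = λ { W fW {A} {x} refl → _ , _ , Strings.split-exec W fW {A} x }
  ; sound = λ W fW {A} {x} e → _ , _ , _ , refl ,
      Registers.Exec-det W fW ((tt , (tt , tt) , tt) , tt , (tt , tt) , (tt , tt) , tt , tt) e (Strings.split-exec W fW {A} x)
  ; short = λ { {x} refl → length-fst x } }

sndT : Transducer (Graph snd)
sndT = record
  { program = Strings.dropFst ; T = linearP 3 ; V = idP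
  ; complete = λ { W fW {A} {x} refl → _ , _ , Strings.dropFst-exec W fW {A} x }
  ; sound = λ W fW {A} {x} e → _ , _ , _ , refl , Registers.Exec-det W fW ((tt , tt) , tt) e (Strings.dropFst-exec W fW {A} x)
  ; short = λ { {x} refl → length-snd x } }

diagonal : Str → Str
diagonal x = pair x x

dupT : Transducer (Graph diagonal)
dupT = record
  { program = Strings.dup ; T = linearP 11 ; V = constP 1 ⊕ (idP ⊗ constP 2 ⊕ idP)
  ; complete = λ { W fW {A} {x} refl → _ , _ , Strings.dup-exec W fW {A} x }
  ; sound = λ W fW {A} {x} e → _ , _ , _ , refl ,
      Registers.Exec-det W fW (((tt , tt , tt) , tt , tt) , tt , tt , tt , tt) e (Strings.dup-exec W fW {A} x)
  ; short = λ { {x} refl → ≤-reflexive (length-pair x x) } }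

consT : ∀ b → Transducer (Graph (b ∷_))
consT b = record
  { program = λ W fW → Registers.put zero (λ _ → inj₁ b) ; T = constP 1 ; V = constP 1 ⊕ idP
  ; complete = λ { W fW refl → _ , _ , Registers.put }
  ; sound = λ { W fW {A} {x} Registers.put → _ , _ , _ , refl , refl }
  ; short = λ { refl → ≤-refl } }

Guessed : ℕ → Str → Str → Set
Guessed c x v = ∃[ u ] (length u ≤ poly c (length x) × v ≡ pair u x)

guessT : ∀ c → Transducer (Guessed c)
guessT c = record
  { program = λ W fW → Strings.guessPair W fW c ; T = clockP c ⊕ (constP 1 ⊕ (constP 1 ⊕ polyP c) ⊗ constP 5) ; V = constP 1 ⊕ (polyP c ⊗ constP 2 ⊕ idP)
  ; complete = λ { W fW {A} {x} (u , le , refl) → _ , _ , Strings.guessPair-complete W fW {A} c x u le }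
  ; sound = λ W fW {A} {x} e → let (u , le , eq) = Strings.guessPair-sound W fW {A} c x e in _ , _ , _ , (u , le , refl) , eq
  ; short = λ { {x} (u , le , refl) → ≤-trans (≤-reflexive (length-pair u x)) (s≤s (+-monoˡ-≤ (length x) (*-monoˡ-≤ 2 le))) } }

-- Preimages under computable maps and polynomially bounded existential quantifiers are both
-- instances: the guesses of the transducer merge with those of the machine for `L`.
NP-transduce : ∀ {A L L' G} → Transducer G → NP[ A ] L → (∀ x → L' x ≡ true → ∃[ v ] (G x v × L v ≡ true)) → (∀ {x v} → G x v → L v ≡ true → L' x ≡ true)
             → NP[ A ] L'
NP-transduce {A} {L} {L'} {G} tr p to from = compose (subroutine₁ p)
  where
  module _ {W : Set} {fW : Finite W} (S : Subroutine W fW A L) where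
    open Registers W fW
    open Transducer tr
    open Subroutine S renaming (complete to call-complete; sound to call-sound)
    compose : NP[ A ] L'
    compose = program⇒NP (program W fW ⨾ call) (T ⊕ cost ⊚ V) complete′ (λ x → λ { (e ⨾ f) → sound′ x e f })
      where
      complete′ : ∀ x → L' x ≡ true → ∃[ σ' ] Exec A (program W fW ⨾ call) (input x) σ' (fn (T ⊕ cost ⊚ V) (length x))
      complete′ x e =
        let (v , g , Lv) = to x e ; (_ , _ , ex) = complete W fW {A} g
        in _ , ex ⨾ Exec-mono (call-complete {v} Lv) (mono cost (short g))
      sound′ : ∀ x {σ σ' t t'} → Exec A (program W fW) (input x) σ t → Exec A call σ σ' t' → L' x ≡ true
      sound′ x e f = let (v , _ , _ , g , eq) = sound W fW e in from g (proj₁ (call-sound {v} (Exec-from eq f)))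

NP-preimage : ∀ {A L f} → Transducer (Graph f) → NP[ A ] L → NP[ A ] (L ∘ f)
NP-preimage {f = f} t p = NP-transduce t p (λ x e → f x , refl , e) (λ { refl e → e })

NP-resp : ∀ {A L L'} → L ≐ L' → NP[ A ] L → NP[ A ] L'
NP-resp eq (M , c , spec) = M , c , λ x → (λ e → proj₁ (spec x) (eq x ∙ e)) , (λ a → sym (eq x) ∙ proj₂ (spec x) a)

NP-query : ∀ {A} → NP[ A ] A
NP-query {A} = program⇒NP (ask INP skip fail) (constP 1)
  (λ x e → _ , ask-t (cong A (toBits-bits₀ x) ∙ e) skip) (λ { x (ask-t e skip) → cong A (sym (toBits-bits₀ x)) ∙ e ; x (ask-f _ ()) })
  where
  open Registers ⊥ fin⊥
  open Strings ⊥ fin⊥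

NP-query-complement : ∀ {A} → NP[ A ] (complement A)
NP-query-complement {A} = program⇒NP (ask INP fail skip) (constP 1)
  (λ x e → _ , ask-f (cong A (toBits-bits₀ x) ∙ sym (not-involutive (A x)) ∙ cong not e) skip)
  (λ { x (ask-f e skip) → cong not (cong A (sym (toBits-bits₀ x)) ∙ e) ; x (ask-t _ ()) })
  where
  open Registers ⊥ fin⊥
  open Strings ⊥ fin⊥

-- The disjoint union plays two roles. It merges two oracles into one, and, with the first bit read
-- as a claimed answer, it is a verifier testing yes-answers by `L₁` and no-answers by `L₂`.
joinL : Lang → Lang → Lang
joinL L₁ L₂ []          = false
joinL L₁ L₂ (true ∷ x)  = L₁ x
joinL L₁ L₂ (false ∷ x) = L₂ x

module Combine {W : Set} {fW : Finite W} {A L₁ L₂ : Lang} (S₁ : Subroutine W fW A L₁) (S₂ : Subroutine W fW A L₂) where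
  open Registers W fW
  open Strings W fW
  open Subroutine S₁ renaming (call to call₁; cost to cost₁; complete to complete₁; sound to sound₁)
  open Subroutine S₂ renaming (call to call₂; cost to cost₂; complete to complete₂; sound to sound₂)

  ∨-NP : NP[ A ] (λ x → L₁ x ∨ L₂ x)
  ∨-NP = program⇒NP (amb call₁ call₂) (constP 1 ⊕ (cost₁ ⊕ cost₂))
    (λ x e → complete x (∨-true e))
    (λ { x (amb-l e) → ∨-introˡ (proj₁ (sound₁ {x} e)) ; x (amb-r e) → ∨-introʳ {L₁ x} (proj₁ (sound₂ {x} e)) })
    where
    complete : ∀ x → L₁ x ≡ true ⊎ L₂ x ≡ true → ∃[ σ' ] Exec A (amb call₁ call₂) (input x) σ' (fn (constP 1 ⊕ (cost₁ ⊕ cost₂)) (length x))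
    complete x (inj₁ e) = _ , amb-l (Exec-mono (complete₁ {x} e) (m≤m+n _ _))
    complete x (inj₂ e) = _ , amb-r (Exec-mono (complete₂ {x} e) (m≤n+m _ _))

  join-NP : NP[ A ] (joinL L₁ L₂)
  join-NP = program⇒NP prog (constP 4 ⊕ (cost₁ ⊕ cost₂)) complete sound
    where
    prog : Cmd
    prog = ifc (topIs true INP) (pop INP ⨾ call₁) (ifc (topIs false INP) (pop INP ⨾ call₂) fail)
    complete : ∀ x → joinL L₁ L₂ x ≡ true → ∃[ σ' ] Exec A prog (input x) σ' (fn (constP 4 ⊕ (cost₁ ⊕ cost₂)) (length x))
    complete (true ∷ x) e = _ , if-t refl (pop {t = 2} ⨾ Exec-mono (complete₁ {x} e) (≤-trans (mono cost₁ (n≤1+n _)) (m≤m+n _ _)))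
    complete (false ∷ x) e = _ , if-f refl (if-t refl (pop {t = 1} ⨾ Exec-mono (complete₂ {x} e) (≤-trans (mono cost₂ (n≤1+n _)) (m≤n+m _ _))))
    sound : ∀ x {σ' t} → Exec A prog (input x) σ' t → joinL L₁ L₂ x ≡ true
    sound [] (if-t () _)
    sound [] (if-f _ (if-t () _))
    sound [] (if-f _ (if-f _ ()))
    sound (true ∷ x) (if-t _ (pop ⨾ e)) = proj₁ (sound₁ {x} e)
    sound (true ∷ x) (if-f () _)
    sound (false ∷ x) (if-t () _)
    sound (false ∷ x) (if-f _ (if-t _ (pop ⨾ e))) = proj₁ (sound₂ {x} e)
    sound (false ∷ x) (if-f _ (if-f () _))

  ∧-NP : NP[ A ] (λ x → L₁ x ∧ L₂ x)
  ∧-NP = program⇒NP prog time complete sound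
    where
    prog : Cmd
    prog = copy ⨾ call₁ ⨾ move SAV INP ⨾ call₂
    time : PolyFn
    time = (constP 1 ⊕ idP) ⊗ constP 7 ⊕ (cost₁ ⊕ ((constP 1 ⊕ idP) ⊗ constP 3 ⊕ cost₂))
    restore : ∀ x → Exec A (move SAV INP) (regs [] [] [] [] [] [] [] [] (bits (x ʳ++ []))) (input x) (suc (length x) * 3)
    restore x = Exec-mono (Exec-to (cong (λ l → regs l [] [] [] [] [] [] [] []) (reverseBits (x ʳ++ []) [] ∙ cong bits (ʳ++-ʳ++-[] x [])))
                  (moveSAV-INP (bits (x ʳ++ []))))
      (≤-reflexive (cong (λ k → suc k * 3) (length-map inj₁ (x ʳ++ []) ∙ length-ʳ++ x ∙ +-identityʳ _)))
    complete : ∀ x → L₁ x ∧ L₂ x ≡ true → ∃[ σ' ] Exec A prog (input x) σ' (fn time (length x))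
    complete x e = let (e₁ , e₂) = ∧-true e in _ , copy-exec x ⨾ complete₁ {x} e₁ ⨾ restore x ⨾ complete₂ {x} e₂
    sound : ∀ x {σ' t} → Exec A prog (input x) σ' t → L₁ x ∧ L₂ x ≡ true
    sound x (e ⨾ f₁ ⨾ g ⨾ h) =
      let (e₁ , eq) = sound₁ {x} (Exec-from (Exec-det ((tt , tt , tt) , tt , tt) e (copy-exec x)) f₁)
          (e₂ , _)  = sound₂ {x} (Exec-from (Exec-det (tt , tt) (Exec-from eq g) (restore x)) h)
      in ∧-intro e₁ e₂

module _ {A L₁ L₂ : Lang} (p₁ : NP[ A ] L₁) (p₂ : NP[ A ] L₂) where
  NP-∨ : NP[ A ] (λ x → L₁ x ∨ L₂ x)
  NP-∨ = Combine.∨-NP (subroutineˡ p₁ p₂) (subroutineʳ p₁ p₂)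

  NP-∧ : NP[ A ] (λ x → L₁ x ∧ L₂ x)
  NP-∧ = Combine.∧-NP (subroutineˡ p₁ p₂) (subroutineʳ p₁ p₂)

  NP-join : NP[ A ] (joinL L₁ L₂)
  NP-join = Combine.join-NP (subroutineˡ p₁ p₂) (subroutineʳ p₁ p₂)

-- Replacing the oracle of a machine by a verifier

record Simulator (W : Set) (fW : Finite W) (M : OTM) (c : ℕ) : Set where
  open Registers W fW
  open Records W fW
  field
    sim      : Cmd
    simP     : PolyFn
    complete : ∀ {A x tr env sav} → Run M (poly c (length x)) (initial M x) tr →
      Exec A sim (regs (bits x) [] [] [] [] [] [] env sav) (regs [] [] [] [] [] [] (records tr []) env sav) (fn simP (length x))
      × length (records tr []) ≤ fn simP (length x)
    sound    : ∀ {A x env sav σ t} → Exec A sim (regs (bits x) [] [] [] [] [] [] env sav) σ t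
      → ∃[ tr ] (Run M (poly c (length x)) (initial M x) tr × σ ≡ regs [] [] [] [] [] [] (records tr []) env sav)

simulator : ∀ {W M} c (fW : Finite W) (emb : TSym M → W) (prj : W → Maybe (TSym M)) → (∀ s → prj (emb s) ≡ just s) → Simulator W fW M c
simulator {W} {M} c fW emb prj prj-emb = record
  { sim = simulate c ; simP = simulateP c ; complete = λ {A} {x} → simulate-complete {A} {c} {x} ; sound = λ {A} {x} → simulate-sound {A} {c} {x} }
  where open Simulation W fW M emb prj prj-emb

module Relativize {W : Set} {fW : Finite W} {M : OTM} {c : ℕ} {A Y : Lang} (S : Simulator W fW M c) (C : Subroutine W fW A Y) where
  open Registers W fW
  open Records W fW
  open Strings W fW
  open Simulator S renaming (complete to sim-complete; sound to sim-sound)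
  open Subroutine C renaming (complete to call-complete; sound to call-sound)

  Answers : Str → Bool → Str → Bool
  Answers e b q = Y (b ∷ pair q e)

  -- `recall` takes one recorded query off `SAV` and assembles the verifier's input `b ∷ pair q e`.
  -- As `e` is wanted again for every query, it is duplicated on the way, one copy returning to
  -- `ENV`.
  copyBack recall checkAll program : Cmd
  copyBack = while (has WL) (put INP (top WL) ⨾ put ENV (top WL) ⨾ pop WL)
  recall   = move ENV WL ⨾ copyBack ⨾ put INP (const′ (bit false)) ⨾ pairUp ⨾
             ifc (λ v → isMarkOf true (lookup v SAV)) (put INP (const′ (bit true))) (put INP (const′ (bit false))) ⨾ pop SAV
  checkAll = while (has SAV) (recall ⨾ call)
  program  = split ⨾ sim ⨾ move REC SAV ⨾ checkAll

  -- Moving `REC` to `SAV` puts the oldest query on top, with its bits reversed and its mark below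
  -- them. That is the order in which `pairUp` can consume it: the reversed bits rebuild `q`, and
  -- the mark both stops the loop and supplies the answer.
  queue : Trace → List Sym
  queue []             = []
  queue ((b , q) ∷ tr) = bits (q ʳ++ []) ++ mark b ∷ queue tr

  records-queue : ∀ tr rec acc → records tr rec ʳ++ acc ≡ rec ʳ++ (queue tr ++ acc)
  records-queue [] rec acc = refl
  records-queue ((b , q) ∷ tr) rec acc = records-queue tr (mark b ∷ bits q ++ rec) acc ∙ ++-ʳ++ (bits q)
    ∙ cong (rec ʳ++_) (bits-ʳ++ q [] ∙ sym (++-assocL (bits (q ʳ++ [])) (mark b ∷ queue tr) acc))
    where
    bits-ʳ++ : ∀ q u {z} → bits q ʳ++ (bits u ++ z) ≡ bits (q ʳ++ u) ++ z
    bits-ʳ++ [] u = refl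
    bits-ʳ++ (b ∷ q) u = bits-ʳ++ q (b ∷ u)

  queue-records : ∀ tr → records tr [] ʳ++ [] ≡ queue tr
  queue-records tr = records-queue tr [] [] ∙ ++-identityʳ (queue tr)

  private
    length-bits : ∀ q → length (bits (q ʳ++ [])) ≡ length q
    length-bits q = length-map inj₁ (q ʳ++ []) ∙ length-ʳ++ q ∙ +-identityʳ _

    length-queue : ∀ b q tr → length (queue ((b , q) ∷ tr)) ≡ length q + suc (length (queue tr))
    length-queue b q tr = length-++ (bits (q ʳ++ [])) ∙ cong (_+ suc (length (queue tr))) (length-bits q)

    queue-length : ∀ tr → length tr ≤ length (queue tr)
    queue-length [] = z≤n
    queue-length ((b , q) ∷ tr) = ≤-trans (s≤s (queue-length tr)) (≤-trans (m≤n+m _ (length q)) (≤-reflexive (sym (length-queue b q tr))))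

    queue-short : ∀ tr {k} → length (queue tr) ≤ k → All (λ bq → length (proj₂ bq) ≤ k) tr
    queue-short [] le = []
    queue-short ((b , q) ∷ tr) {k} le = ≤-trans (m≤m+n _ _) le′ ∷ queue-short tr (≤-trans (≤-trans (n≤1+n _) (m≤n+m _ (length q))) le′)
      where
      le′ : length q + suc (length (queue tr)) ≤ k
      le′ = ≤-trans (≤-reflexive (sym (length-queue b q tr))) le

    nonempty : ∀ (l : List Sym) {a l'} → is-just (nth 0 (l ++ a ∷ l')) ≡ true
    nonempty [] = refl
    nonempty (_ ∷ _) = refl

  recallT : ℕ → ℕ → ℕ
  recallT q e = suc e * 3 + (suc e * 4 + (1 + (suc q * 4 + (2 + 1))))

  copyBack-exec : ∀ z i e {ql qr s clk rec sav} → Exec A copyBack (regs (bits i) (bits z) ql qr s clk rec (bits e) sav)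
                    (regs (bits (z ʳ++ i)) [] ql qr s clk rec (bits (z ʳ++ e)) sav) (suc (length z) * 4)
  copyBack-exec [] i e = while-f refl
  copyBack-exec (b ∷ z) i e = while-t refl (put₁ ⨾ put₁ ⨾ pop₁) (copyBack-exec z (b ∷ i) (b ∷ e))

  recall-exec : ∀ b q e l → Exec A recall (regs [] [] [] [] [] [] [] (bits e) (bits (q ʳ++ []) ++ mark b ∷ l))
                               (regs (bits (b ∷ pair q e)) [] [] [] [] [] [] (bits e) l) (recallT (length q) (length e))
  recall-exec b q e l =
    Exec-mono (Exec-to (cong (λ z → regs [] z [] [] [] [] [] [] (bits (q ʳ++ []) ++ mark b ∷ l)) (reverseBits e [])) (moveENV-WL (bits e)))
      (≤-reflexive (cong (λ k → suc k * 3) (length-map inj₁ e))) ⨾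
    Exec-mono (Exec-to (cong (λ z → regs (bits z) [] [] [] [] [] [] (bits z) (bits (q ʳ++ []) ++ mark b ∷ l)) (ʳ++-ʳ++-[] e [])) (copyBack-exec (e ʳ++ []) [] []))
      (≤-reflexive (cong (λ k → suc k * 4) (length-ʳ++ e ∙ +-identityʳ _))) ⨾
    put₁ ⨾
    Exec-mono (Exec-to (cong (λ z → regs (bits (pair z e)) [] [] [] [] [] [] (bits e) (mark b ∷ l)) (ʳ++-ʳ++-[] q [])) (pairUp-exec (q ʳ++ []) [] e refl))
      (≤-reflexive (cong (λ k → suc k * 4) (length-ʳ++ q ∙ +-identityʳ _))) ⨾
    answer b ⨾ pop₁
    where
    answer : ∀ b → Exec A (ifc (λ v → isMarkOf true (lookup v SAV)) (put INP (const′ (bit true))) (put INP (const′ (bit false))))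
                     (regs (bits (pair q e)) [] [] [] [] [] [] (bits e) (mark b ∷ l)) (regs (bits (b ∷ pair q e)) [] [] [] [] [] [] (bits e) (mark b ∷ l)) 2
    answer true = if-t refl put₁
    answer false = if-f refl put₁

  recall-det : Det recall
  recall-det = (tt , tt) , (tt , tt , tt) , tt , (tt , tt , tt) , (tt , tt) , tt

  stepT : ℕ → ℕ → ℕ
  stepT q e = suc (recallT q e + fn cost (suc (suc (q * 2 + e))))

  stepT-mono : ∀ {q q' e e'} → q ≤ q' → e ≤ e' → stepT q e ≤ stepT q' e'
  stepT-mono q≤ e≤ = s≤s (+-mono-≤ (+-mono-≤ (*-monoˡ-≤ 3 (s≤s e≤)) (+-mono-≤ (*-monoˡ-≤ 4 (s≤s e≤)) (s≤s (+-monoˡ-≤ 3 (*-monoˡ-≤ 4 (s≤s q≤))))))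
    (mono cost (s≤s (s≤s (+-mono-≤ (*-monoˡ-≤ 2 q≤) e≤)))))

  checkAll-complete : ∀ tr e k → Sat (Answers e) tr → All (λ bq → length (proj₂ bq) ≤ k) tr →
    Exec A checkAll (regs [] [] [] [] [] [] [] (bits e) (queue tr)) (regs [] [] [] [] [] [] [] (bits e) []) (suc (length tr) * stepT k (length e))
  checkAll-complete [] e k s m = while-f refl
  checkAll-complete ((b , q) ∷ tr) e k (y ∷ s) (m ∷ ms) = Exec-mono
    (while-t (nonempty (bits (q ʳ++ []))) (recall-exec b q e (queue tr) ⨾ call-complete {b ∷ pair q e} y) (checkAll-complete tr e k s ms))
    (+-monoˡ-≤ _ (≤-trans (s≤s (+-monoʳ-≤ (recallT (length q) (length e)) (≤-reflexive (cong (λ j → fn cost (suc j)) (length-pair q e))))) (stepT-mono m ≤-refl)))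

  checkAll-sound : ∀ tr e {σ t} → Exec A checkAll (regs [] [] [] [] [] [] [] (bits e) (queue tr)) σ t → Sat (Answers e) tr
  checkAll-sound [] e _ = []
  checkAll-sound ((b , q) ∷ tr) e (while-f x) with sym (nonempty (bits (q ʳ++ []))) ∙ x
  ... | ()
  checkAll-sound ((b , q) ∷ tr) e {σ} (while-t _ (r ⨾ f) g) =
    proj₁ called ∷ checkAll-sound tr e (Exec-from (proj₂ called) g)
    where
    called : Y (b ∷ pair q e) ≡ true × _ ≡ regs [] [] [] [] [] [] [] (bits e) (queue tr)
    called = call-sound {b ∷ pair q e} (Exec-from (Exec-det recall-det r (recall-exec b q e (queue tr))) f)

  timeP : PolyFn
  timeP = linearP 14 ⊕ (simP ⊕ ((constP 1 ⊕ simP) ⊗ constP 3 ⊕ (constP 1 ⊕ simP) ⊗ D))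
    where
    D : PolyFn
    D = constP 1 ⊕ (((constP 1 ⊕ idP) ⊗ constP 3 ⊕ ((constP 1 ⊕ idP) ⊗ constP 4 ⊕ (constP 1 ⊕ ((constP 1 ⊕ simP) ⊗ constP 4 ⊕ constP 3))))
          ⊕ cost ⊚ (constP 2 ⊕ (simP ⊗ constP 2 ⊕ idP)))

  L~ : Lang
  L~ w = runs M (Answers (snd w)) (poly c (length (fst w))) (initial M (fst w))

  program-complete : ∀ w {tr} → Run M (poly c (length (fst w))) (initial M (fst w)) tr → Sat (Answers (snd w)) tr
                   → Exec A program (input w) (regs [] [] [] [] [] [] [] (bits (snd w)) []) (fn timeP (length w))
  program-complete w {tr} r s = let (e , short) = sim-complete {A} r in
    split-exec w ⨾ Exec-mono (e ⨾
      Exec-to (cong (λ l → regs [] [] [] [] [] [] [] (bits (snd w)) l) (queue-records tr)) (moveREC-SAV (records tr [])) ⨾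
      checkAll-complete tr (snd w) (fn simP (length w)) s (queue-short tr (q≤ short)))
      (+-mono-≤ sim≤ (+-mono-≤ (*-monoˡ-≤ 3 (s≤s (≤-trans short sim≤)))
        (*-mono-≤ (s≤s (≤-trans (queue-length tr) (q≤ short))) (stepT-mono {fn simP (length w)} ≤-refl (length-snd w)))))
    where
    sim≤ : fn simP (length (fst w)) ≤ fn simP (length w)
    sim≤ = mono simP (length-fst w)
    q≤ : length (records tr []) ≤ fn simP (length (fst w)) → length (queue tr) ≤ fn simP (length w)
    q≤ short = ≤-trans (≤-reflexive (cong length (sym (queue-records tr)) ∙ length-ʳ++ (records tr []) ∙ +-identityʳ _)) (≤-trans short sim≤)

  split-det : Det split
  split-det = (tt , (tt , tt) , tt) , tt , (tt , tt) , (tt , tt) , tt , tt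

  program-sound : ∀ w {σ t} → Exec A program (input w) σ t → L~ w ≡ true
  program-sound w {σ} (e ⨾ f ⨾ g ⨾ h) = conclude (sim-sound {A} {fst w} (Exec-from (Exec-det split-det e (split-exec w)) f)) g h
    where
    conclude : ∀ {σ₁ σ₂ t t'} → ∃[ tr ] (Run M (poly c (length (fst w))) (initial M (fst w)) tr × σ₁ ≡ regs [] [] [] [] [] [] (records tr []) (bits (snd w)) [])
             → Exec A (move REC SAV) σ₁ σ₂ t → Exec A checkAll σ₂ σ t' → L~ w ≡ true
    conclude (tr , r , eq) g h = Run⇒runs M r (checkAll-sound tr (snd w)
      (Exec-from (Exec-det (tt , tt) (Exec-from eq g) (moveREC-SAV (records tr [])) ∙ cong (λ l → regs [] [] [] [] [] [] [] (bits (snd w)) l) (queue-records tr)) h))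

  relativized : NP[ A ] L~
  relativized = program⇒NP program timeP
    (λ w e → let (tr , r , s) = runs⇒Run M _ _ e in _ , program-complete w r s) (λ w → program-sound w)

NP-relativize : ∀ M c {A Y} → NP[ A ] Y → NP[ A ] (λ w → runs M (λ b q → Y (b ∷ pair q (snd w))) (poly c (length (fst w))) (initial M (fst w)))
NP-relativize M c {A} p = Relativize.relativized {W} {fW} {M} {c}
  (simulator c fW inj₁ (λ { (inj₁ s) → just s ; (inj₂ _) → nothing }) (λ _ → refl))
  (subroutine fW p inj₂ (λ { (inj₁ _) → nothing ; (inj₂ s) → just s }) (λ _ → refl))
  where
  W : Set
  W = TSym M ⊎ TSym (proj₁ p)
  fW : Finite W
  fW = fin⊎ (finTSym M) (finTSym (proj₁ p))

-- The polynomial hierarchy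

anyStr : ℕ → (Str → Bool) → Bool
anyStr zero    p = p []
anyStr (suc n) p = p [] ∨ (anyStr n (p ∘ (true ∷_)) ∨ anyStr n (p ∘ (false ∷_)))

anyStr-intro : ∀ n {p} u → length u ≤ n → p u ≡ true → anyStr n p ≡ true
anyStr-intro zero [] _ e = e
anyStr-intro (suc n) [] _ e = ∨-introˡ e
anyStr-intro (suc n) {p} (true ∷ u) (s≤s le) e = ∨-introʳ {p []} (∨-introˡ (anyStr-intro n u le e))
anyStr-intro (suc n) {p} (false ∷ u) (s≤s le) e = ∨-introʳ {p []} (∨-introʳ {anyStr n (p ∘ (true ∷_))} (anyStr-intro n u le e))

anyStr-elim : ∀ n {p} → anyStr n p ≡ true → ∃[ u ] (length u ≤ n × p u ≡ true)
anyStr-elim zero e = [] , z≤n , e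
anyStr-elim (suc n) {p} e with ∨-true {p []} e
... | inj₁ e₁ = [] , z≤n , e₁
... | inj₂ e₂ with ∨-true {anyStr n (p ∘ (true ∷_))} e₂
... | inj₁ e₃ = let (u , le , e′) = anyStr-elim n e₃ in true ∷ u , s≤s le , e′
... | inj₂ e₃ = let (u , le , e′) = anyStr-elim n e₃ in false ∷ u , s≤s le , e′

-- Oracles that agree pointwise need not be equal as functions; the runs are transferred through
-- their traces, which mention single values only.
NP-resp-oracle : ∀ {A B L} → A ≐ B → NP[ A ] L → NP[ B ] L
NP-resp-oracle {A} {B} eq (M , c , spec) = M , c , λ x → (λ e → change eq (proj₁ (spec x) e)) , (λ a → proj₂ (spec x) (change (sym ∘ eq) a))
  where
  Sat-resp : ∀ {A B} → A ≐ B → ∀ {tr} → Sat (answers A) tr → Sat (answers B) tr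
  Sat-resp eq [] = []
  Sat-resp eq {tr = (true , q) ∷ _} (e ∷ s) = (sym (eq q) ∙ e) ∷ Sat-resp eq s
  Sat-resp eq {tr = (false , q) ∷ _} (e ∷ s) = (cong not (sym (eq q)) ∙ e) ∷ Sat-resp eq s
  change : ∀ {A B n c} → A ≐ B → AcceptsIn M A n c → AcceptsIn M B n c
  change eq a = let (_ , r , s) = AcceptsIn⇒Run M a in Run⇒AcceptsIn M r (Sat-resp eq s)

-- Y verifies the answers of the original oracle B in the presence of the
-- environment e.
relativize : ∀ {A B L Y} (p : NP[ B ] L) → NP[ A ] Y → ∃[ L~ ] (NP[ A ] L~ ×
  (∀ q e → (∀ b u → length u ≤ poly (proj₁ (proj₂ p)) (length q) → Y (b ∷ pair u e) ≡ answers B b u) → L~ (pair q e) ≡ L q))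
relativize {A} {B} {L} {Y} (M , c , spec) y = _ , NP-relativize M c y , correct
  where
  ans : Str → Bool → Str → Bool
  ans e b u = Y (b ∷ pair u e)
  n : Str → ℕ
  n q = poly c (length q)
  Sat-short : ∀ {Y Y' : Bool → Str → Bool} {k tr} → (∀ b u → length u ≤ k → Y b u ≡ Y' b u) → Short M k tr → Sat Y tr → Sat Y' tr
  Sat-short eq [] [] = []
  Sat-short {tr = (b , u) ∷ _} eq (m ∷ ms) (e ∷ s) = (sym (eq b u m) ∙ e) ∷ Sat-short eq ms s
  transfer : ∀ {Y Y' q} → (∀ b u → length u ≤ n q → Y b u ≡ Y' b u) → runs M Y (n q) (initial M q) ≡ true → runs M Y' (n q) (initial M q) ≡ true
  -- A run of `n q` steps asks only strings of length at most `n q`, so agreement of the tests on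
  -- these is enough.
  transfer {Y} {q = q} eq e = let (_ , r , s) = runs⇒Run M {Y} (n q) (initial M q) e in Run⇒runs M r (Sat-short eq (queries-poly M r) s)
  correct : ∀ q e → (∀ b u → length u ≤ n q → ans e b u ≡ answers B b u)
          → runs M (ans (snd (pair q e))) (n (fst (pair q e))) (initial M (fst (pair q e))) ≡ L q
  correct q e eq rewrite fst-pair q e | snd-pair q e =
    bool-ext (transfer {ans e} {answers B} eq) (transfer {answers B} {ans e} (λ b u le → sym (eq b u le))) ∙ sym (accepts≡runs M {B} {c} {L} spec q)

-- A guessed answer about `u` is tested by asking `A` about `f u`. No environment is called for, so
-- `x` itself fills that place.
NP-lift : ∀ {A B L f} → Transducer (Graph f) → (∀ q → A (f q) ≡ B q) → NP[ B ] L → NP[ A ] L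
NP-lift {A} {B} {L} {f} t eq p =
  let (L~ , p~ , correct) = relativize p (NP-join (NP-preimage fstT (NP-preimage t NP-query)) (NP-preimage fstT (NP-preimage t NP-query-complement)))
  in NP-resp (λ x → correct x x (λ b u _ → answered x b u)) (NP-preimage dupT p~)
  where
  answered : ∀ x b u → joinL (λ w → A (f (fst w))) (λ w → not (A (f (fst w)))) (b ∷ pair u x) ≡ answers B b u
  answered x true u = cong (A ∘ f) (fst-pair u x) ∙ eq u
  answered x false u = cong not (cong (A ∘ f) (fst-pair u x) ∙ eq u)

-- Sigma, with level 0 replaced by the empty oracle so that every successor
-- step is a relativization.
K : ℕ → Class
K zero    L = L ≐ emptyLang
K (suc j) L = Σ[ A ∈ Lang ] (K j A × NP[ A ] L)

K⇒Sigma : ∀ j {L} → K (suc j) L → Sigma (suc j) L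
K⇒Sigma zero (A , e , p) = NP-resp-oracle e p
K⇒Sigma (suc j) (A , a , p) = A , K⇒Sigma j a , p

Sigma⇒K : ∀ j {L} → Sigma (suc j) L → K (suc j) L
Sigma⇒K zero p = emptyLang , (λ _ → refl) , p
Sigma⇒K (suc j) (A , a , p) = A , Sigma⇒K j a , p

K-resp : ∀ j {L L'} → L ≐ L' → K j L → K j L'
K-resp zero eq e x = sym (eq x) ∙ e x
K-resp (suc j) eq (A , a , p) = A , a , NP-resp eq p

-- Mutual with `NP-common`: joining two languages of level j + 1 takes a common oracle of level j,
-- and the join of their oracles is one. At level 0 the join of empty languages is empty.
K-join : ∀ j {L₁ L₂} → K j L₁ → K j L₂ → K j (joinL L₁ L₂)
NP-common : ∀ j {A₁ A₂} → K j A₁ → K j A₂ → ∃[ A ] (K j A × (∀ {L} → NP[ A₁ ] L → NP[ A ] L) × (∀ {L} → NP[ A₂ ] L → NP[ A ] L))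

K-join zero e₁ e₂ [] = refl
K-join zero e₁ e₂ (true ∷ x) = e₁ x
K-join zero e₁ e₂ (false ∷ x) = e₂ x
K-join (suc j) (A₁ , a₁ , p₁) (A₂ , a₂ , p₂) =
  let (A , a , l , r) = NP-common j a₁ a₂ in A , a , NP-join (l p₁) (r p₂)

NP-common j {A₁} {A₂} a₁ a₂ = joinL A₁ A₂ , K-join j a₁ a₂ , NP-lift (consT true) (λ _ → refl) , NP-lift (consT false) (λ _ → refl)

K-∧ : ∀ {j L₁ L₂} → K (suc j) L₁ → K (suc j) L₂ → K (suc j) (λ x → L₁ x ∧ L₂ x)
K-∧ {j} (A₁ , a₁ , p₁) (A₂ , a₂ , p₂) = let (A , a , l , r) = NP-common j a₁ a₂ in A , a , NP-∧ (l p₁) (r p₂)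

K-∨ : ∀ {j L₁ L₂} → K (suc j) L₁ → K (suc j) L₂ → K (suc j) (λ x → L₁ x ∨ L₂ x)
K-∨ {j} (A₁ , a₁ , p₁) (A₂ , a₂ , p₂) = let (A , a , l , r) = NP-common j a₁ a₂ in A , a , NP-∨ (l p₁) (r p₂)

K-preimage : ∀ {j L f} → Transducer (Graph f) → K (suc j) L → K (suc j) (L ∘ f)
K-preimage t (A , a , p) = A , a , NP-preimage t p

-- The quantifier costs no level, because the guess of `u` is made by the nondeterministic machine
-- itself.
K-exists : ∀ {j L} c → K (suc j) L → K (suc j) (λ x → anyStr (poly c (length x)) (λ u → L (pair u x)))
K-exists {L = L} c (A , a , p) = A , a , NP-transduce (guessT c) p
  (λ x e → let (u , le , e′) = anyStr-elim (poly c (length x)) e in pair u x , (u , le , refl) , e′)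
  (λ { {x} (u , le , refl) e → anyStr-intro (poly c (length x)) u le e })

K-suc : ∀ {j L} → K j L → K (suc j) L
K-suc a = _ , a , NP-query

K-complement : ∀ {j L} → K j L → K (suc j) (complement L)
K-complement a = _ , a , NP-query-complement

K-lift : ∀ d {j L} → K j L → K (d + j) L
K-lift zero a = a
K-lift (suc d) a = K-suc (K-lift d a)

-- Iterated differences and decreasing sequences

diff : List Lang → Lang
diff []       x = false
diff (A ∷ As) x = A x ∧ not (diff As x)

DIFF⇒diff : ∀ m {C : Class} {L} → DIFF (suc m) C L → Σ[ A ∈ Lang ] Σ[ As ∈ List Lang ] (length As ≡ m × All C (A ∷ As) × L ≐ diff (A ∷ As))
DIFF⇒diff zero {L = L} p = L , [] , refl , p ∷ [] , λ x → sym (∧-identityʳ (L x))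
DIFF⇒diff (suc m) (L₁ , L₂ , p , q , eq) =
  let (A , As , len , ps , eq₂) = DIFF⇒diff m q
  in L₁ , A ∷ As , cong suc len , p ∷ ps , λ x → eq x ∙ cong (λ b → L₁ x ∧ not b) (eq₂ x)

diff⇒DIFF : ∀ {C : Class} → (∀ {L L'} → L ≐ L' → C L → C L') → ∀ A As {L} → All C (A ∷ As) → L ≐ diff (A ∷ As) → DIFF (suc (length As)) C L
diff⇒DIFF resp A [] (p ∷ []) eq = resp (λ x → sym (eq x ∙ ∧-identityʳ (A x))) p
diff⇒DIFF resp A (A' ∷ As) (p ∷ ps) eq = A , diff (A' ∷ As) , p , diff⇒DIFF resp A' As ps (λ _ → refl) , eq

diff-preimage : ∀ f As x → diff (map (_∘ f) As) x ≡ diff As (f x)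
diff-preimage f [] x = refl
diff-preimage f (A ∷ As) x = cong (λ b → A (f x) ∧ not b) (diff-preimage f As x)

-- Both halves go through the induction together, since subtraction makes each half for a list
-- depend on the opposite half for its tail.
K-diff : ∀ {j} A As → All (K j) (A ∷ As) → K (suc j) (diff (A ∷ As)) × K (suc j) (complement (diff (A ∷ As)))
K-diff {j} A [] (a ∷ []) = K-suc single , K-complement single
  where
  single : K j (λ x → A x ∧ true)
  single = K-resp j (λ x → sym (∧-identityʳ (A x))) a
K-diff {j} A (A' ∷ As) (a ∷ as) =
  let (p , n) = K-diff A' As as
  in K-∧ (K-suc a) n ,
     K-resp (suc j) (λ x → deMorgan (A x) (diff (A' ∷ As) x)) (K-∨ (K-complement a) p)
  where
  deMorgan : ∀ a d → (not a ∨ d) ≡ not (a ∧ not d)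
  deMorgan true d = sym (not-involutive d)
  deMorgan false d = refl

-- Running intersections, the usual way to make the sets of an iterated difference decreasing;
-- inside `P` the difference is unchanged.
nest : Lang → List Lang → List Lang
nest P []       = []
nest P (A ∷ As) = (λ x → P x ∧ A x) ∷ nest (λ x → P x ∧ A x) As

length-nest : ∀ P As → length (nest P As) ≡ length As
length-nest P [] = refl
length-nest P (A ∷ As) = cong suc (length-nest _ As)

K-nest : ∀ {j P} As → K (suc j) P → All (K (suc j)) As → All (K (suc j)) (nest P As)
K-nest [] p [] = []
K-nest (A ∷ As) p (a ∷ as) = K-∧ p a ∷ K-nest As (K-∧ p a) as

diff-nest : ∀ P As x → diff (nest P As) x ≡ P x ∧ diff As x
diff-nest P [] x = sym (∧-zeroʳ (P x))
diff-nest P (A ∷ As) x = cong (λ b → (P x ∧ A x) ∧ not b) (diff-nest _ As x) ∙ cases (P x) (A x) (diff As x)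
  where
  cases : ∀ p a d → (p ∧ a) ∧ not ((p ∧ a) ∧ d) ≡ p ∧ (a ∧ not d)
  cases true true d = refl
  cases true false d = refl
  cases false a d = refl

Decreasing : List Lang → Set
Decreasing []       = ⊤
Decreasing (P ∷ Ps) = All (λ Q → ∀ w → Q w ≡ true → P w ≡ true) Ps × Decreasing Ps

nest-below : ∀ P As → All (λ Q → ∀ w → Q w ≡ true → P w ≡ true) (nest P As)
nest-below P [] = []
nest-below P (A ∷ As) = (λ w e → proj₁ (∧-true {P w} e)) ∷ weaken (nest-below _ As)
  where
  weaken : ∀ {Ps} → All (λ Q → ∀ w → Q w ≡ true → P w ∧ A w ≡ true) Ps → All (λ Q → ∀ w → Q w ≡ true → P w ≡ true) Ps
  weaken [] = []
  weaken (h ∷ hs) = (λ w e → proj₁ (∧-true {P w} (h w e))) ∷ weaken hs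

nest-decreasing : ∀ P As → Decreasing (nest P As)
nest-decreasing P [] = tt
nest-decreasing P (A ∷ As) = nest-below _ As , nest-decreasing _ As

module Projection (bad : Lang) (n : ℕ) (x : Str) where

  project : Lang → Bool
  project P = anyStr n (λ u → bad (pair u x) ∧ P (pair u x))

  Witness : Str → Set
  Witness u = length u ≤ n × bad (pair u x) ≡ true

  project-intro : ∀ P {u} → Witness u → P (pair u x) ≡ true → project P ≡ true
  project-intro P {u} (le , b) e = anyStr-intro n u le (∧-intro b e)

  project-elim : ∀ P → project P ≡ true → ∃[ u ] (Witness u × P (pair u x) ≡ true)
  project-elim P e = let (u , le , e′) = anyStr-elim n e ; (b , p) = ∧-true {bad (pair u x)} e′ in u , (le , b) , p

  not-projected : ∀ P {u} → Witness u → project P ≡ false → P (pair u x) ≡ false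
  not-projected P {u} w e with P (pair u x) in eq
  ... | false = refl
  ... | true with sym (project-intro P w eq) ∙ e
  ... | ()

  -- A witness for the tail is kept unless it misses `P` although some other witness `v` lies in
  -- `P`. In that case it misses all later sets too, as they are contained in `P`; so their
  -- projections are false, every witness misses them, and `v` can take over.
  common-witness : ∀ Ps → Decreasing Ps → ∃[ u ] Witness u → ∃[ u ] (Witness u × All (λ P → project P ≡ P (pair u x)) Ps)
  common-witness [] _ (u , w) = u , w , []
  common-witness (P ∷ Ps) (below , dec) w₀ with common-witness Ps dec w₀
  ... | u , w , eqs with project P in eP | P (pair u x) in eu
  ... | false | false = u , w , (eP ∙ sym eu) ∷ eqs
  ... | true  | true  = u , w , (eP ∙ sym eu) ∷ eqs
  ... | false | true  with sym (project-intro P w eu) ∙ eP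
  ... | ()
  common-witness (P ∷ Ps) (below , dec) w₀ | u , w , eqs | true | false =
    let (v , wv , ev) = project-elim P eP in v , wv , (eP ∙ sym ev) ∷ others wv below eqs
    where
    others : ∀ {v Qs} → Witness v → All (λ Q → ∀ w → Q w ≡ true → P w ≡ true) Qs → All (λ Q → project Q ≡ Q (pair u x)) Qs
           → All (λ Q → project Q ≡ Q (pair v x)) Qs
    others wv [] [] = []
    others {Qs = Q ∷ _} wv (b ∷ bs) (e ∷ es) = (none ∙ sym (not-projected Q wv none)) ∷ others wv bs es
      where
      Q-false : Q (pair u x) ≡ false
      Q-false with Q (pair u x) in eQ
      ... | false = refl
      ... | true with sym (b (pair u x) eQ) ∙ eu
      ... | ()
      none : project Q ≡ false
      none = e ∙ Q-false

-- Chains of oracles and their collapse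

data Chain (S : Lang) : ℕ → Lang → Set where
  base : Chain S 0 S
  link : ∀ {d A L} → Chain S d A → NP[ A ] L → Chain S (suc d) L

K⇒Chain : ∀ d {i B} → K (d + i) B → ∃[ S ] (K i S × Chain S d B)
K⇒Chain zero a = _ , a , base
K⇒Chain (suc d) (A , a , p) = let (S , s , ch) = K⇒Chain d a in S , s , link ch p

common-oracle : ∀ {j} A As → All (K (suc j)) (A ∷ As) → ∃[ O ] (K j O × All NP[ O ] (A ∷ As))
common-oracle A [] ((O , o , p) ∷ []) = O , o , p ∷ []
common-oracle {j} A (A' ∷ As) ((O₁ , o₁ , p) ∷ ps) =
  let (O₂ , o₂ , qs) = common-oracle A' As ps ; (O , o , l , r) = NP-common j o₁ o₂ in O , o , l p ∷ lift r qs
  where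
  lift : ∀ {O₂ O} → (∀ {L} → NP[ O₂ ] L → NP[ O ] L) → ∀ {Ls} → All NP[ O₂ ] Ls → All NP[ O ] Ls
  lift r [] = []
  lift r (q ∷ qs) = r q ∷ lift r qs

module Collapse {i : ℕ} (S S' : Lang) (s : K (suc i) S) (s' : K (suc i) S') where

  Good : PolyFn → Str → Set
  Good p x = ∀ u → length u ≤ fn p (length x) → S' (pair u x) ≡ not (S u)

  -- If ¬S reduces to S' via u ↦ pair u x on all short u, then every level
  -- above S drops by one.
  collapse : ∀ d {B} → Chain S (suc d) B → (r : PolyFn) → ∃[ p ] ∃[ B~ ] (K (d + suc i) B~ ×
    (∀ x → Good p x → ∀ q → length q ≤ fn r (length x) → B~ (pair q x) ≡ B q))
  collapse zero (link base p) r =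
    let (A₁ , a₁ , p₁) = s ; (A₂ , a₂ , p₂) = s'
        (A , a , l , r′) = NP-common i a₁ a₂
        -- A yes-answer about `S` is tested by `S` and a no-answer by `S'` at `pair u x`. Both tests
        -- are nondeterministic with the oracle `A` below `S`, so the level of `S` is saved.
        (B~ , b , correct) = relativize p (NP-join (NP-preimage fstT (l p₁)) (r′ p₂))
    in polyP c ⊚ r , B~ , (A , a , b) , λ x good q le → correct q x (λ b u le′ → answered x b u (good u (≤-trans le′ (poly-mono c le))))
    where
    c : ℕ
    c = proj₁ (proj₂ p)
    answered : ∀ x b u → S' (pair u x) ≡ not (S u) → joinL (S ∘ fst) S' (b ∷ pair u x) ≡ answers S b u
    answered x true u _ = cong S (fst-pair u x)
    answered x false u e = e
  collapse (suc d) (link {A = A} ch p) r =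
    let (p′ , A~ , a , correct) = collapse d ch (polyP c ⊚ r)
        (B~ , b , correct′) = relativize p (NP-join NP-query NP-query-complement)
    in p′ , B~ , (A~ , a , b) , λ x good q le → correct′ q x (λ b u le′ → answered x b u (correct x good u (≤-trans le′ (poly-mono c le))))
    where
    c : ℕ
    c = proj₁ (proj₂ p)
    answered : ∀ {A~} x b u → A~ (pair u x) ≡ A u → joinL A~ (complement A~) (b ∷ pair u x) ≡ answers A b u
    answered x true u e = e
    answered x false u e = cong not e

  K-diagonal : ∀ d {L} → K (d + suc i) L → K (d + suc i) (L ∘ diagonal)
  K-diagonal zero    = K-preimage dupT
  K-diagonal (suc d) = K-preimage dupT

  collapse-diff : ∀ d A As → All (Chain S (suc d)) (A ∷ As) → ∃[ p ] ∃[ A~ ] ∃[ As~ ] (All (K (d + suc i)) (A~ ∷ As~) ×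
    (∀ x → Good p x → diff (A~ ∷ As~) x ≡ diff (A ∷ As) x))
  collapse-diff d A [] (ch ∷ []) =
    let (p , A~ , a , correct) = collapse d ch idP
    -- Here `x` is both the string to be decided and the environment that supplies the reduction,
    -- hence the pair of `x` with itself.
    in p , A~ ∘ diagonal , [] , K-diagonal d a ∷ [] , λ x good → cong (_∧ true) (correct x good x ≤-refl)
  collapse-diff d A (A' ∷ As) (ch ∷ chs) =
    let (p , A~ , a , correct) = collapse d ch idP
        (p′ , A'~ , As~ , as , correct′) = collapse-diff d A' As chs
    in p ⊕ p′ , A~ ∘ diagonal , A'~ ∷ As~ , K-diagonal d a ∷ as , λ x good →
       cong₂ (λ b b′ → b ∧ not b′) (correct x (λ u le → good u (≤-trans le (m≤m+n _ _))) x ≤-refl)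
                                    (correct′ x (λ u le → good u (≤-trans le (m≤n+m _ _))))

DIFF-resp : ∀ m {C : Class} {L L'} → (∀ {L L'} → L ≐ L' → C L → C L') → L ≐ L' → DIFF m C L → DIFF m C L'
DIFF-resp (suc zero) resp eq p = resp eq p
DIFF-resp (suc (suc m)) resp eq (L₁ , L₂ , p , q , e) = L₁ , L₂ , p , q , λ x → sym (eq x) ∙ e x

Sigma-resp : ∀ j {L L'} → L ≐ L' → Sigma (suc j) L → Sigma (suc j) L'
Sigma-resp j eq p = K⇒Sigma j (K-resp (suc j) eq (Sigma⇒K j p))

diff-agree : ∀ {E : Lang → Lang} {x w} Ps → All (λ P → E P x ≡ P w) Ps → diff (map E Ps) x ≡ diff Ps w
diff-agree [] [] = refl
diff-agree (P ∷ Ps) (e ∷ es) = cong₂ (λ a b → a ∧ not b) e (diff-agree Ps es)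

diff-none : ∀ {E : Lang → Lang} {x} Ps → (∀ P → E P x ≡ false) → diff (map E Ps) x ≡ false
diff-none [] none = refl
diff-none {E} {x} (P ∷ Ps) none = cong (_∧ not (diff (map E Ps) x)) (none P)

-- The easy-hard argument

module EasyHard {d i : ℕ} (S S' D D' A' : Lang) (As' : List Lang) (s : K (suc i) S) (s' : K (suc i) S')
  (L≐ : ∀ w → not (S (fst w) xor D (snd w)) ≡ S' w xor D' w)
  (as' : All (K (suc (suc (d + suc i)))) (A' ∷ As')) (D'≐ : D' ≐ diff (A' ∷ As'))
  (p : PolyFn) (D~ : Lang) (D~-K : K (suc (suc (d + suc i))) (complement D~))
  (collapsed : ∀ x → Collapse.Good S S' s s' p x → D~ x ≡ D x) where

  -- This is k - 1: the index i of the theorem is `suc i` here, and k is `suc k′`.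
  k′ : ℕ
  k′ = suc (d + suc i)

  -- A bad pair turns a query about x ∉ D into one about D'; if x has no
  -- short bad partner, the hierarchy above S collapses by one level on x.
  bad : Lang
  bad w = (S (fst w) ∧ S' w) ∨ (not (S (fst w)) ∧ not (S' w))

  c : ℕ
  c = polyBound p

  hasBad : Lang
  hasBad x = anyStr (poly c (length x)) (λ u → bad (pair u x))

  E : Lang → Lang
  E P x = anyStr (poly c (length x)) (λ u → bad (pair u x) ∧ P (pair u x))

  -- The second disjunct vanishes as soon as a bad partner exists; otherwise all projections are
  -- empty and it alone decides. It may use the absence of a bad partner because `hasBad` lies one
  -- level below k.
  first : Lang
  first x = E A' x ∨ (not (hasBad x) ∧ not (D~ x))

  Bs : List Lang
  Bs = nest A' As'

  private
    bad-K : K (suc (suc i)) bad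
    bad-K = K-∨ (K-∧ (K-suc sf) (K-suc s')) (K-∧ (K-complement sf) (K-complement s'))
      where
      sf : K (suc i) (S ∘ fst)
      sf = K-preimage fstT s

    -- The gap between i and k - 1 is used here: badness lies one level above `S`, which is still at
    -- most k - 1.
    raise : ∀ {P} → K (suc (suc i)) P → K k′ P
    raise {P} q = subst (λ j → K j P) (+-suc d (suc i)) (K-lift d q)

    E-K : ∀ {P} → K (suc k′) P → K (suc k′) (E P)
    E-K q = K-exists c (K-∧ (K-suc (raise bad-K)) q)

    Es-K : ∀ {Ps} → All (K (suc k′)) Ps → All (K (suc k′)) (map E Ps)
    Es-K [] = []
    Es-K (q ∷ qs) = E-K q ∷ Es-K qs

  members : All (K (suc k′)) (first ∷ map E Bs)
  members = build as'
    where
    build : All (K (suc k′)) (A' ∷ As') → All (K (suc k′)) (first ∷ map E Bs)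
    build (q ∷ qs) = K-∨ (E-K q) (K-∧ (K-complement (raise (K-exists c bad-K))) D~-K) ∷ Es-K (K-nest As' q qs)

  private
    agrees : ∀ s s' → (s ∧ s') ∨ (not s ∧ not s') ≡ false → s' ≡ not s
    agrees true false e = refl
    agrees false true e = refl

    flips : ∀ s s' d d' → (s ∧ s') ∨ (not s ∧ not s') ≡ true → not (s xor d) ≡ s' xor d' → d' ≡ not d
    flips true true d d' _ e = sym (not-involutive d') ∙ cong not (sym e ∙ not-involutive d)
    flips false false d d' _ e = sym e

    absorb : ∀ a d → a ∧ not (a ∧ d) ≡ a ∧ not d
    absorb true d = refl
    absorb false d = refl

    false≢true : ∀ {b} {P : Set} → b ≡ true → b ≡ false → P
    false≢true refl ()

    -- At a bad pair, `S` and `S'` have equal values, so complementing the symmetric difference must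
    -- negate the other part: `D'` there is the complement of `D` at `x`. A common witness lets all
    -- projected sets be read off at one such pair.
    with-bad : ∀ x → hasBad x ≡ true → not (D x) ≡ diff (first ∷ map E Bs) x
    with-bad x eq =
      let (u₀ , le₀ , b₀) = anyStr-elim (poly c (length x)) eq
          (u , (le , b) , es) = common-witness (A' ∷ Bs) (nest-below A' As' , nest-decreasing A' As') (u₀ , le₀ , b₀)
      in sym (cong (λ h → (E A' x ∨ (not h ∧ not (D~ x))) ∧ not (diff (map E Bs) x)) eq
              ∙ cong (λ a → a ∧ not (diff (map E Bs) x)) (∨-identityʳ (E A' x))
              ∙ diff-agree {E} {x} {pair u x} (A' ∷ Bs) es
              ∙ cong (λ b → A' (pair u x) ∧ not b) (diff-nest A' As' (pair u x))
              ∙ absorb (A' (pair u x)) (diff As' (pair u x))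
              ∙ sym (D'≐ (pair u x))
              ∙ flips (S (fst (pair u x))) (S' (pair u x)) (D x) (D' (pair u x)) b
                  (cong (λ y → not (S (fst (pair u x)) xor D y)) (sym (snd-pair u x)) ∙ L≐ (pair u x)))
      where open Projection bad (poly c (length x)) x

    without-bad : ∀ x → hasBad x ≡ false → not (D x) ≡ diff (first ∷ map E Bs) x
    without-bad x eq =
      sym (cong₂ (λ a h → (a ∨ (not h ∧ not (D~ x))) ∧ not (diff (map E Bs) x)) (none A') eq
           ∙ cong (λ b → not (D~ x) ∧ not b) (diff-none {E} {x} Bs none)
           ∙ ∧-identityʳ (not (D~ x)) ∙ cong not (collapsed x good))
      where
      open Projection bad (poly c (length x)) x
      not-true : ∀ {b} → (b ≡ true → hasBad x ≡ true) → b ≡ false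
      not-true {false} h = refl
      not-true {true} h = false≢true (h refl) eq
      none : ∀ P → E P x ≡ false
      none P = not-true (λ e → let (u , (le , b) , _) = project-elim P e in anyStr-intro (poly c (length x)) u le b)
      good : Collapse.Good S S' s s' p x
      good u le = agrees (S u) (S' (pair u x))
        (cong (λ v → (S v ∧ S' (pair u x)) ∨ (not (S v) ∧ not (S' (pair u x)))) (sym (fst-pair u x))
         ∙ not-true (anyStr-intro (poly c (length x)) u (≤-trans le (≤-polyBound p (length x)))))

    cases : ∀ x b → hasBad x ≡ b → not (D x) ≡ diff (first ∷ map E Bs) x
    cases x true  = with-bad x
    cases x false = without-bad x

  complement-DIFF : DIFF (suc (length As')) (Sigma (suc k′)) (complement D)
  complement-DIFF = subst (λ n → DIFF (suc n) (Sigma (suc k′)) (complement D)) (length-map E Bs ∙ length-nest A' As')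
    (diff⇒DIFF (Sigma-resp k′) first (map E Bs) (mapAll (K⇒Sigma k′) members) (λ x → cases x (hasBad x) refl))

-- Closure of the difference class under complement

DIFF-preimage-snd : ∀ m j {D} → DIFF (suc m) (Sigma (suc j)) D → DIFF (suc m) (Sigma (suc j)) (D ∘ snd)
DIFF-preimage-snd m j {D} p =
  let (A , As , len , as , D≐) = DIFF⇒diff m p
  in subst (λ n → DIFF (suc n) (Sigma (suc j)) (D ∘ snd)) (length-map (_∘ snd) As ∙ len)
       (diff⇒DIFF (Sigma-resp j) (A ∘ snd) (map (_∘ snd) As) (preimages as) (λ w → D≐ (snd w) ∙ sym (diff-preimage snd (A ∷ As) w)))
  where
  preimages : ∀ {Ls} → All (Sigma (suc j)) Ls → All (Sigma (suc j)) (map (_∘ snd) Ls)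
  preimages [] = []
  preimages (p ∷ ps) = K⇒Sigma j (K-preimage sndT (Sigma⇒K j p)) ∷ preimages ps

complement-closed : ∀ m i d → ClosedUnderComplement (Sigma (suc i) Δ DIFF (suc m) (Sigma (suc (suc (d + suc i))))) →
  ∀ D → DIFF (suc m) (Sigma (suc (suc (d + suc i)))) D → DIFF (suc m) (Sigma (suc (suc (d + suc i)))) (complement D)
complement-closed m i d closed D q =
  let (A , As , _ , as , D≐) = DIFF⇒diff m q
      (O , o , ps) = common-oracle A As (mapAll (Sigma⇒K k′) as)
      (S , s , chain) = K⇒Chain (suc d) o
      (S' , D' , σ , δ , L≐) = closed (λ w → S (fst w) xor D (snd w))
        (S ∘ fst , D ∘ snd , K⇒Sigma i (K-preimage fstT s) , DIFF-preimage-snd m k′ q , λ _ → refl)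
      (A' , As' , len' , as' , D'≐) = DIFF⇒diff m δ
      -- The members of `D` are one link above `O`, so their chains have d + 2 links and their
      -- collapsed versions lie at level `k′`. A Boolean combination of these is then available,
      -- with its complement, at level k.
      (p , A~ , As~ , as~ , collapsed) = Collapse.collapse-diff S S' s (Sigma⇒K i σ) (suc d) A As (mapAll (link chain) ps)
  in subst (λ n → DIFF (suc n) (Sigma (suc k′)) (complement D)) len'
       (EasyHard.complement-DIFF {d} {i} S S' D D' A' As' s (Sigma⇒K i σ) L≐ (mapAll (Sigma⇒K k′) as') D'≐
          p (diff (A~ ∷ As~)) (proj₂ (K-diff {k′} A~ As~ as~)) (λ x good → collapsed x good ∙ sym (D≐ x)))
  where
  k′ : ℕ
  k′ = suc (d + suc i)

theorem3p1 : (m i k : ℕ) → 0 < m → 0 < i → suc i < k →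
    ClosedUnderComplement (Sigma i Δ DIFF m (Sigma k)) →
    DIFF m (Sigma k) ≡C coDIFF m (Sigma k)
theorem3p1 (suc m) (suc i) k _ _ i<k with m≤n⇒∃[o]m+o≡n i<k
-- `d` is the number of levels strictly between i and k - 1.
... | d , e = subst Claim (cong (λ j → suc (suc j)) (+-suc d i ∙ cong suc (+-comm d i)) ∙ e) claim
  where
  Claim : ℕ → Set
  Claim k = ClosedUnderComplement (Sigma (suc i) Δ DIFF (suc m) (Sigma k)) → DIFF (suc m) (Sigma k) ≡C coDIFF (suc m) (Sigma k)
  claim : Claim (suc (suc (d + suc i)))
  claim closed L = complement-closed m i d closed L , λ p →
    DIFF-resp (suc m) (Sigma-resp (suc (d + suc i))) (λ x → not-involutive (L x)) (complement-closed m i d closed (complement L) p)
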